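{- (a) Every nonnegative integer $n$ can be written as $n=p_3(x)+p_5(y)+p_{11}(z)$ with $x,y,z\in\mathbb{Z}$. (b) Every nonnegative integer $n$ can be written as $n=3p_3(x)+p_5(y)+p_7(z)$ with $x,y,z\in\mathbb{Z}$.
   Context: For an integer $m\geq 3$ and $x\in\mathbb{Z}$, $p_m(x)=(m-2)\frac{x(x-1)}{2}+x$. Thus $p_3(x)=\frac{x(x+1)}{2}$, $p_5(x)=\frac{3x^2-x}{2}$, $p_7(x)=\frac{5x^2-3x}{2}$, $p_{11}(x)=\frac{9x^2-7x}{2}$. -}

module Defs where

open import Data.Nat using (ℕ)
open import Data.Integer using (ℤ; +_; _+_; _-_; _*_; 1ℤ)
open import Data.Integer.DivMod using (_/_)

-- Polygonal number p_m(x) = (m-2) * x(x-1)/2 + x, for x ∈ ℤ.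
-- x(x-1) is always even, so the (floor) integer division by 2 is exact.
p : ℕ → ℤ → ℤ
p m x = (+ m - + 2) * ((x * (x - 1ℤ)) / (+ 2)) + x

{-# OPTIONS --safe #-}
module Submission where

open import Defs
open import Data.Nat using (ℕ; zero; suc; z≤n; s≤s)
open import Data.Integer using (ℤ; +_; _+_; _*_; _-_; -_; _^_; 0ℤ; 1ℤ; -1ℤ)
open import Data.Product using (_×_; _,_; ∃-syntax; proj₁; proj₂)
open import Relation.Binary.PropositionalEquality
open import Algebra.Structures {A = ℤ} _≡_ using (IsCommutativeMonoid)
open import Data.Bool using (Bool; true; T; _∧_; if_then_else_)
open import Data.Empty using (⊥; ⊥-elim)
open import Data.Fin using (Fin; toℕ; fromℕ<; punchOut)
import Data.Fin.Properties as Fin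
import Data.Integer as ℤ
import Data.Integer.DivMod as ℤ
open import Data.Integer.Divisibility.Signed using (_∣_; divides; ∣⇒∣ᵤ; ∣ᵤ⇒∣; ∣-trans; ∣m∣n⇒∣m+n; ∣m⇒∣-m; ∣n⇒∣m*n; ∣m⇒∣m*n)
import Data.Integer.Properties as ℤ
import Data.Integer.Solver as ℤSolver
open import Data.Integer.Tactic.RingSolver using (solve-∀)
open import Data.List using (List; []; _∷_)
import Data.List.Membership.DecPropositional as DecMembership
open import Data.List.Membership.Propositional using (_∈_)
open import Data.List.Relation.Unary.All using (_∷_)
open import Data.List.Relation.Unary.Any using (here; there)
import Data.Nat as ℕ
open import Data.Nat.Coprimality as Coprimality using (Coprime; coprime?; coprime-divisor; prime⇒coprime; coprime-Bézout)
open import Data.Nat.DivMod using (_%_; m%n<n; m≡m%n+[m/n]*n; m<n⇒m%n≡m)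
import Data.Nat.Divisibility as ℕ∣
open import Data.Nat.GCD using (module Bézout)
open import Data.Nat.Induction using (<-rec)
open import Data.Nat.Primality using (Prime; prime?; euclidsLemma; prime⇒nonTrivial; prime⇒nonZero; prime⇒irreducible)
open import Data.Nat.Primality.Factorisation using (factorise)
import Data.Nat.Properties as ℕ
import Data.Nat.Solver as ℕSolver
open import Data.Nat.Tactic.RingSolver using () renaming (solve-∀ to ℕ-solve-∀)
import Data.Product.Properties as Product
open import Data.Sum using (_⊎_; inj₁; inj₂)
open import Function using (_∘_)
open import Relation.Binary.Definitions using (DecidableEquality; tri<; tri≈; tri>)
open import Relation.Nullary using (¬_; Dec; yes; no; contradiction; ¬?; _×-dec_; _⊎-dec_; _→-dec_)
open import Relation.Nullary.Decidable using (⌊_⌋; toWitness; from-yes)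

-- Completing squares, (a) asks for 72n + 61 = 9X² + Z² + 3Y² and (b) for 120n + 77 = 5(9A² + B²) + 3Z² with odd
-- unknowns satisfying congruences modulo 3 and 5. Both follow from N = s² + t² + 3z² with s, t, z odd, for
-- N ≡ 5 (mod 8) prime to 3: rotating t + z√-3 by a sixth root of unity repairs the congruences.
-- Such N are represented by x² + u² + uv + v², the only positive even ternary lattice of determinant 6 up to
-- isometry (Selling reduction), because N lies in some such lattice: one is written down from P, k with
-- P k² ≡ -c² (mod 4N) and -3N a square modulo P.
-- They come from a factorisation n = P k² of some n ≡ ρ (mod 12N) with G(n) = Σ_{d ∣ n} χ(d) ≠ 0, where χ = (·/3N),
-- χ(ρ) = 1 and ρ ≡ -c² (mod 4N); quadratic reciprocity makes -3N a square modulo each prime q with χ(q) = 1.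
-- Such an n exists: weighted by (X - n)⁺, the sums of G over n ≡ ρ and over n ≡ 1 differ by
-- O(X log X), as double Abel summation shows, while the second one is ≫ X^{3/2} because G ≥ 0 and G(k²) ≥ 1.

-- Finite sums and products, congruences

-- `P k²` takes over the role of a prime in an arithmetic progression. The lattice asks only for its
-- class modulo 4N and for a square root of -3N modulo P; the factor k² is absorbed by the
-- coefficients of the form. For n > 0, `G n` vanishes exactly when some prime q with χ(q) = -1
-- divides n to an odd power, so G(n) ≠ 0 says just what is wanted of n. The condition χ(ρ) = 1
-- makes the two classes comparable: if d e is ρ or 1 modulo M = 12N, then χ(d) = χ(e), so χ(d)
-- ([d e ≡ ρ] - [d e ≡ 1]) is symmetric in d and e. It sums to zero over a period of e, hence also
-- of d, and its sums over rectangles are bounded. The class of 1 is the reference because it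
-- contains the squares (1 + M j)². With a sharp cutoff the squares and the error would both be of
-- order √X; the weight raises them to X^(3/2) and X log X. The choice ρ = 4N - c² takes c = 1 for N
-- ≡ 2 and c = 3 for N ≡ 1 (mod 3), so that ρ is 1 modulo 3 as well as 3 modulo 4; these two
-- congruences give χ(ρ) = 1.

Injective< : ℕ → (ℕ → ℕ) → Set
Injective< n σ = ∀ {i j} → i ℕ.< n → j ℕ.< n → σ i ≡ σ j → i ≡ j

-- A value v that is missed could be punched out of the range, leaving n arguments for n - 1 values,
-- against the pigeonhole principle.
injective<⇒surjective< : ∀ n σ → (∀ {i} → i ℕ.< n → σ i ℕ.< n) → Injective< n σ →
  ∀ {v} → v ℕ.< n → ∃[ i ] (i ℕ.< n × σ i ≡ v)
injective<⇒surjective< n σ bd inj {v} v<n with ℕ.anyUpTo? (λ i → σ i ℕ.≟ v) n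
... | yes p = p
injective<⇒surjective< (suc n) σ bd inj {v} v<n | no ∄ =
  let i , j , i<j , eq = Fin.pigeonhole (ℕ.n<1+n n) (λ k → punchOut (avoids k)) in
  contradiction (inj (Fin.toℕ<n i) (Fin.toℕ<n j)
      (trans (sym (Fin.toℕ-fromℕ< _))
        (trans (cong toℕ (Fin.punchOut-injective (avoids i) (avoids j) eq)) (Fin.toℕ-fromℕ< _))))
    (ℕ.<⇒≢ i<j)
  where
  avoids : ∀ k → fromℕ< v<n ≢ fromℕ< (bd (Fin.toℕ<n k))
  avoids k eq = ∄ (toℕ k , Fin.toℕ<n k ,
    sym (trans (sym (Fin.toℕ-fromℕ< v<n)) (trans (cong toℕ eq) (Fin.toℕ-fromℕ< _))))

module BigOp (_∙_ : ℤ → ℤ → ℤ) (ε : ℤ) (isCM : IsCommutativeMonoid _∙_ ε) where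
  open IsCommutativeMonoid isCM using (assoc; comm; identityˡ; identityʳ)
  open ≡-Reasoning

  big : ℕ → (ℕ → ℤ) → ℤ
  big zero    f = ε
  big (suc n) f = big n f ∙ f n

  big-cong : ∀ n {f g} → (∀ {i} → i ℕ.< n → f i ≡ g i) → big n f ≡ big n g
  big-cong zero    f≡g = refl
  big-cong (suc n) f≡g = cong₂ _∙_ (big-cong n (λ i<n → f≡g (ℕ.m≤n⇒m≤1+n i<n))) (f≡g (ℕ.n<1+n n))

  big-ε : ∀ n → big n (λ _ → ε) ≡ ε
  big-ε zero    = refl
  big-ε (suc n) = trans (identityʳ _) (big-ε n)

  interchange : ∀ a b c d → (a ∙ b) ∙ (c ∙ d) ≡ (a ∙ c) ∙ (b ∙ d)
  interchange a b c d = begin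
    (a ∙ b) ∙ (c ∙ d)  ≡⟨ assoc a b _ ⟩
    a ∙ (b ∙ (c ∙ d))  ≡⟨ cong (a ∙_) (assoc b c d) ⟨
    a ∙ ((b ∙ c) ∙ d)  ≡⟨ cong (λ t → a ∙ (t ∙ d)) (comm b c) ⟩
    a ∙ ((c ∙ b) ∙ d)  ≡⟨ cong (a ∙_) (assoc c b d) ⟩
    a ∙ (c ∙ (b ∙ d))  ≡⟨ assoc a c _ ⟨
    (a ∙ c) ∙ (b ∙ d)  ∎

  big-∙ : ∀ n f g → big n (λ i → f i ∙ g i) ≡ big n f ∙ big n g
  big-∙ zero    f g = sym (identityˡ ε)
  big-∙ (suc n) f g = trans (cong (_∙ (f n ∙ g n)) (big-∙ n f g)) (interchange _ _ _ _)

  big-swap : ∀ m n (f : ℕ → ℕ → ℤ) → big m (λ i → big n (f i)) ≡ big n (λ j → big m (λ i → f i j))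
  big-swap zero    n f = sym (big-ε n)
  big-swap (suc m) n f = trans (cong (_∙ big n (f m)) (big-swap m n f)) (sym (big-∙ n _ _))

  big-head : ∀ n f → big (suc n) f ≡ f 0 ∙ big n (f ∘ suc)
  big-head zero    f = trans (identityˡ _) (sym (identityʳ _))
  big-head (suc n) f = trans (cong (_∙ f (suc n)) (big-head n f)) (assoc _ _ _)

  big-split : ∀ m n f → big (m ℕ.+ n) f ≡ big m f ∙ big n (λ i → f (m ℕ.+ i))
  big-split m zero    f = trans (cong (λ k → big k f) (ℕ.+-identityʳ m)) (sym (identityʳ _))
  big-split m (suc n) f = begin
    big (m ℕ.+ suc n) f                                ≡⟨ cong (λ k → big k f) (ℕ.+-suc m n) ⟩
    big (m ℕ.+ n) f ∙ f (m ℕ.+ n)                      ≡⟨ cong (_∙ f (m ℕ.+ n)) (big-split m n f) ⟩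
    (big m f ∙ big n (λ i → f (m ℕ.+ i))) ∙ f (m ℕ.+ n) ≡⟨ assoc _ _ _ ⟩
    big m f ∙ big (suc n) (λ i → f (m ℕ.+ i))          ∎

  update : (ℕ → ℕ) → ℕ → ℕ → ℕ → ℕ
  update σ i x j with j ℕ.≟ i
  ... | yes _ = x
  ... | no  _ = σ j

  update-≡ : ∀ σ i x → update σ i x i ≡ x
  update-≡ σ i x with i ℕ.≟ i
  ... | yes _  = refl
  ... | no i≢i = contradiction refl i≢i

  update-≢ : ∀ σ i x {j} → j ≢ i → update σ i x j ≡ σ j
  update-≢ σ i x {j} j≢i with j ℕ.≟ i
  ... | yes j≡i = contradiction j≡i j≢i
  ... | no  _   = refl

  -- A commutative monoid has no inverses, so the factor `F (σ i)` that the update removes is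
  -- multiplied back instead of being divided out.
  big-update : ∀ n F σ i x → i ℕ.< n → big n (F ∘ update σ i x) ∙ F (σ i) ≡ big n (F ∘ σ) ∙ F x
  big-update (suc n) F σ i x i<1+n with ℕ.m<1+n⇒m<n∨m≡n i<1+n
  ... | inj₂ refl = begin
    (big n (F ∘ update σ n x) ∙ F (update σ n x n)) ∙ F (σ n)
      ≡⟨ cong₂ (λ s t → (s ∙ F t) ∙ F (σ n))
           (big-cong n (λ {j} j<n → cong F (update-≢ σ n x {j} (ℕ.<⇒≢ j<n)))) (update-≡ σ n x) ⟩
    (big n (F ∘ σ) ∙ F x) ∙ F (σ n)                            ≡⟨ assoc _ _ _ ⟩
    big n (F ∘ σ) ∙ (F x ∙ F (σ n))                            ≡⟨ cong (big n (F ∘ σ) ∙_) (comm _ _) ⟩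
    big n (F ∘ σ) ∙ (F (σ n) ∙ F x)                            ≡⟨ assoc _ _ _ ⟨
    (big n (F ∘ σ) ∙ F (σ n)) ∙ F x                            ∎
  ... | inj₁ i<n = begin
    (big n (F ∘ update σ i x) ∙ F (update σ i x n)) ∙ F (σ i)
      ≡⟨ cong (λ t → (big n (F ∘ update σ i x) ∙ F t) ∙ F (σ i)) (update-≢ σ i x (ℕ.>⇒≢ i<n)) ⟩
    (big n (F ∘ update σ i x) ∙ F (σ n)) ∙ F (σ i)             ≡⟨ assoc _ _ _ ⟩
    big n (F ∘ update σ i x) ∙ (F (σ n) ∙ F (σ i))             ≡⟨ cong (big n (F ∘ update σ i x) ∙_) (comm _ _) ⟩
    big n (F ∘ update σ i x) ∙ (F (σ i) ∙ F (σ n))             ≡⟨ assoc _ _ _ ⟨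
    (big n (F ∘ update σ i x) ∙ F (σ i)) ∙ F (σ n)             ≡⟨ cong (_∙ F (σ n)) (big-update n F σ i x i<n) ⟩
    (big n (F ∘ σ) ∙ F x) ∙ F (σ n)                            ≡⟨ assoc _ _ _ ⟩
    big n (F ∘ σ) ∙ (F x ∙ F (σ n))                            ≡⟨ cong (big n (F ∘ σ) ∙_) (comm _ _) ⟩
    big n (F ∘ σ) ∙ (F (σ n) ∙ F x)                            ≡⟨ assoc _ _ _ ⟨
    (big n (F ∘ σ) ∙ F (σ n)) ∙ F x                            ∎

  -- Induction on n. If σ sends i < n to the top value n, then rerouting i to `σ n` gives a
  -- permutation τ of the numbers below n, and `big-update` accounts for the exchange.
  big-permute : ∀ n (F : ℕ → ℤ) σ → (∀ {i} → i ℕ.< n → σ i ℕ.< n) → Injective< n σ →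
    big n (F ∘ σ) ≡ big n F
  big-permute zero    F σ bd inj = refl
  big-permute (suc n) F σ bd inj with injective<⇒surjective< (suc n) σ bd inj (ℕ.n<1+n n)
  ... | i , i<1+n , σi≡n with ℕ.m<1+n⇒m<n∨m≡n i<1+n
  ... | inj₂ refl = cong₂ _∙_ (big-permute n F σ bd′ inj′) (cong F σi≡n)
    where
    inj′ : Injective< n σ
    inj′ a b = inj (ℕ.m≤n⇒m≤1+n a) (ℕ.m≤n⇒m≤1+n b)
    bd′ : ∀ {j} → j ℕ.< n → σ j ℕ.< n
    bd′ {j} j<n with ℕ.m<1+n⇒m<n∨m≡n (bd (ℕ.m≤n⇒m≤1+n j<n))
    ... | inj₁ lt = lt
    ... | inj₂ eq = contradiction (inj (ℕ.m≤n⇒m≤1+n j<n) i<1+n (trans eq (sym σi≡n))) (ℕ.<⇒≢ j<n)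
  ... | inj₁ i<n = begin
    big n (F ∘ σ) ∙ F (σ n)   ≡⟨ big-update n F σ i (σ n) i<n ⟨
    big n (F ∘ τ) ∙ F (σ i)   ≡⟨ cong₂ (λ s t → s ∙ F t) (big-permute n F τ bdτ injτ) σi≡n ⟩
    big n F ∙ F n             ∎
    where
    τ : ℕ → ℕ
    τ = update σ i (σ n)
    up : ∀ {j} → j ℕ.< n → j ℕ.< suc n
    up = ℕ.m≤n⇒m≤1+n
    below : ∀ {j} → j ℕ.< suc n → j ≢ i → σ j ℕ.< n
    below {j} j<1+n j≢i with ℕ.m<1+n⇒m<n∨m≡n (bd j<1+n)
    ... | inj₁ lt = lt
    ... | inj₂ eq = contradiction (inj j<1+n i<1+n (trans eq (sym σi≡n))) j≢i
    bdτ : ∀ {j} → j ℕ.< n → τ j ℕ.< n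
    bdτ {j} j<n with j ℕ.≟ i
    ... | yes _  = below (ℕ.n<1+n n) (ℕ.>⇒≢ i<n)
    ... | no j≢i = below (up j<n) j≢i
    injτ : Injective< n τ
    injτ {j} {k} j<n k<n eq with j ℕ.≟ i | k ℕ.≟ i
    ... | yes j≡i | yes k≡i = trans j≡i (sym k≡i)
    ... | yes _   | no _    = contradiction (inj (ℕ.n<1+n n) (up k<n) eq) (ℕ.>⇒≢ k<n)
    ... | no _    | yes _   = contradiction (inj (up j<n) (ℕ.n<1+n n) eq) (ℕ.<⇒≢ j<n)
    ... | no _    | no _    = inj (up j<n) (up k<n) eq

open BigOp _+_ 0ℤ ℤ.+-0-isCommutativeMonoid public using () renaming
  ( big to Σ< ; big-cong to Σ-cong ; big-ε to Σ-0 ; big-∙ to Σ-+ ; big-swap to Σ-swap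
  ; big-head to Σ-head ; big-split to Σ-split ; big-permute to Σ-permute )
open BigOp _*_ 1ℤ ℤ.*-1-isCommutativeMonoid public using () renaming
  ( big to Π< ; big-cong to Π-cong ; big-ε to Π-1 ; big-∙ to Π-* ; big-swap to Π-swap
  ; big-permute to Π-permute )

infix 4 _≡_[mod_]
-- A record and not an abbreviation, so that a and b can be recovered from the type; the difference
-- a - b alone does not determine them.
record _≡_[mod_] (a b m : ℤ) : Set where
  constructor congruent
  field
    divides-difference : m ∣ a - b

open _≡_[mod_] public

∣-resp : ∀ {m x y} → x ≡ y → m ∣ x → m ∣ y
∣-resp refl d = d

mod-reflexive : ∀ {m a b} → a ≡ b → a ≡ b [mod m ]
mod-reflexive {m} {a} refl = congruent (divides 0ℤ (ℤ.+-inverseʳ a))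

mod-sym : ∀ {m a b} → a ≡ b [mod m ] → b ≡ a [mod m ]
mod-sym {m} {a} {b} (congruent d) = congruent (∣-resp (lem a b) (∣m⇒∣-m d))
  where
  lem : ∀ a b → - (a - b) ≡ b - a
  lem = solve-∀

mod-trans : ∀ {m a b c} → a ≡ b [mod m ] → b ≡ c [mod m ] → a ≡ c [mod m ]
mod-trans {m} {a} {b} {c} (congruent d) (congruent e) = congruent (∣-resp (lem a b c) (∣m∣n⇒∣m+n d e))
  where
  lem : ∀ a b c → a - b + (b - c) ≡ a - c
  lem = solve-∀

mod-* : ∀ {m a b c d} → a ≡ b [mod m ] → c ≡ d [mod m ] → a * c ≡ b * d [mod m ]
mod-* {m} {a} {b} {c} {d} (congruent p) (congruent q) =
  congruent (∣-resp (lem a b c d) (∣m∣n⇒∣m+n (∣m⇒∣m*n c p) (∣n⇒∣m*n b q)))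
  where
  lem : ∀ a b c d → (a - b) * c + b * (c - d) ≡ a * c - b * d
  lem = solve-∀

mod-Π : ∀ {m} n {f g} → (∀ {i} → i ℕ.< n → f i ≡ g i [mod m ]) → Π< n f ≡ Π< n g [mod m ]
mod-Π zero    p = mod-reflexive refl
mod-Π (suc n) p = mod-* (mod-Π n (λ i<n → p (ℕ.m≤n⇒m≤1+n i<n))) (p (ℕ.n<1+n n))

-- The Jacobi symbol through half systems

small-multiple-zero : ∀ {m} x → + m ∣ x → ℤ.∣ x ∣ ℕ.< m → x ≡ 0ℤ
small-multiple-zero x d lt with ℤ.∣ x ∣ ℕ.≟ 0
... | yes eq = ℤ.∣i∣≡0⇒i≡0 eq
... | no neq = contradiction (∣⇒∣ᵤ d) (ℕ∣.>⇒∤ {{ℕ.≢-nonZero neq}} lt)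

mod-small : ∀ {m a b} → + a ≡ + b [mod + m ] → a ℕ.< m → b ℕ.< m → a ≡ b
mod-small {m} {a} {b} (congruent d) a<m b<m = ℤ.+-injective (ℤ.i-j≡0⇒i≡j (+ a) (+ b) (small-multiple-zero _ d
  (ℕ.≤-<-trans (subst (ℕ._≤ a ℕ.⊔ b) (cong ℤ.∣_∣ (sym (ℤ.m-n≡m⊖n a b))) (ℤ.∣m⊝n∣≤m⊔n a b)) (ℕ.⊔-lub a<m b<m))))

%-mod : ∀ x m .{{_ : ℕ.NonZero m}} → + x ≡ + (x % m) [mod + m ]
%-mod x m = congruent (divides (+ (x ℕ./ m)) (trans (cong (λ t → + t - + (x % m)) (m≡m%n+[m/n]*n x m))
  (trans (lem (+ (x % m)) (+ (x ℕ./ m ℕ.* m))) (ℤ.pos-* (x ℕ./ m) m))))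
  where
  lem : ∀ a b → (a + b) - a ≡ b
  lem = solve-∀

mod⇒% : ∀ {a b} m .{{_ : ℕ.NonZero m}} → + a ≡ + b [mod + m ] → a % m ≡ b % m
mod⇒% {a} {b} m p = mod-small (mod-trans (mod-sym (%-mod a m)) (mod-trans p (%-mod b m))) (m%n<n a m) (m%n<n b m)

mod-cancelˡ : ∀ {n m} x y → Coprime n m → + n * x ≡ + n * y [mod + m ] → x ≡ y [mod + m ]
mod-cancelˡ {n} {m} x y c (congruent d) = congruent (∣ᵤ⇒∣ (coprime-divisor (Coprimality.sym c)
  (subst (m ℕ∣.∣_) (trans (cong ℤ.∣_∣ (lem (+ n) x y)) (ℤ.abs-* (+ n) (x - y))) (∣⇒∣ᵤ d))))
  where
  lem : ∀ n x y → n * x - n * y ≡ n * (x - y)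
  lem = solve-∀

data IsSign : ℤ → Set where
  pos : IsSign 1ℤ
  neg : IsSign -1ℤ

sign-square : ∀ {s} → IsSign s → s * s ≡ 1ℤ
sign-square pos = refl
sign-square neg = refl

sign-* : ∀ {s t} → IsSign s → IsSign t → IsSign (s * t)
sign-* pos pos = pos
sign-* pos neg = neg
sign-* neg pos = neg
sign-* neg neg = pos

sign-Π : ∀ n {f} → (∀ i → IsSign (f i)) → IsSign (Π< n f)
sign-Π zero    p = pos
sign-Π (suc n) p = sign-* (sign-Π n p) (p n)

-- The modulus is 2h + 1, and {1, …, h} represents the nonzero residues up to sign.
module HalfSystem (h : ℕ) where

  modulus : ℕ
  modulus = suc (h ℕ.+ h)

  h<modulus : h ℕ.< modulus
  h<modulus = s≤s (ℕ.m≤m+n h h)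

  halfSign : ℕ → ℤ
  halfSign r with r ℕ.≤? h
  ... | yes _ = 1ℤ
  ... | no  _ = -1ℤ

  sgn : ℕ → ℤ
  sgn x = halfSign (x % modulus)

  fold : ℕ → ℕ
  fold x with x % modulus ℕ.≤? h
  ... | yes _ = x % modulus
  ... | no  _ = modulus ℕ.∸ x % modulus

  sgn-isSign : ∀ x → IsSign (sgn x)
  sgn-isSign x with x % modulus ℕ.≤? h
  ... | yes _ = pos
  ... | no  _ = neg

  fold≤h : ∀ x → fold x ℕ.≤ h
  fold≤h x with x % modulus ℕ.≤? h
  ... | yes r≤h = r≤h
  ... | no  r≰h = ℕ.≤-trans (ℕ.∸-monoʳ-≤ modulus (ℕ.≰⇒> r≰h)) (ℕ.≤-reflexive (ℕ.m+n∸m≡n h h))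

  sgn-fold : ∀ x → + x ≡ sgn x * + fold x [mod + modulus ]
  sgn-fold x with x % modulus ℕ.≤? h
  ... | yes _ = mod-trans (%-mod x modulus) (mod-reflexive (sym (ℤ.*-identityˡ _)))
  ... | no  _ = mod-trans (%-mod x modulus) (congruent (divides 1ℤ (begin
      + r - -1ℤ * + (modulus ℕ.∸ r)      ≡⟨ lem (+ r) (+ (modulus ℕ.∸ r)) ⟩
      1ℤ * + (r ℕ.+ (modulus ℕ.∸ r))     ≡⟨ cong (λ t → 1ℤ * + t) (ℕ.m+[n∸m]≡n (ℕ.<⇒≤ (m%n<n x modulus))) ⟩
      1ℤ * + modulus                     ∎)))
    where
    open ≡-Reasoning
    r : ℕ
    r = x % modulus
    lem : ∀ a b → a - -1ℤ * b ≡ 1ℤ * (a + b)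
    lem = solve-∀

  fold-pos : ∀ x → ¬ modulus ℕ∣.∣ x → 0 ℕ.< fold x
  fold-pos x m∤x = ℕ.n≢0⇒n>0 λ eq → m∤x
    (∣⇒∣ᵤ (∣-resp (lem (+ x) (sgn x) (+ fold x) (cong +_ eq)) (divides-difference (sgn-fold x))))
    where
    lem : ∀ a s b → b ≡ 0ℤ → a - s * b ≡ a
    lem a s b refl = trans (cong (λ t → a - t) (ℤ.*-zeroʳ s)) (ℤ.+-identityʳ a)

  -- Opposite signs would make the modulus 2h + 1 divide a + b, which lies strictly between 0 and 2h
  -- + 1.
  signed-unique : ∀ {s t a b} → IsSign s → IsSign t → 0 ℕ.< a → a ℕ.≤ h → b ℕ.≤ h →
    s * + a ≡ t * + b [mod + modulus ] → s ≡ t × a ≡ b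
  signed-unique {a = a} {b} pos pos 0<a a≤h b≤h p = refl ,
    mod-small (subst₂ (_≡_[mod + modulus ]) (ℤ.*-identityˡ (+ a)) (ℤ.*-identityˡ (+ b)) p)
      (ℕ.≤-<-trans a≤h h<modulus) (ℕ.≤-<-trans b≤h h<modulus)
  signed-unique {a = a} {b} neg neg 0<a a≤h b≤h (congruent p) = refl ,
    mod-small (congruent (∣-resp (lem (+ a) (+ b)) (∣m⇒∣-m p)))
      (ℕ.≤-<-trans a≤h h<modulus) (ℕ.≤-<-trans b≤h h<modulus)
    where
    lem : ∀ a b → - (-1ℤ * a - -1ℤ * b) ≡ a - b
    lem = solve-∀
  signed-unique {a = a} {b} pos neg 0<a a≤h b≤h (congruent p) = contradiction
    (∣⇒∣ᵤ (∣-resp (lem (+ a) (+ b)) p))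
    (ℕ∣.>⇒∤ {{ℕ.>-nonZero (ℕ.<-≤-trans 0<a (ℕ.m≤m+n a b))}} (s≤s (ℕ.+-mono-≤ a≤h b≤h)))
    where
    lem : ∀ a b → 1ℤ * a - -1ℤ * b ≡ a + b
    lem = solve-∀
  signed-unique {a = a} {b} neg pos 0<a a≤h b≤h (congruent p) = contradiction
    (∣⇒∣ᵤ (∣-resp (lem (+ a) (+ b)) (∣m⇒∣-m p)))
    (ℕ∣.>⇒∤ {{ℕ.>-nonZero (ℕ.<-≤-trans 0<a (ℕ.m≤m+n a b))}} (s≤s (ℕ.+-mono-≤ a≤h b≤h)))
    where
    lem : ∀ a b → - (-1ℤ * a - 1ℤ * b) ≡ a + b
    lem = solve-∀

  sgn-resp : ∀ {a b} → + a ≡ + b [mod + modulus ] → sgn a ≡ sgn b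
  sgn-resp p = cong halfSign (mod⇒% modulus p)

  -- Gauss's lemma taken as the definition. For n prime to the modulus the product is the Jacobi
  -- symbol even when the modulus is composite, so 3N need not be factored. For other n it is still
  -- a sign, which the character replaces by 0.
  jacobi : ℕ → ℤ
  jacobi n = Π< h (λ i → sgn (n ℕ.* suc i))

  jacobi-isSign : ∀ n → IsSign (jacobi n)
  jacobi-isSign n = sign-Π h (λ i → sgn-isSign (n ℕ.* suc i))

  jacobi-resp : ∀ {a b} → + a ≡ + b [mod + modulus ] → jacobi a ≡ jacobi b
  jacobi-resp {a} {b} p = Π-cong h λ {i} _ → sgn-resp (subst₂ (_≡_[mod + modulus ])
    (sym (ℤ.pos-* a (suc i))) (sym (ℤ.pos-* b (suc i))) (mod-* p (mod-reflexive {a = + suc i} refl)))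

  module _ {n} (coprime : Coprime n modulus) where

    modulus∤ : ∀ {i} → i ℕ.< h → ¬ modulus ℕ∣.∣ n ℕ.* suc i
    modulus∤ i<h d = ℕ∣.>⇒∤ (ℕ.≤-<-trans i<h h<modulus) (coprime-divisor (Coprimality.sym coprime) d)

    position : ℕ → ℕ
    position i = ℕ.pred (fold (n ℕ.* suc i))

    suc-position : ∀ {i} → i ℕ.< h → suc (position i) ≡ fold (n ℕ.* suc i)
    suc-position {i} i<h = ℕ.suc-pred _ {{ℕ.>-nonZero (fold-pos (n ℕ.* suc i) (modulus∤ i<h))}}

    position-< : ∀ {i} → i ℕ.< h → position i ℕ.< h
    position-< {i} i<h = subst (ℕ._≤ h) (sym (suc-position i<h)) (fold≤h (n ℕ.* suc i))

    sgn-n* : ∀ i → + n * (sgn (n ℕ.* suc i) * + suc i) ≡ + fold (n ℕ.* suc i) [mod + modulus ]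
    sgn-n* i = mod-trans (mod-reflexive (trans (lem₁ (+ n) s (+ suc i)) (cong (s *_) (sym (ℤ.pos-* n (suc i))))))
      (mod-trans (mod-* (mod-reflexive {a = s} refl) (sgn-fold x))
        (mod-reflexive (trans (sym (ℤ.*-assoc s s (+ fold x)))
          (trans (cong (_* + fold x) (sign-square (sgn-isSign x))) (ℤ.*-identityˡ _)))))
      where
      x = n ℕ.* suc i
      s = sgn x
      lem₁ : ∀ n s k → n * (s * k) ≡ s * (n * k)
      lem₁ = solve-∀

    -- Equal folds give n (s k) ≡ n (t l) with signs s, t by `sgn-n*`; cancelling n leaves two
    -- congruent signed elements of the half system.
    position-injective : Injective< h position
    position-injective {i} {j} i<h j<h eq = ℕ.suc-injective (proj₂ (signed-unique
      (sgn-isSign (n ℕ.* suc i)) (sgn-isSign (n ℕ.* suc j)) (s≤s z≤n) i<h j<h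
      (mod-cancelˡ {n} _ _ coprime (mod-trans (sgn-n* i)
        (mod-trans (mod-reflexive
          (cong +_ (trans (sym (suc-position i<h)) (trans (cong suc eq) (suc-position j<h)))))
          (mod-sym (sgn-n* j)))))))

    jacobi-permute : ∀ (F : ℕ → ℤ) → Π< h (λ i → F (fold (n ℕ.* suc i))) ≡ Π< h (λ i → F (suc i))
    jacobi-permute F = trans (Π-cong h λ i<h → cong F (sym (suc-position i<h)))
      (Π-permute h (F ∘ suc) position position-< position-injective)

  -- The sign of a b k is that of a times the fold of b k, multiplied by the sign of b k. As k ↦
  -- `fold (b k)` permutes the half system, the first factors multiply to `jacobi a`.
  jacobi-* : ∀ {a b} → Coprime a modulus → Coprime b modulus → jacobi (a ℕ.* b) ≡ jacobi a * jacobi b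
  jacobi-* {a} {b} ca cb = begin
    Π< h (λ i → sgn (a ℕ.* b ℕ.* suc i))                                ≡⟨ Π-cong h step ⟩
    Π< h (λ i → sgn (a ℕ.* fold (b ℕ.* suc i)) * sgn (b ℕ.* suc i))     ≡⟨ Π-* h _ _ ⟩
    Π< h (λ i → sgn (a ℕ.* fold (b ℕ.* suc i))) * jacobi b                   ≡⟨ cong (_* jacobi b)
      (jacobi-permute cb (λ k → sgn (a ℕ.* k))) ⟩
    jacobi a * jacobi b                                                           ∎
    where
    open ≡-Reasoning
    step : ∀ {i} → i ℕ.< h → sgn (a ℕ.* b ℕ.* suc i) ≡ sgn (a ℕ.* fold (b ℕ.* suc i)) * sgn (b ℕ.* suc i)
    step {i} i<h = proj₁ (signed-unique (sgn-isSign z) (sign-* (sgn-isSign (a ℕ.* y)) (sgn-isSign x))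
        (fold-pos z m∤z) (fold≤h z) (fold≤h (a ℕ.* y))
        (mod-trans (mod-sym (sgn-fold z)) (mod-trans (mod-reflexive e₁)
          (mod-trans (mod-* (mod-reflexive {a = + a} refl) (sgn-fold x))
            (mod-trans (mod-reflexive e₂) (mod-trans (mod-* (sgn-fold (a ℕ.* y)) (mod-reflexive {a = sgn x} refl))
              (mod-reflexive (lem₂ (sgn (a ℕ.* y)) (+ fold (a ℕ.* y)) (sgn x)))))))))
      where
      x = b ℕ.* suc i
      y = fold x
      z = a ℕ.* b ℕ.* suc i
      z≡ : z ≡ a ℕ.* x
      z≡ = ℕ.*-assoc a b (suc i)
      m∤z : ¬ modulus ℕ∣.∣ z
      m∤z d = modulus∤ cb i<h (coprime-divisor (Coprimality.sym ca) (subst (modulus ℕ∣.∣_) z≡ d))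
      e₁ : + z ≡ + a * + x
      e₁ = trans (cong +_ z≡) (ℤ.pos-* a x)
      e₂ : + a * (sgn x * + y) ≡ + (a ℕ.* y) * sgn x
      e₂ = trans (lem₁ (+ a) (sgn x) (+ y)) (cong (_* sgn x) (sym (ℤ.pos-* a y)))
        where
        lem₁ : ∀ a s y → a * (s * y) ≡ a * y * s
        lem₁ = solve-∀
      lem₂ : ∀ s f t → s * f * t ≡ s * t * f
      lem₂ = solve-∀

  jacobi-minus-one : ∀ n → + n ≡ -1ℤ [mod + modulus ] → jacobi n ≡ -1ℤ ^ h
  jacobi-minus-one n p = trans (Π-cong h step) (const h)
    where
    step : ∀ {i} → i ℕ.< h → sgn (n ℕ.* suc i) ≡ -1ℤ
    step {i} i<h = sym (proj₁ (signed-unique neg (sgn-isSign (n ℕ.* suc i)) (s≤s z≤n) i<h (fold≤h (n ℕ.* suc i))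
      (mod-trans (mod-* (mod-sym p) (mod-reflexive {a = + suc i} refl))
        (mod-trans (mod-reflexive (sym (ℤ.pos-* n (suc i)))) (sgn-fold (n ℕ.* suc i))))))
    const : ∀ k → Π< k (λ _ → -1ℤ) ≡ -1ℤ ^ k
    const zero    = refl
    const (suc k) = trans (cong (_* -1ℤ) (const k)) (ℤ.*-comm (-1ℤ ^ k) -1ℤ)

-- Quadratic reciprocity

parity : ℕ → ℤ
parity n = -1ℤ ^ n

parity-+ : ∀ m n → parity (m ℕ.+ n) ≡ parity m * parity n
parity-+ = ℤ.^-distribˡ-+-* -1ℤ

parity-isSign : ∀ n → IsSign (parity n)
parity-isSign zero    = pos
parity-isSign (suc n) = sign-* neg (parity-isSign n)

parity-double : ∀ n → parity (n ℕ.+ n) ≡ 1ℤ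
parity-double n = trans (parity-+ n n) (sign-square (parity-isSign n))

parity-odd* : ∀ l k → parity (suc (l ℕ.+ l) ℕ.* k) ≡ parity k
parity-odd* l k = begin
  parity (k ℕ.+ (l ℕ.+ l) ℕ.* k)          ≡⟨ cong (λ t → parity (k ℕ.+ t)) (ℕ.*-distribʳ-+ k l l) ⟩
  parity (k ℕ.+ (l ℕ.* k ℕ.+ l ℕ.* k))    ≡⟨ parity-+ k (l ℕ.* k ℕ.+ l ℕ.* k) ⟩
  parity k * parity (l ℕ.* k ℕ.+ l ℕ.* k) ≡⟨ cong (parity k *_) (parity-double (l ℕ.* k)) ⟩
  parity k * 1ℤ                           ≡⟨ ℤ.*-identityʳ _ ⟩
  parity k                                ∎
  where open ≡-Reasoning

parity-* : ∀ l k → parity (l ℕ.* k) ≡ parity l ^ k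
parity-* l k = sym (ℤ.^-*-assoc -1ℤ l k)

Π-const : ∀ k c → Π< k (λ _ → c) ≡ c ^ k
Π-const zero    c = refl
Π-const (suc k) c = trans (cong (_* c) (Π-const k c)) (ℤ.*-comm (c ^ k) c)

-- Eisenstein's lattice points counted by signs: each point on one side of the diagonal contributes
-- -1, so products replace cardinalities modulo 2.
compareSign : ℕ → ℕ → ℤ
compareSign a b with a ℕ.<? b
... | yes _ = -1ℤ
... | no  _ = 1ℤ

compareSign-< : ∀ {a b} → a ℕ.< b → compareSign a b ≡ -1ℤ
compareSign-< {a} {b} a<b with a ℕ.<? b
... | yes _  = refl
... | no a≮b = contradiction a<b a≮b

compareSign-≮ : ∀ {a b} → ¬ a ℕ.< b → compareSign a b ≡ 1ℤ
compareSign-≮ {a} {b} a≮b with a ℕ.<? b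
... | yes a<b = contradiction a<b a≮b
... | no  _   = refl

compareSign-antisym : ∀ {a b} → a ≢ b → compareSign a b * compareSign b a ≡ -1ℤ
compareSign-antisym {a} {b} a≢b with ℕ.<-cmp a b
... | tri< a<b _ b≮a = cong₂ _*_ (compareSign-< a<b) (compareSign-≮ b≮a)
... | tri≈ _ a≡b _ = contradiction a≡b a≢b
... | tri> a≮b _ b<a = cong₂ _*_ (compareSign-≮ a≮b) (compareSign-< b<a)

parity-count : ∀ l q (f : ℕ → ℤ) → q ℕ.≤ l → (∀ {j} → j ℕ.< q → f j ≡ -1ℤ) → (∀ {j} → q ℕ.≤ j → f j ≡ 1ℤ) →
  Π< l f ≡ parity q
parity-count l q f q≤l below above with ℕ.m≤n⇒m<n∨m≡n q≤l
... | inj₂ refl = trans (Π-cong l below) (Π-const l -1ℤ)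
parity-count (suc l) q f _ below above | inj₁ (s≤s q≤l) =
  trans (cong₂ _*_ (parity-count l q f q≤l below above) (above q≤l)) (ℤ.*-identityʳ _)

module _ (h l : ℕ) where
  open HalfSystem h
  private
    n : ℕ
    n = suc (l ℕ.+ l)
    quot : ℕ → ℕ
    quot x = x ℕ./ modulus

  -- Both sides compare the parities in x = r + ⌊x/m⌋ m, where x = n k, m and n are odd.
  sgn-parity : ∀ k → let x = n ℕ.* k in
    sgn x ≡ parity (quot x) * (parity (fold x) * parity k)
  sgn-parity k = by-residue
    where
    open ≡-Reasoning
    x r : ℕ
    x = n ℕ.* k
    r = x % modulus
    total : parity k ≡ parity r * parity (quot x)
    total = begin
      parity k                                   ≡⟨ parity-odd* l k ⟨
      parity x                                   ≡⟨ cong parity (m≡m%n+[m/n]*n x modulus) ⟩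
      parity (r ℕ.+ quot x ℕ.* modulus)          ≡⟨ parity-+ r _ ⟩
      parity r * parity (quot x ℕ.* modulus)     ≡⟨ cong (λ t → parity r * parity t) (ℕ.*-comm (quot x) modulus) ⟩
      parity r * parity (modulus ℕ.* quot x)     ≡⟨ cong (parity r *_) (parity-odd* h (quot x)) ⟩
      parity r * parity (quot x)                 ∎
    collect : ∀ q f r → q * (f * (r * q)) ≡ (q * q) * (f * r)
    collect = solve-∀
    reduce : ∀ f → parity (quot x) * (f * parity k) ≡ f * parity r
    reduce f = begin
      parity (quot x) * (f * parity k)                      ≡⟨ cong (λ t → parity (quot x) * (f * t)) total ⟩
      parity (quot x) * (f * (parity r * parity (quot x)))  ≡⟨ collect (parity (quot x)) f (parity r) ⟩
      (parity (quot x) * parity (quot x)) * (f * parity r)  ≡⟨ cong (_* (f * parity r))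
        (sign-square (parity-isSign (quot x))) ⟩
      1ℤ * (f * parity r)                                   ≡⟨ ℤ.*-identityˡ _ ⟩
      f * parity r                                          ∎
    by-residue : sgn x ≡ parity (quot x) * (parity (fold x) * parity k)
    by-residue with x % modulus ℕ.≤? h
    ... | yes _ = sym (trans (reduce (parity r)) (sign-square (parity-isSign r)))
    ... | no  _ = sym (trans (reduce (parity (modulus ℕ.∸ r))) (begin
      parity (modulus ℕ.∸ r) * parity r  ≡⟨ parity-+ (modulus ℕ.∸ r) r ⟨
      parity (modulus ℕ.∸ r ℕ.+ r)       ≡⟨ cong parity (ℕ.m∸n+n≡m (ℕ.<⇒≤ (m%n<n x modulus))) ⟩
      -1ℤ * parity (h ℕ.+ h)             ≡⟨ cong (-1ℤ *_) (parity-double h) ⟩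
      -1ℤ                                ∎))

  -- In the product of `sgn-parity` over k the parities of the folds and of the k cancel, because
  -- folding permutes the half system. What remains is the parity of ⌊n k / m⌋, the number of j ≥ 1
  -- with m j < n k.
  jacobi-lattice : Coprime n modulus →
    jacobi n ≡ Π< h (λ i → Π< l (λ j → compareSign (modulus ℕ.* suc j) (n ℕ.* suc i)))
  jacobi-lattice coprime = begin
    jacobi n
      ≡⟨ Π-cong h (λ {i} _ → sgn-parity (suc i)) ⟩
    Π< h (λ i → parity (q i) * (parity (fold (n ℕ.* suc i)) * parity (suc i)))
      ≡⟨ Π-* h _ _ ⟩
    Π< h (parity ∘ q) * Π< h (λ i → parity (fold (n ℕ.* suc i)) * parity (suc i))
      ≡⟨ cong (Π< h (parity ∘ q) *_)
        (trans (Π-* h _ _) (cong (_* Π< h (parity ∘ suc)) (jacobi-permute coprime parity))) ⟩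
    Π< h (parity ∘ q) * (Π< h (parity ∘ suc) * Π< h (parity ∘ suc))
      ≡⟨ cong (Π< h (parity ∘ q) *_) (sign-square (sign-Π h (parity-isSign ∘ suc))) ⟩
    Π< h (parity ∘ q) * 1ℤ
      ≡⟨ ℤ.*-identityʳ _ ⟩
    Π< h (parity ∘ q)
      ≡⟨ Π-cong h (λ {i} i<h → sym (parity-count l (q i) _ (q≤l i<h) (below i<h) (above i<h))) ⟩
    Π< h (λ i → Π< l (λ j → compareSign (modulus ℕ.* suc j) (n ℕ.* suc i)))
      ∎
    where
    open ≡-Reasoning
    q : ℕ → ℕ
    q i = quot (n ℕ.* suc i)
    module _ (i : ℕ) where
      x r : ℕ
      x = n ℕ.* suc i
      r = x % modulus
      x≡ : x ≡ r ℕ.+ q i ℕ.* modulus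
      x≡ = m≡m%n+[m/n]*n x modulus
    r≢0 : ∀ {i} → i ℕ.< h → r i ≢ 0
    r≢0 {i} i<h eq = modulus∤ coprime i<h (ℕ∣.divides (q i) (trans (x≡ i) (cong (ℕ._+ q i ℕ.* modulus) eq)))
    expand : ∀ h l → suc (l ℕ.+ l) ℕ.* h ℕ.+ suc (h ℕ.+ l) ≡ suc l ℕ.* suc (h ℕ.+ h)
    expand = ℕ-solve-∀
    -- Since n h < (l + 1) m, the quotient never exceeds l, and all the points counted lie in the h
    -- by l rectangle.
    q≤l : ∀ {i} → i ℕ.< h → q i ℕ.≤ l
    q≤l {i} i<h = ℕ.≤-pred (ℕ.*-cancelʳ-< modulus (q i) (suc l) (ℕ.≤-<-trans
      (ℕ.≤-trans (ℕ.m≤n+m _ (r i)) (ℕ.≤-reflexive (sym (x≡ i))))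
      (ℕ.≤-<-trans (ℕ.*-monoʳ-≤ n i<h) (subst (n ℕ.* h ℕ.<_) (expand h l) (ℕ.m<m+n (n ℕ.* h) (s≤s z≤n))))))
    below : ∀ {i} → i ℕ.< h → ∀ {j} → j ℕ.< q i → compareSign (modulus ℕ.* suc j) (n ℕ.* suc i) ≡ -1ℤ
    below {i} i<h {j} j<q = compareSign-< (ℕ.≤-<-trans
      (ℕ.≤-trans (ℕ.*-monoʳ-≤ modulus j<q) (ℕ.≤-reflexive (ℕ.*-comm modulus (q i))))
      (subst (q i ℕ.* modulus ℕ.<_) (sym (x≡ i)) (ℕ.m<n+m (q i ℕ.* modulus) (ℕ.n≢0⇒n>0 (r≢0 i<h)))))
    above : ∀ {i} → i ℕ.< h → ∀ {j} → q i ℕ.≤ j → compareSign (modulus ℕ.* suc j) (n ℕ.* suc i) ≡ 1ℤ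
    above {i} i<h {j} q≤j = compareSign-≮ (ℕ.≤⇒≯ (ℕ.<⇒≤ (ℕ.<-≤-trans
      (subst (ℕ._< suc (q i) ℕ.* modulus) (sym (x≡ i)) (ℕ.+-monoˡ-< (q i ℕ.* modulus) (m%n<n (x i) modulus)))
      (ℕ.≤-trans (ℕ.*-monoˡ-≤ modulus (s≤s q≤j)) (ℕ.≤-reflexive (ℕ.*-comm (suc j) modulus))))))

-- Both symbols become products over the same rectangle. No point lies on the diagonal, so each of
-- the h l points contributes -1 to exactly one of them.
reciprocity : ∀ h l → Coprime (suc (l ℕ.+ l)) (suc (h ℕ.+ h)) →
  HalfSystem.jacobi h (suc (l ℕ.+ l)) * HalfSystem.jacobi l (suc (h ℕ.+ h)) ≡ parity (h ℕ.* l)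
reciprocity h l coprime = begin
  HalfSystem.jacobi h n * HalfSystem.jacobi l m
    ≡⟨ cong₂ _*_ (jacobi-lattice h l coprime) (jacobi-lattice l h (Coprimality.sym coprime)) ⟩
  Π< h (λ i → Π< l (λ j → compareSign (m ℕ.* suc j) (n ℕ.* suc i))) *
  Π< l (λ j → Π< h (λ i → compareSign (n ℕ.* suc i) (m ℕ.* suc j)))
    ≡⟨ cong (Π< h (λ i → Π< l (λ j → compareSign (m ℕ.* suc j) (n ℕ.* suc i))) *_) (Π-swap l h _) ⟩
  Π< h (λ i → Π< l (λ j → compareSign (m ℕ.* suc j) (n ℕ.* suc i))) *
  Π< h (λ i → Π< l (λ j → compareSign (n ℕ.* suc i) (m ℕ.* suc j)))
    ≡⟨ trans (sym (Π-* h _ _)) (Π-cong h (λ _ → sym (Π-* l _ _))) ⟩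
  Π< h (λ i → Π< l (λ j → compareSign (m ℕ.* suc j) (n ℕ.* suc i) * compareSign (n ℕ.* suc i) (m ℕ.* suc j)))
    ≡⟨ Π-cong h (λ {i} i<h → trans (Π-cong l (λ {j} _ → compareSign-antisym (distinct i<h))) (Π-const l -1ℤ)) ⟩
  Π< h (λ _ → parity l)
    ≡⟨ Π-const h (parity l) ⟩
  parity l ^ h
    ≡⟨ parity-* l h ⟨
  parity (l ℕ.* h)
    ≡⟨ cong parity (ℕ.*-comm l h) ⟩
  parity (h ℕ.* l) ∎
  where
  open ≡-Reasoning
  m n : ℕ
  m = suc (h ℕ.+ h)
  n = suc (l ℕ.+ l)
  distinct : ∀ {i j} → i ℕ.< h → m ℕ.* suc j ≢ n ℕ.* suc i
  distinct {i} {j} i<h eq = HalfSystem.modulus∤ h coprime i<h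
    (ℕ∣.divides (suc j) (trans (sym eq) (ℕ.*-comm m (suc j))))

-- A polynomial function of formal degree d with leading coefficient a, given through its successive divided differences.
Poly : ℤ → ℕ → (ℤ → ℤ) → Set
Poly a zero    f = ∀ x → f x ≡ a
Poly a (suc d) f = ∀ r → ∃[ g ] (Poly a d g × (∀ x → f x - f r ≡ (x - r) * g x))

poly-+ : ∀ d {a b f g} → Poly a d f → Poly b d g → Poly (a + b) d (λ x → f x + g x)
poly-+ zero    p q x = cong₂ _+_ (p x) (q x)
poly-+ (suc d) {f = f} {g} p q r with p r | q r
... | f′ , pf′ , ef | g′ , pg′ , eg = _ , poly-+ d pf′ pg′ , λ x →
  trans (rearrange (f x) (g x) (f r) (g r))
    (trans (cong₂ _+_ (ef x) (eg x)) (sym (ℤ.*-distribˡ-+ (x - r) (f′ x) (g′ x))))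
  where
  rearrange : ∀ a b c d → (a + b) - (c + d) ≡ (a - c) + (b - d)
  rearrange = solve-∀

poly-scale : ∀ d c {a f} → Poly a d f → Poly (c * a) d (λ x → c * f x)
poly-scale zero    c p x = cong (c *_) (p x)
poly-scale (suc d) c {f = f} p r with p r
... | f′ , pf′ , ef = _ , poly-scale d c pf′ , λ x →
  trans (rearrange c (f x) (f r)) (trans (cong (c *_) (ef x)) (commute c (x - r) (f′ x)))
  where
  rearrange : ∀ c a b → c * a - c * b ≡ c * (a - b)
  rearrange = solve-∀
  commute : ∀ c a b → c * (a * b) ≡ a * (c * b)
  commute = solve-∀

-- The degree is only formal. In `poly-x*` this allows f to be added to a multiple of its divided
-- difference, which has degree one less.
poly-raise : ∀ d {a f} → Poly a d f → Poly 0ℤ (suc d) f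
poly-raise zero {a} {f} p r = (λ _ → 0ℤ) , (λ _ → refl) , λ x →
  trans (cong₂ _-_ (p x) (p r)) (trans (ℤ.+-inverseʳ a) (sym (ℤ.*-zeroʳ (x - r))))
poly-raise (suc d) p r with p r
... | f′ , pf′ , ef = f′ , poly-raise d pf′ , ef

poly-x* : ∀ d {a f} → Poly a d f → Poly a (suc d) (λ x → x * f x)
poly-x* zero {a} {f} p r = (λ _ → a) , (λ _ → refl) , λ x →
  trans (cong₂ (λ s t → x * s - r * t) (p x) (p r)) (rearrange x r a)
  where
  rearrange : ∀ x r a → x * a - r * a ≡ (x - r) * a
  rearrange = solve-∀
poly-x* (suc d) {a} {f} p r with p r
... | f′ , pf′ , ef = (λ x → f x + r * f′ x) ,
  subst (λ t → Poly t (suc d) (λ x → f x + r * f′ x)) (ℤ.+-identityʳ a)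
    (poly-+ (suc d) {f = f} {g = λ x → r * f′ x} p (poly-raise d (poly-scale d r pf′))) ,
  λ x → trans (split x r (f x) (f r)) (trans (cong (λ t → (x - r) * f x + r * t) (ef x)) (collect x r (f x) (f′ x)))
  where
  split : ∀ x r a b → x * a - r * b ≡ (x - r) * a + r * (a - b)
  split = solve-∀
  collect : ∀ x r a b → (x - r) * a + r * ((x - r) * b) ≡ (x - r) * (a + r * b)
  collect = solve-∀

poly-power : ∀ d → Poly 1ℤ d (_^ d)
poly-power zero    x = refl
poly-power (suc d) = poly-x* d (poly-power d)

poly-power-1 : ∀ d → Poly 1ℤ (suc d) (λ x → x ^ suc d - 1ℤ)
poly-power-1 d r with poly-power (suc d) r
... | g , pg , eg = g , pg , λ x → trans (rearrange (x ^ suc d) (r ^ suc d)) (eg x)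
  where
  rearrange : ∀ a b → (a - 1ℤ) - (b - 1ℤ) ≡ a - b
  rearrange = solve-∀

prime-∣-* : ∀ {q} → Prime q → ∀ x y → + q ∣ x * y → + q ∣ x ⊎ + q ∣ y
prime-∣-* {q} pq x y d with euclidsLemma ℤ.∣ x ∣ ℤ.∣ y ∣ pq (subst (q ℕ∣.∣_) (ℤ.abs-* x y) (∣⇒∣ᵤ d))
... | inj₁ e = inj₁ (∣ᵤ⇒∣ e)
... | inj₂ e = inj₂ (∣ᵤ⇒∣ e)

-- Lagrange's theorem, phrased through the leading coefficient: the divided difference at the last
-- root vanishes modulo q at all the others, because q is prime and the roots are distinct, and it
-- has the same leading coefficient.
root-bound : ∀ {q} → Prime q → ∀ d {a f} → Poly a d f → (ρ : ℕ → ℤ) →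
  (∀ {i j} → i ℕ.≤ d → j ℕ.≤ d → ρ i ≡ ρ j [mod + q ] → i ≡ j) →
  (∀ {i} → i ℕ.≤ d → + q ∣ f (ρ i)) → + q ∣ a
root-bound pq zero p ρ distinct root = ∣-resp (p (ρ 0)) (root z≤n)
root-bound {q} pq (suc d) {a} {f} p ρ distinct root with p (ρ (suc d))
... | g , pg , eg = root-bound pq d pg ρ (λ i≤d j≤d → distinct (ℕ.m≤n⇒m≤1+n i≤d) (ℕ.m≤n⇒m≤1+n j≤d)) root′
  where
  root′ : ∀ {i} → i ℕ.≤ d → + q ∣ g (ρ i)
  root′ {i} i≤d with prime-∣-* pq (ρ i - ρ (suc d)) (g (ρ i))
    (∣-resp (eg (ρ i)) (∣m∣n⇒∣m+n (root (ℕ.m≤n⇒m≤1+n i≤d)) (∣m⇒∣-m (root ℕ.≤-refl))))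
  ... | inj₁ e = contradiction (distinct (ℕ.m≤n⇒m≤1+n i≤d) ℕ.≤-refl (congruent e)) (ℕ.<⇒≢ (s≤s i≤d))
  ... | inj₂ e = e

-- Euler's criterion

^-* : ∀ x y n → (x * y) ^ n ≡ x ^ n * y ^ n
^-* x y zero    = refl
^-* x y (suc n) = trans (cong (x * y *_) (^-* x y n)) (interchange x y (x ^ n) (y ^ n))
  where
  interchange : ∀ a b c d → a * b * (c * d) ≡ (a * c) * (b * d)
  interchange = solve-∀

mod-^ : ∀ {m a b} n → a ≡ b [mod m ] → a ^ n ≡ b ^ n [mod m ]
mod-^ zero    p = mod-reflexive refl
mod-^ (suc n) p = mod-* p (mod-^ n p)

module EulerCriterion (h : ℕ) (prime : Prime (suc (h ℕ.+ h))) where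
  open HalfSystem h

  half-factorial : ℤ
  half-factorial = Π< h (λ i → + suc i)

  modulus∤Π : ∀ n → n ℕ.≤ h → ¬ + modulus ∣ Π< n (λ i → + suc i)
  modulus∤Π zero    _   d = ℕ∣.>⇒∤ (ℕ.nonTrivial⇒n>1 modulus {{prime⇒nonTrivial prime}}) (∣⇒∣ᵤ d)
  modulus∤Π (suc n) n<h d with prime-∣-* prime (Π< n (λ i → + suc i)) (+ suc n) d
  ... | inj₁ e = modulus∤Π n (ℕ.<⇒≤ n<h) e
  ... | inj₂ e = ℕ∣.>⇒∤ (ℕ.≤-<-trans n<h h<modulus) (∣⇒∣ᵤ e)

  -- Multiply the congruences a k ≡ ± fold(a k) over the half system. The folds permute it, so h!
  -- occurs on both sides, and it is prime to the modulus.
  euler : ∀ {a} → Coprime a modulus → (+ a) ^ h ≡ jacobi a [mod + modulus ]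
  euler {a} coprime = cancel (prime-∣-* prime half-factorial ((+ a) ^ h - jacobi a)
    (∣-resp (factor half-factorial ((+ a) ^ h) (jacobi a)) (divides-difference scaled)))
    where
    factor : ∀ f x y → x * f - y * f ≡ f * (x - y)
    factor = solve-∀
    left : (+ a) ^ h * half-factorial ≡ Π< h (λ i → + (a ℕ.* suc i))
    left = sym (trans (Π-cong h λ {i} _ → ℤ.pos-* a (suc i))
      (trans (Π-* h _ _) (cong (_* half-factorial) (Π-const h (+ a)))))
    right : Π< h (λ i → sgn (a ℕ.* suc i) * + fold (a ℕ.* suc i)) ≡ jacobi a * half-factorial
    right = trans (Π-* h _ _) (cong (jacobi a *_) (jacobi-permute coprime (λ k → + k)))
    scaled : (+ a) ^ h * half-factorial ≡ jacobi a * half-factorial [mod + modulus ]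
    scaled = mod-trans (mod-reflexive left)
      (mod-trans (mod-Π h λ {i} _ → sgn-fold (a ℕ.* suc i)) (mod-reflexive right))
    cancel : + modulus ∣ half-factorial ⊎ + modulus ∣ (+ a) ^ h - jacobi a → (+ a) ^ h ≡ jacobi a [mod + modulus ]
    cancel (inj₁ d) = contradiction d (modulus∤Π h ℕ.≤-refl)
    cancel (inj₂ d) = congruent d

  square-power : ∀ {i} → i ℕ.< h → (+ suc i * + suc i) ^ h ≡ 1ℤ [mod + modulus ]
  square-power {i} i<h = mod-trans (mod-reflexive (^-* (+ suc i) (+ suc i) h))
    (mod-trans (mod-* e e) (mod-reflexive (sign-square (jacobi-isSign (suc i)))))
    where
    e : (+ suc i) ^ h ≡ jacobi (suc i) [mod + modulus ]
    e = euler (Coprimality.sym (prime⇒coprime prime (ℕ.≤-<-trans i<h h<modulus)))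

  squares-distinct : ∀ {i j} → i ℕ.< h → j ℕ.< h →
    + suc i * + suc i ≡ + suc j * + suc j [mod + modulus ] → i ≡ j
  squares-distinct {i} {j} i<h j<h (congruent d) =
    by-factor (prime-∣-* prime (+ suc i - + suc j) (+ suc i + + suc j) (∣-resp (factor (+ suc i) (+ suc j)) d))
    where
    factor : ∀ a b → a * a - b * b ≡ (a - b) * (a + b)
    factor = solve-∀
    minus : ∀ a b → a - b ≡ 1ℤ * a - 1ℤ * b
    minus = solve-∀
    plus : ∀ a b → a + b ≡ 1ℤ * a - -1ℤ * b
    plus = solve-∀
    by-factor : + modulus ∣ + suc i - + suc j ⊎ + modulus ∣ + suc i + + suc j → i ≡ j
    by-factor (inj₁ e) = ℕ.suc-injective
      (proj₂ (signed-unique pos pos (s≤s z≤n) i<h j<h (congruent (∣-resp (minus (+ suc i) (+ suc j)) e))))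
    by-factor (inj₂ e) = contradiction
      (proj₁ (signed-unique {a = suc i} {b = suc j} pos neg (s≤s z≤n) i<h j<h
        (congruent (∣-resp (plus (+ suc i) (+ suc j)) e)))) λ ()

  -- Otherwise a and the h nonzero squares would be h + 1 roots of x^h - 1.
  jacobi-1⇒square : ∀ {a} → Coprime a modulus → jacobi a ≡ 1ℤ → ∃[ k ] (+ k * + k ≡ + a [mod + modulus ])
  jacobi-1⇒square {a} coprime eq with ℕ.anyUpTo? (λ i → modulus ℕ∣.∣? ℤ.∣ + suc i * + suc i - + a ∣) h
  ... | yes (i , _ , d) = suc i , congruent (∣ᵤ⇒∣ d)
  ... | no ∄ = contradiction (too-many-roots h prime′ refl) λ ()
    where
    prime′ : h ≢ 0
    prime′ refl = ℕ.n≮n 1 (ℕ.nonTrivial⇒n>1 modulus {{prime⇒nonTrivial prime}})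
    root : ℕ → ℤ
    root i with i ℕ.<? h
    ... | yes _ = + suc i * + suc i
    ... | no  _ = + a
    is-root : ∀ i → + modulus ∣ root i ^ h - 1ℤ
    is-root i with i ℕ.<? h
    ... | yes i<h = divides-difference (square-power i<h)
    ... | no  _   = divides-difference (mod-trans (euler coprime) (mod-reflexive eq))
    distinct : ∀ {i j} → i ℕ.≤ h → j ℕ.≤ h → root i ≡ root j [mod + modulus ] → i ≡ j
    distinct {i} {j} i≤h j≤h p with i ℕ.<? h | j ℕ.<? h
    ... | yes i<h | yes j<h = squares-distinct i<h j<h p
    ... | yes i<h | no _    = contradiction (i , i<h , ∣⇒∣ᵤ (divides-difference p)) ∄
    ... | no _    | yes j<h = contradiction (j , j<h , ∣⇒∣ᵤ (divides-difference (mod-sym p))) ∄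
    ... | no i≮h  | no j≮h  = trans (ℕ.≤-antisym i≤h (ℕ.≮⇒≥ i≮h)) (ℕ.≤-antisym (ℕ.≮⇒≥ j≮h) j≤h)
    too-many-roots : ∀ k → k ≢ 0 → k ≡ h → ⊥
    too-many-roots zero    k≢0 _ = k≢0 refl
    too-many-roots (suc k) _ refl = ℕ∣.>⇒∤ (ℕ.nonTrivial⇒n>1 modulus {{prime⇒nonTrivial prime}})
      (∣⇒∣ᵤ (root-bound prime (suc k) {f = λ x → x ^ suc k - 1ℤ} (poly-power-1 k) root distinct
        (λ {i} _ → is-root i)))

-- The quadratic character attached to the Jacobi symbol

coprime-* : ∀ {a b n} → Coprime a n → Coprime b n → Coprime (a ℕ.* b) n
coprime-* {a} ca cb {d} (d∣ab , d∣n) = cb (coprime-divisor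
  (λ (e∣d , e∣a) → ca (e∣a , ℕ∣.∣-trans e∣d d∣n)) d∣ab , d∣n)

coprime-∣ : ∀ {a b n} → a ℕ∣.∣ b → Coprime b n → Coprime a n
coprime-∣ a∣b c (d∣a , d∣n) = c (ℕ∣.∣-trans d∣a a∣b , d∣n)

coprime-resp : ∀ {a b m} → + a ≡ + b [mod + m ] → Coprime b m → Coprime a m
coprime-resp {a} {b} {m} (congruent p) c {d} (d∣a , d∣m) = c (d∣b , d∣m)
  where
  lem : ∀ a b → a + - (a - b) ≡ b
  lem = solve-∀
  d∣b : d ℕ∣.∣ b
  d∣b = ∣⇒∣ᵤ (∣-resp (lem (+ a) (+ b)) (∣m∣n⇒∣m+n {+ d} {+ a} (∣ᵤ⇒∣ d∣a)
    (∣m⇒∣-m (∣-trans (∣ᵤ⇒∣ d∣m) p))))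

even-or-odd : ∀ n → (∃[ k ] n ≡ k ℕ.+ k) ⊎ (∃[ k ] n ≡ suc (k ℕ.+ k))
even-or-odd zero = inj₁ (0 , refl)
even-or-odd (suc n) with even-or-odd n
... | inj₁ (k , eq) = inj₂ (k , cong suc eq)
... | inj₂ (k , eq) = inj₁ (suc k , cong suc (trans eq (sym (ℕ.+-suc k k))))

data Value : ℤ → Set where
  sign : ∀ {x} → IsSign x → Value x
  null : Value 0ℤ

record Character (M : ℕ) : Set where
  field
    χ            : ℕ → ℤ
    χ-coprime    : ∀ {n} → Coprime n M → IsSign (χ n)
    χ-noncoprime : ∀ {n} → ¬ Coprime n M → χ n ≡ 0ℤ
    χ-*          : ∀ a b → χ (a ℕ.* b) ≡ χ a * χ b
    χ-resp       : ∀ {a b} → + a ≡ + b [mod + M ] → χ a ≡ χ b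

  χ-value : ∀ n → Value (χ n)
  χ-value n with coprime? n M
  ... | yes c = sign (χ-coprime c)
  ... | no ¬c = subst Value (sym (χ-noncoprime ¬c)) null

-- In the application the modulus is 3N. The factor 4 in `M` makes χ vanish at even numbers, so that
-- only odd primes have value 1, and makes the period 12N a multiple of the number 4N modulo which n
-- is prescribed.
module JacobiCharacter (L : ℕ) where
  open HalfSystem L

  M : ℕ
  M = 4 ℕ.* modulus

  coprime-modulus : ∀ {n} → Coprime n M → Coprime n modulus
  coprime-modulus c = Coprimality.sym (coprime-∣ (ℕ∣.n∣m*n 4) (Coprimality.sym c))

  χ : ℕ → ℤ
  χ n with coprime? n M
  ... | yes _ = jacobi n
  ... | no  _ = 0ℤ

  χ≡jacobi : ∀ {n} → Coprime n M → χ n ≡ jacobi n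
  χ≡jacobi {n} c with coprime? n M
  ... | yes _ = refl
  ... | no ¬c = contradiction (λ {d} → c {d}) ¬c

  χ≡0 : ∀ {n} → ¬ Coprime n M → χ n ≡ 0ℤ
  χ≡0 {n} ¬c with coprime? n M
  ... | yes c = contradiction (λ {d} → c {d}) ¬c
  ... | no  _ = refl

  character : Character M
  character = record
    { χ            = χ
    ; χ-coprime    = λ {n} c → subst IsSign (sym (χ≡jacobi c)) (jacobi-isSign n)
    ; χ-noncoprime = χ≡0
    ; χ-*          = mult
    ; χ-resp       = periodic
    }
    where
    mult : ∀ a b → χ (a ℕ.* b) ≡ χ a * χ b
    mult a b with coprime? a M | coprime? b M
    ... | yes ca | yes cb = trans (χ≡jacobi (coprime-* ca cb)) (jacobi-* (coprime-modulus ca) (coprime-modulus cb))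
    ... | yes ca | no ¬cb = trans (χ≡0 λ c → ¬cb (coprime-∣ (ℕ∣.n∣m*n a) c)) (sym (ℤ.*-zeroʳ (jacobi a)))
    ... | no ¬ca | _      = χ≡0 λ c → ¬ca (coprime-∣ (ℕ∣.m∣m*n b) c)
    periodic : ∀ {a b} → + a ≡ + b [mod + M ] → χ a ≡ χ b
    periodic {a} {b} p with coprime? b M
    ... | yes cb = trans (χ≡jacobi (coprime-resp p cb)) (jacobi-resp (weaken p))
      where
      weaken : + a ≡ + b [mod + M ] → + a ≡ + b [mod + modulus ]
      weaken (congruent d) = congruent (∣-trans (∣ᵤ⇒∣ (ℕ∣.n∣m*n 4)) d)
    ... | no ¬cb = χ≡0 λ ca → ¬cb (coprime-resp (mod-sym p) ca)

  χ-1⇒coprime : ∀ {n} → χ n ≡ 1ℤ → Coprime n M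
  χ-1⇒coprime {n} eq with coprime? n M
  ... | yes c = c
  ... | no  _ = contradiction eq λ ()

  -- For L odd the modulus m is 3 mod 4, so that (-m / q) = (q / m).
  χ-1⇒square : ∀ l → L ≡ suc (l ℕ.+ l) → ∀ {q} → Prime q → χ q ≡ 1ℤ → ∃[ x ] + q ∣ x * x + + modulus
  χ-1⇒square l L-odd {q} q-prime eq with even-or-odd q
  ... | inj₁ (h , refl) = contradiction
        (χ-1⇒coprime {q} eq (ℕ∣.divides h (trans (cong (h ℕ.+_) (sym (ℕ.+-identityʳ h))) (ℕ.*-comm 2 h)) ,
          ℕ∣.∣m⇒∣m*n modulus (ℕ∣.divides 2 refl))) λ ()
  ... | inj₂ (h , refl) = + proj₁ square , ∣-resp (add (+ proj₁ square * + proj₁ square) (+ (h ℕ.+ h)) (+ modulus))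
        (∣m∣n⇒∣m+n (divides-difference (mod-trans (proj₂ square) (mod-reflexive (ℤ.pos-* (h ℕ.+ h) modulus))))
          (∣n⇒∣m*n (+ modulus) {+ suc (h ℕ.+ h)} (divides 1ℤ (sym (ℤ.*-identityˡ _)))))
    where
    module Q = HalfSystem h
    add : ∀ x h m → x - h * m + m * (1ℤ + h) ≡ x + m
    add = solve-∀
    c : Coprime modulus q
    c = Coprimality.sym (coprime-modulus (χ-1⇒coprime {q} eq))
    c′ : Coprime (h ℕ.+ h) q
    c′ {d} (d∣2h , d∣q) = ℕ∣.∣1⇒≡1 (ℕ∣.∣m+n∣m⇒∣n (subst (d ℕ∣.∣_) (ℕ.+-comm 1 (h ℕ.+ h)) d∣q) d∣2h)
    jacobi-modulus : Q.jacobi modulus ≡ parity h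
    jacobi-modulus = begin
      Q.jacobi modulus                       ≡⟨ ℤ.*-identityʳ _ ⟨
      Q.jacobi modulus * 1ℤ                  ≡⟨ cong (Q.jacobi modulus *_)
        (trans (sym eq) (χ≡jacobi {q} (χ-1⇒coprime {q} eq))) ⟩
      Q.jacobi modulus * jacobi q            ≡⟨ reciprocity h L c ⟩
      parity (h ℕ.* L)                       ≡⟨ cong parity (ℕ.*-comm h L) ⟩
      parity (L ℕ.* h)                       ≡⟨ trans (cong (λ t → parity (t ℕ.* h)) L-odd) (parity-odd* l h) ⟩
      parity h                               ∎
      where open ≡-Reasoning
    -- The class of -m modulo q is written as the natural number (q - 1) m = 2h m.
    square : ∃[ k ] (+ k * + k ≡ + ((h ℕ.+ h) ℕ.* modulus) [mod + q ])
    square = EulerCriterion.jacobi-1⇒square h q-prime (coprime-* c′ c)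
      (trans (Q.jacobi-* c′ c) (trans (cong₂ _*_ (Q.jacobi-minus-one (h ℕ.+ h)
        (congruent (divides 1ℤ (cong +_ (trans (ℕ.+-comm (h ℕ.+ h) 1) (sym (ℕ.*-identityˡ q))))))) jacobi-modulus)
        (sign-square (parity-isSign h))))

  -- The parameters describe ρ = 2k + 1 = 4N - c² with m = 3N, so that M = 4m = 3ρ + 3c². Oddness of
  -- k says that ρ is 3 modulo 4, and `ρ≡1` that it is 1 modulo 3.
  module _ (l : ℕ) (L-odd : L ≡ suc (l ℕ.+ l)) (k j : ℕ) (k-odd : k ≡ suc (j ℕ.+ j)) (c u : ℕ)
           (ρ≡1 : suc (k ℕ.+ k) ≡ 1 ℕ.+ u ℕ.* 3) (M≡ : M ≡ 3 ℕ.* suc (k ℕ.+ k) ℕ.+ 3 ℕ.* (c ℕ.* c))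
           (c∣3 : c ℕ∣.∣ 3) where
    private
      ρ : ℕ
      ρ = suc (k ℕ.+ k)
      module K = HalfSystem k
      3⊥ρ : Coprime 3 ρ
      3⊥ρ {d} (d∣3 , d∣ρ) = ℕ∣.∣1⇒≡1
        (ℕ∣.∣m+n∣m⇒∣n (subst (d ℕ∣.∣_) (trans ρ≡1 (ℕ.+-comm 1 _)) d∣ρ) (ℕ∣.∣n⇒∣m*n u d∣3))
      c⊥ρ : Coprime c ρ
      c⊥ρ = coprime-∣ c∣3 3⊥ρ
      M⊥ρ : Coprime M ρ
      M⊥ρ {d} (d∣M , d∣ρ) = coprime-* 3⊥ρ (coprime-* c⊥ρ c⊥ρ)
        (ℕ∣.∣m+n∣m⇒∣n (subst (d ℕ∣.∣_) M≡ d∣M) (ℕ∣.∣n⇒∣m*n 3 d∣ρ) , d∣ρ)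
      m⊥ρ : Coprime modulus ρ
      m⊥ρ = coprime-∣ (ℕ∣.n∣m*n 4) M⊥ρ
      2⊥ρ : Coprime 2 ρ
      2⊥ρ = coprime-∣ (ℕ∣.∣m⇒∣m*n modulus (ℕ∣.divides 2 refl)) M⊥ρ
      odd-parity : ∀ n → parity (suc (n ℕ.+ n)) ≡ -1ℤ
      odd-parity n = trans (cong parity (sym (ℕ.*-identityʳ (suc (n ℕ.+ n))))) (parity-odd* n 1)
      jacobi-square : ∀ {a} → Coprime a ρ → K.jacobi (a ℕ.* a) ≡ 1ℤ
      jacobi-square {a} c = trans (K.jacobi-* c c) (sign-square (K.jacobi-isSign a))
      jacobi-3 : K.jacobi 3 ≡ -1ℤ
      jacobi-3 = begin
        K.jacobi 3                            ≡⟨ ℤ.*-identityʳ _ ⟨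
        K.jacobi 3 * 1ℤ                       ≡⟨ cong (K.jacobi 3 *_) (HalfSystem.jacobi-resp 1 {ρ} {1}
                                                  (congruent (divides (+ u)
                                                    (trans (cong (λ t → + t - 1ℤ) ρ≡1)
                                                    (trans (shift (+ (u ℕ.* 3))) (ℤ.pos-* u 3)))))) ⟨
        K.jacobi 3 * HalfSystem.jacobi 1 ρ    ≡⟨ reciprocity k 1 3⊥ρ ⟩
        parity (k ℕ.* 1)                      ≡⟨ cong parity (trans (ℕ.*-identityʳ k) k-odd) ⟩
        parity (suc (j ℕ.+ j))                ≡⟨ odd-parity j ⟩
        -1ℤ                                   ∎
        where
        open ≡-Reasoning
        shift : ∀ x → 1ℤ + x - 1ℤ ≡ x
        shift = solve-∀
      jacobi-modulus : K.jacobi modulus ≡ -1ℤ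
      jacobi-modulus = begin
        K.jacobi modulus                          ≡⟨ ℤ.*-identityˡ _ ⟨
        -- The square 4 is inserted to turn m into M, which is 3c² modulo ρ.
        1ℤ * K.jacobi modulus                     ≡⟨ cong (_* K.jacobi modulus) (jacobi-square 2⊥ρ) ⟨
        K.jacobi 4 * K.jacobi modulus             ≡⟨ K.jacobi-* (coprime-* 2⊥ρ 2⊥ρ) m⊥ρ ⟨
        K.jacobi M                                ≡⟨ K.jacobi-resp {M} {3 ℕ.* (c ℕ.* c)} (congruent (divides (+ 3)
                                                      (trans (cong (λ t → + t - + (3 ℕ.* (c ℕ.* c))) M≡)
                                                        (trans (shift (+ (3 ℕ.* ρ)) (+ (3 ℕ.* (c ℕ.* c))))
                                                        (ℤ.pos-* 3 ρ))))) ⟩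
        K.jacobi (3 ℕ.* (c ℕ.* c))                ≡⟨ K.jacobi-* 3⊥ρ (coprime-* c⊥ρ c⊥ρ) ⟩
        K.jacobi 3 * K.jacobi (c ℕ.* c)           ≡⟨ cong₂ _*_ jacobi-3 (jacobi-square c⊥ρ) ⟩
        -1ℤ                                       ∎
        where
        open ≡-Reasoning
        shift : ∀ x y → x + y - y ≡ x
        shift = solve-∀

    -- Modulo ρ the number 4m is three times a square, so (m / ρ) = (3 / ρ), which is -1 because ρ
    -- is 1 modulo 3 and 3 modulo 4. Both m and ρ are 3 modulo 4, so reciprocity reverses the sign.
    χ-special : χ (suc (k ℕ.+ k)) ≡ 1ℤ
    χ-special = trans (χ≡jacobi (Coprimality.sym M⊥ρ)) (flip-sign (jacobi ρ) (begin
      -1ℤ * jacobi ρ                ≡⟨ cong (_* jacobi ρ) jacobi-modulus ⟨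
      K.jacobi modulus * jacobi ρ   ≡⟨ reciprocity k L m⊥ρ ⟩
      parity (k ℕ.* L)              ≡⟨ parity-* k L ⟩
      parity k ^ L                  ≡⟨ cong (_^ L) (trans (cong parity k-odd) (odd-parity j)) ⟩
      parity L                      ≡⟨ trans (cong parity L-odd) (odd-parity l) ⟩
      -1ℤ                           ∎))
      where
      open ≡-Reasoning
      flip-sign : ∀ x → -1ℤ * x ≡ -1ℤ → x ≡ 1ℤ
      flip-sign x eq = trans (sym (neg-neg x)) (cong (-1ℤ *_) eq)
        where
        neg-neg : ∀ x → -1ℤ * (-1ℤ * x) ≡ x
        neg-neg = solve-∀

-- Divisor sums of a quadratic character

guard : {P : Set} → Dec P → ℤ → ℤ
guard (yes _) x = x
guard (no  _) x = 0ℤ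

guard-yes : ∀ {P : Set} (P? : Dec P) {x} → P → guard P? x ≡ x
guard-yes (yes _) p = refl
guard-yes (no ¬p) p = contradiction p ¬p

guard-no : ∀ {P : Set} (P? : Dec P) {x} → ¬ P → guard P? x ≡ 0ℤ
guard-no (yes p) ¬p = contradiction p ¬p
guard-no (no  _) ¬p = refl

guard-cong : ∀ {P Q : Set} (P? : Dec P) (Q? : Dec Q) {x y} → (P → Q) → (Q → P) → (P → x ≡ y) → guard P? x ≡
  guard Q? y
guard-cong (yes p) Q? f g eq = trans (eq p) (sym (guard-yes Q? (f p)))
guard-cong (no ¬p) Q? f g eq = sym (guard-no Q? (¬p ∘ g))

guard-* : ∀ {P : Set} (P? : Dec P) c x → guard P? (c * x) ≡ c * guard P? x
guard-* (yes _) c x = refl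
guard-* (no  _) c x = sym (ℤ.*-zeroʳ c)

guard-split : ∀ {P : Set} (P? : Dec P) x → x ≡ guard P? x + guard (¬? P?) x
guard-split (yes _) x = sym (ℤ.+-identityʳ x)
guard-split (no  _) x = sym (ℤ.+-identityˡ x)

Σ-vanish : ∀ n {f} → (∀ {i} → i ℕ.< n → f i ≡ 0ℤ) → Σ< n f ≡ 0ℤ
Σ-vanish n f≡0 = trans (Σ-cong n f≡0) (Σ-0 n)

Σ-extend : ∀ {m n} f → m ℕ.≤ n → (∀ {i} → m ℕ.≤ i → f i ≡ 0ℤ) → Σ< n f ≡ Σ< m f
Σ-extend {m} {n} f m≤n tail = begin
  Σ< n f                                      ≡⟨ cong (λ k → Σ< k f) (ℕ.m+[n∸m]≡n m≤n) ⟨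
  Σ< (m ℕ.+ (n ℕ.∸ m)) f                      ≡⟨ Σ-split m (n ℕ.∸ m) f ⟩
  Σ< m f + Σ< (n ℕ.∸ m) (λ i → f (m ℕ.+ i))   ≡⟨ cong (λ t → Σ< m f + t)
    (Σ-vanish (n ℕ.∸ m) (λ _ → tail (ℕ.m≤m+n m _))) ⟩
  Σ< m f + 0ℤ                                 ≡⟨ ℤ.+-identityʳ _ ⟩
  Σ< m f                                      ∎
  where open ≡-Reasoning

Σ-*ˡ : ∀ n c f → Σ< n (λ i → c * f i) ≡ c * Σ< n f
Σ-*ˡ zero    c f = sym (ℤ.*-zeroʳ c)
Σ-*ˡ (suc n) c f = trans (cong (_+ c * f n) (Σ-*ˡ n c f)) (sym (ℤ.*-distribˡ-+ c _ _))

-- Index i stands for the number i + 1, so in each block of D consecutive indices exactly the last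
-- one gives a multiple of D.
Σ-multiples : ∀ d E (F : ℕ → ℤ) → let D = suc d in
  Σ< (E ℕ.* D) (λ i → guard (D ℕ∣.∣? suc i) (F (suc i))) ≡ Σ< E (λ e → F (suc e ℕ.* D))
Σ-multiples d zero    F = refl
Σ-multiples d (suc E) F = begin
  Σ< (D ℕ.+ E ℕ.* D) g                                     ≡⟨ cong (λ k → Σ< k g) (ℕ.+-comm D (E ℕ.* D)) ⟩
  Σ< (E ℕ.* D ℕ.+ D) g                                     ≡⟨ Σ-split (E ℕ.* D) D g ⟩
  Σ< (E ℕ.* D) g + (Σ< d (λ i → g (E ℕ.* D ℕ.+ i)) + g (E ℕ.* D ℕ.+ d))
    ≡⟨ cong₂ (λ s t → s + t) (Σ-multiples d E F) (cong₂ _+_ (Σ-vanish d inner) last) ⟩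
  Σ< E (λ e → F (suc e ℕ.* D)) + (0ℤ + F (suc E ℕ.* D))    ≡⟨ cong (λ t → Σ< E (λ e → F (suc e ℕ.* D)) + t)
    (ℤ.+-identityˡ _) ⟩
  Σ< (suc E) (λ e → F (suc e ℕ.* D))                       ∎
  where
  open ≡-Reasoning
  D : ℕ
  D = suc d
  g : ℕ → ℤ
  g i = guard (D ℕ∣.∣? suc i) (F (suc i))
  inner : ∀ {i} → i ℕ.< d → g (E ℕ.* D ℕ.+ i) ≡ 0ℤ
  inner {i} i<d = guard-no (D ℕ∣.∣? _) λ D∣ → ℕ∣.>⇒∤ (s≤s i<d)
    (ℕ∣.∣m+n∣m⇒∣n (subst (D ℕ∣.∣_) (sym (ℕ.+-suc (E ℕ.* D) i)) D∣) (ℕ∣.n∣m*n E))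
  last : g (E ℕ.* D ℕ.+ d) ≡ F (suc E ℕ.* D)
  last = trans (guard-yes (D ℕ∣.∣? _) (subst (D ℕ∣.∣_) (sym eq) (ℕ∣.n∣m*n (suc E)))) (cong F eq)
    where
    eq : suc (E ℕ.* D ℕ.+ d) ≡ suc E ℕ.* D
    eq = trans (sym (ℕ.+-suc (E ℕ.* D) d)) (ℕ.+-comm (E ℕ.* D) D)

prime-divisor : ∀ n → 1 ℕ.< n → ∃[ q ] (Prime q × q ℕ∣.∣ n)
prime-divisor n 1<n with factorise n {{ℕ.>-nonZero (ℕ.<⇒≤ 1<n)}}
... | record { factors = [] ; isFactorisation = eq } = contradiction eq (ℕ.>⇒≢ 1<n)
... | record { factors = q ∷ qs ; isFactorisation = eq ; factorsPrime = pq ∷ _ } =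
  q , pq , subst (q ℕ∣.∣_) (sym eq) (ℕ∣.m∣m*n _)

strip : ∀ q → 1 ℕ.< q → ∀ n → 0 ℕ.< n → ∃[ e ] ∃[ m ] (n ≡ q ℕ.^ e ℕ.* m × ¬ q ℕ∣.∣ m × 0 ℕ.< m)
strip q 1<q = <-rec _ go
  where
  go : ∀ n → (∀ {k} → k ℕ.< n → 0 ℕ.< k → ∃[ e ] ∃[ m ] (k ≡ q ℕ.^ e ℕ.* m × ¬ q ℕ∣.∣ m × 0 ℕ.< m)) →
    0 ℕ.< n → ∃[ e ] ∃[ m ] (n ≡ q ℕ.^ e ℕ.* m × ¬ q ℕ∣.∣ m × 0 ℕ.< m)
  go n rec 0<n with q ℕ∣.∣? n
  ... | no q∤n = 0 , n , sym (ℕ.*-identityˡ n) , q∤n , 0<n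
  ... | yes (ℕ∣.divides k refl) with ℕ.n≢0⇒n>0 {k} (λ { refl → ℕ.n≮n 0 0<n })
  ... | 0<k with rec (ℕ.m<m*n k q {{ℕ.>-nonZero 0<k}} 1<q) 0<k
  ... | e , m , eq , q∤m , 0<m = suc e , m , trans (cong (ℕ._* q) eq) (lem (q ℕ.^ e) m q) , q∤m , 0<m
    where
    lem : ∀ a m q → a ℕ.* m ℕ.* q ≡ q ℕ.* a ℕ.* m
    lem = ℕ-solve-∀

-- Induction for multiplicative functions: each step splits off the full power of one prime, leaving
-- a cofactor prime to it.
prime-power-induction : (P : ℕ → Set) → P 1 →
  (∀ {q} e m → Prime q → ¬ q ℕ∣.∣ m → 0 ℕ.< m → P m → P (q ℕ.^ e ℕ.* m)) → ∀ n → 0 ℕ.< n → P n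
prime-power-induction P base step = <-rec _ go
  where
  go : ∀ n → (∀ {k} → k ℕ.< n → 0 ℕ.< k → P k) → 0 ℕ.< n → P n
  go n rec 0<n with ℕ.m≤n⇒m<n∨m≡n 0<n
  ... | inj₂ refl = base
  ... | inj₁ 1<n with prime-divisor n 1<n
  ... | q , pq , q∣n with ℕ.nonTrivial⇒n>1 q {{prime⇒nonTrivial pq}}
  ... | 1<q with strip q 1<q n 0<n
  ... | zero , m , refl , q∤m , 0<m = contradiction (subst (q ℕ∣.∣_) (ℕ.*-identityˡ m) q∣n) q∤m
  ... | suc e , m , refl , q∤m , 0<m = step (suc e) m pq q∤m 0<m (rec m<n 0<m)
    where
    m<n : m ℕ.< q ℕ.^ suc e ℕ.* m
    m<n = subst (m ℕ.<_) (ℕ.*-comm m (q ℕ.^ suc e)) (ℕ.m<m*n m (q ℕ.^ suc e) {{ℕ.>-nonZero 0<m}}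
      (ℕ.<-≤-trans 1<q (ℕ.m≤m*n q (q ℕ.^ e) {{ℕ.m^n≢0 q e {{prime⇒nonZero pq}}}})))

bézout : ∀ {a b} → Coprime a b → ∃[ u ] ∃[ v ] (u * + a + v * + b ≡ 1ℤ)
bézout {a} {b} c with coprime-Bézout c
... | Bézout.+- x y eq = + x , - + y , trans (lem (+ x * + a) (+ y) (+ b))
  (trans (cong (_- + y * + b)
    (trans (sym (ℤ.pos-* x a)) (trans (cong +_ (sym eq)) (cong (λ t → 1ℤ + t) (ℤ.pos-* y b))))) (lem′ (+ y * + b)))
  where
  lem : ∀ z y b → z + - y * b ≡ z - y * b
  lem = solve-∀
  lem′ : ∀ z → 1ℤ + z - z ≡ 1ℤ
  lem′ = solve-∀
... | Bézout.-+ x y eq = - + x , + y , trans (lem (+ y * + b) (+ x) (+ a))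
  (trans (cong (_- + x * + a)
    (trans (sym (ℤ.pos-* y b)) (trans (cong +_ (sym eq)) (cong (λ t → 1ℤ + t) (ℤ.pos-* x a))))) (lem′ (+ x * + a)))
  where
  lem : ∀ z y b → - y * b + z ≡ z - y * b
  lem = solve-∀
  lem′ : ∀ z → 1ℤ + z - z ≡ 1ℤ
  lem′ = solve-∀

-- Chinese remaindering: with u a + v b = 1 the number z = x v b + y u a is x modulo a and y modulo
-- b. The same identity combines divisibility of z² + D by a and by b into divisibility by a b.
root-of-product : ∀ {a b} D → Coprime a b → ∃[ x ] + a ∣ x * x + D → ∃[ y ] + b ∣ y * y + D →
  ∃[ z ] + (a ℕ.* b) ∣ z * z + D
root-of-product {a} {b} D c (x , divides k ek) (y , divides l el) with bézout c
... | u , v , uv = z , divides (l′ * u + k′ * v) (begin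
    z * z + D                                        ≡⟨ ℤ.*-identityʳ _ ⟨
    (z * z + D) * 1ℤ                                 ≡⟨ cong ((z * z + D) *_) uv ⟨
    (z * z + D) * (u * + a + v * + b)                ≡⟨ ℤ.*-distribˡ-+ (z * z + D) _ _ ⟩
    (z * z + D) * (u * + a) + (z * z + D) * (v * + b) ≡⟨ cong₂ (λ s t → s * (u * + a) + t * (v * + b)) modb moda ⟩
    (l′ * + b) * (u * + a) + (k′ * + a) * (v * + b)  ≡⟨ collect l′ k′ u v (+ a) (+ b) ⟩
    (l′ * u + k′ * v) * (+ a * + b)                  ≡⟨ cong ((l′ * u + k′ * v) *_) (ℤ.pos-* a b) ⟨
    (l′ * u + k′ * v) * + (a ℕ.* b)                  ∎)
  where
  open ≡-Reasoning
  z k′ l′ : ℤ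
  z = x * (v * + b) + y * (u * + a)
  k′ = k + (u * (y - x)) * (z + x)
  l′ = l + (v * (x - y)) * (z + y)
  collect : ∀ l k u v a b → (l * b) * (u * a) + (k * a) * (v * b) ≡ (l * u + k * v) * (a * b)
  collect = solve-∀
  via : ∀ z x D w k a → z - x ≡ w * a → x * x + D ≡ k * a → z * z + D ≡ (k + w * (z + x)) * a
  via z x D w k a e f = trans (expand z x D) (trans (cong₂ (λ s t → s + t * (z + x)) f e) (factor k w z x a))
    where
    expand : ∀ z x D → z * z + D ≡ (x * x + D) + (z - x) * (z + x)
    expand = solve-∀
    factor : ∀ k w z x a → k * a + w * a * (z + x) ≡ (k + w * (z + x)) * a
    factor = solve-∀
  diff : ∀ x y u v a b → u * a + v * b ≡ 1ℤ → x * (v * b) + y * (u * a) - x ≡ u * (y - x) * a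
  diff x y u v a b e = trans
    (cong (λ t → x * (v * b) + y * (u * a) - t) (trans (sym (ℤ.*-identityʳ x)) (cong (x *_) (sym e))))
    (expand x y u v a b)
    where
    expand : ∀ x y u v a b → x * (v * b) + y * (u * a) - x * (u * a + v * b) ≡ u * (y - x) * a
    expand = solve-∀
  moda : z * z + D ≡ k′ * + a
  moda = via z x D (u * (y - x)) k (+ a) (diff x y u v (+ a) (+ b) uv) ek
  modb : z * z + D ≡ l′ * + b
  modb = via z y D (v * (x - y)) l (+ b)
    (trans (cong (_- y) (ℤ.+-comm (x * (v * + b)) _))
      (diff y x v u (+ b) (+ a) (trans (ℤ.+-comm (v * + b) _) uv))) el

prime∤⇒coprime : ∀ {q d} → Prime q → ¬ q ℕ∣.∣ d → Coprime d q
prime∤⇒coprime {q} {d} pq q∤d {k} (k∣d , k∣q) with prime⇒irreducible pq k∣q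
... | inj₁ k≡1 = k≡1
... | inj₂ refl = contradiction k∣d q∤d

module DivisorSum {M} (character : Character M) where
  open Character character

  term : ℕ → ℕ → ℤ
  term n i = guard (suc i ℕ∣.∣? n) (χ (suc i))

  -- The Dirichlet convolution of 1 and χ. For n > 0 it is a product of factors 1 + χ(q) + ... +
  -- χ(q)^e over the prime powers q^e of n, hence nonnegative, and zero only through a prime with
  -- χ(q) = -1 and e odd.
  G : ℕ → ℤ
  G n = Σ< n (term n)

  G-range : ∀ {n L} → 0 ℕ.< n → n ℕ.≤ L → Σ< L (term n) ≡ G n
  G-range {n} 0<n n≤L = Σ-extend (term n) n≤L λ n≤i → guard-no (_ ℕ∣.∣? n) (ℕ∣.>⇒∤ {{ℕ.>-nonZero 0<n}} (s≤s n≤i))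

  term∤ : ℕ → ℕ → ℕ → ℤ
  term∤ q n i = guard (¬? (q ℕ∣.∣? suc i)) (term n i)

  G∤ : ℕ → ℕ → ℤ
  G∤ q n = Σ< n (term∤ q n)

  χ1 : χ 1 ≡ 1ℤ
  χ1 with χ 1 | χ-coprime (Coprimality.1-coprimeTo M) | χ-* 1 1
  ... | _ | pos | _ = refl
  ... | _ | neg | ()

  -- The divisors of m q that q divides are q times the divisors of m; the others are unaffected by
  -- further factors q. This yields the recursion G(q^(e+1) m) = χ(q) G(q^e m) + G(m) for q prime to
  -- m.
  G-prime* : ∀ {q} m → Prime q → 0 ℕ.< m → G (m ℕ.* q) ≡ χ q * G m + G∤ q (m ℕ.* q)
  G-prime* {suc d} m pq 0<m = begin
    Σ< n (term n)                                      ≡⟨ Σ-cong n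
      (λ {i} _ → guard-split (q ℕ∣.∣? suc i) (term n i)) ⟩
    Σ< n (λ i → guard (q ℕ∣.∣? suc i) (term n i) + term∤ q n i)  ≡⟨ Σ-+ n _ _ ⟩
    Σ< n (λ i → guard (q ℕ∣.∣? suc i) (term n i)) + G∤ q n  ≡⟨ cong (_+ G∤ q n)
      (Σ-multiples d m (λ k → guard (k ℕ∣.∣? n) (χ k))) ⟩
    Σ< m (λ e → guard (suc e ℕ.* q ℕ∣.∣? n) (χ (suc e ℕ.* q))) + G∤ q n
      ≡⟨ cong (_+ G∤ q n) (Σ-cong m λ {e} _ → trans (guard-cong (suc e ℕ.* q ℕ∣.∣? n) (suc e ℕ∣.∣? m)
           (ℕ∣.*-cancelʳ-∣ q) (ℕ∣.*-monoˡ-∣ q) (λ _ → trans (χ-* (suc e) q) (ℤ.*-comm (χ (suc e)) (χ q))))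
           (guard-* (suc e ℕ∣.∣? m) (χ q) (χ (suc e)))) ⟩
    Σ< m (λ e → χ q * term m e) + G∤ q n               ≡⟨ cong (_+ G∤ q n) (Σ-*ˡ m (χ q) (term m)) ⟩
    χ q * G m + G∤ q n                                 ∎
    where
    open ≡-Reasoning
    q n : ℕ
    q = suc d
    n = m ℕ.* q

  G∤-prime* : ∀ {q} m → Prime q → 0 ℕ.< m → G∤ q (m ℕ.* q) ≡ G∤ q m
  G∤-prime* {q} m pq 0<m = begin
    Σ< (m ℕ.* q) (term∤ q (m ℕ.* q))  ≡⟨ Σ-cong (m ℕ.* q) (λ {i} _ → same i) ⟩
    Σ< (m ℕ.* q) (term∤ q m)
      ≡⟨ Σ-extend (term∤ q m) (ℕ.m≤m*n m q {{prime⇒nonZero pq}}) (λ {i} m≤i → trans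
           (cong (guard (¬? (q ℕ∣.∣? suc i))) (guard-no (suc i ℕ∣.∣? m) (ℕ∣.>⇒∤ {{ℕ.>-nonZero 0<m}} (s≤s m≤i))))
           (guard-0 (¬? (q ℕ∣.∣? suc i)))) ⟩
    Σ< m (term∤ q m)                  ∎
    where
    open ≡-Reasoning
    guard-0 : ∀ {P : Set} (P? : Dec P) → guard P? 0ℤ ≡ 0ℤ
    guard-0 (yes _) = refl
    guard-0 (no  _) = refl
    same : ∀ i → term∤ q (m ℕ.* q) i ≡ term∤ q m i
    same i = guard-cong (¬? (q ℕ∣.∣? suc i)) (¬? (q ℕ∣.∣? suc i)) (λ c → c) (λ c → c) λ q∤d →
      guard-cong (suc i ℕ∣.∣? (m ℕ.* q)) (suc i ℕ∣.∣? m)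
        (λ d∣mq → coprime-divisor (prime∤⇒coprime pq q∤d) (subst (suc i ℕ∣.∣_) (ℕ.*-comm m q) d∣mq))
        (ℕ∣.∣m⇒∣m*n q) (λ _ → refl)

  G∤-coprime : ∀ {q} m → ¬ q ℕ∣.∣ m → G∤ q m ≡ G m
  G∤-coprime {q} m q∤m = Σ-cong m λ {i} _ → drop i
    where
    drop : ∀ i → term∤ q m i ≡ term m i
    drop i with q ℕ∣.∣? suc i
    ... | no  _ = refl
    ... | yes q∣d = sym (guard-no (suc i ℕ∣.∣? m) (λ d∣m → q∤m (ℕ∣.∣-trans q∣d d∣m)))

  -- The Horner form of 1 + c + ... + c^e.
  geometric : ℤ → ℕ → ℤ
  geometric c zero    = 1ℤ
  geometric c (suc e) = c * geometric c e + 1ℤ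

  G-prime-power : ∀ {q} e m → Prime q → ¬ q ℕ∣.∣ m → 0 ℕ.< m → G (q ℕ.^ e ℕ.* m) ≡ geometric (χ q) e * G m
  G-prime-power {q} e m pq q∤m 0<m = proj₂ (go e)
    where
    open ≡-Reasoning
    swap : ∀ e → q ℕ.^ suc e ℕ.* m ≡ (q ℕ.^ e ℕ.* m) ℕ.* q
    swap e = lem q (q ℕ.^ e) m
      where
      lem : ∀ q a m → q ℕ.* a ℕ.* m ≡ a ℕ.* m ℕ.* q
      lem = ℕ-solve-∀
    positive : ∀ e → 0 ℕ.< q ℕ.^ e ℕ.* m
    positive e = ℕ.>-nonZero⁻¹ _ {{ℕ.m*n≢0 (q ℕ.^ e) m {{ℕ.m^n≢0 q e {{prime⇒nonZero pq}}}} {{ℕ.>-nonZero 0<m}}}}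
    go : ∀ e → G∤ q (q ℕ.^ e ℕ.* m) ≡ G m × G (q ℕ.^ e ℕ.* m) ≡ geometric (χ q) e * G m
    go zero = trans (cong (G∤ q) (ℕ.*-identityˡ m)) (G∤-coprime m q∤m) ,
      trans (cong G (ℕ.*-identityˡ m)) (sym (ℤ.*-identityˡ (G m)))
    go (suc e) with go e
    ... | h , g = h′ , (begin
      G (q ℕ.^ suc e ℕ.* m)                            ≡⟨ cong G (swap e) ⟩
      G ((q ℕ.^ e ℕ.* m) ℕ.* q)                        ≡⟨ G-prime* (q ℕ.^ e ℕ.* m) pq (positive e) ⟩
      χ q * G (q ℕ.^ e ℕ.* m) + G∤ q ((q ℕ.^ e ℕ.* m) ℕ.* q)
        ≡⟨ cong₂ (λ s t → χ q * s + t) g (trans (cong (G∤ q) (sym (swap e))) h′) ⟩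
      χ q * (geometric (χ q) e * G m) + G m            ≡⟨ lem (χ q) (geometric (χ q) e) (G m) ⟩
      geometric (χ q) (suc e) * G m                    ∎)
      where
      h′ : G∤ q (q ℕ.^ suc e ℕ.* m) ≡ G m
      h′ = trans (cong (G∤ q) (swap e)) (trans (G∤-prime* (q ℕ.^ e ℕ.* m) pq (positive e)) h)
      lem : ∀ c g x → c * (g * x) + x ≡ (c * g + 1ℤ) * x
      lem = solve-∀

  geometric-pos : ∀ e → geometric 1ℤ e ≡ + suc e
  geometric-pos zero    = refl
  geometric-pos (suc e) = trans (cong (λ t → 1ℤ * t + 1ℤ) (geometric-pos e))
    (trans (cong (_+ 1ℤ) (ℤ.*-identityˡ (+ suc e))) (cong +_ (ℕ.+-comm (suc e) 1)))

  geometric-neg : ∀ e → geometric -1ℤ (e ℕ.+ e) ≡ 1ℤ × geometric -1ℤ (suc (e ℕ.+ e)) ≡ 0ℤ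
  geometric-neg zero    = refl , refl
  geometric-neg (suc e) with geometric-neg e
  ... | _ , odd rewrite ℕ.+-suc e e = cong (λ t → -1ℤ * t + 1ℤ) odd , cong (λ t → -1ℤ * (-1ℤ * t + 1ℤ) + 1ℤ) odd

  geometric-null : ∀ e → geometric 0ℤ e ≡ 1ℤ
  geometric-null zero    = refl
  geometric-null (suc e) = refl

  geometric-nonNegative : ∀ {c} → Value c → ∀ e → 0ℤ ℤ.≤ geometric c e
  geometric-nonNegative (sign pos) e = subst (0ℤ ℤ.≤_) (sym (geometric-pos e)) (ℤ.+≤+ z≤n)
  geometric-nonNegative (sign neg) e with even-or-odd e
  ... | inj₁ (k , refl) = subst (0ℤ ℤ.≤_) (sym (proj₁ (geometric-neg k))) (ℤ.+≤+ z≤n)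
  ... | inj₂ (k , refl) = subst (0ℤ ℤ.≤_) (sym (proj₂ (geometric-neg k))) (ℤ.+≤+ z≤n)
  geometric-nonNegative null       e = subst (0ℤ ℤ.≤_) (sym (geometric-null e)) (ℤ.+≤+ z≤n)

  geometric-even : ∀ {c} → Value c → ∀ e → 1ℤ ℤ.≤ geometric c (e ℕ.+ e)
  geometric-even (sign pos) e = subst (1ℤ ℤ.≤_) (sym (geometric-pos (e ℕ.+ e))) (ℤ.+≤+ (s≤s z≤n))
  geometric-even (sign neg) e = ℤ.≤-reflexive (sym (proj₁ (geometric-neg e)))
  geometric-even null       e = ℤ.≤-reflexive (sym (geometric-null (e ℕ.+ e)))

  G1 : G 1 ≡ 1ℤ
  G1 = trans (ℤ.+-identityˡ _) (trans (guard-yes (1 ℕ∣.∣? 1) ℕ∣.∣-refl) χ1)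

  nonNegative-* : ∀ {a b} → 0ℤ ℤ.≤ a → 0ℤ ℤ.≤ b → 0ℤ ℤ.≤ a * b
  nonNegative-* {+ a} {+ b} _ _ = subst (0ℤ ℤ.≤_) (ℤ.pos-* a b) (ℤ.+≤+ z≤n)

  positive-* : ∀ {a b} → 1ℤ ℤ.≤ a → 1ℤ ℤ.≤ b → 1ℤ ℤ.≤ a * b
  positive-* {+ a} {+ b} (ℤ.+≤+ p) (ℤ.+≤+ q) = subst (1ℤ ℤ.≤_) (ℤ.pos-* a b) (ℤ.+≤+ (ℕ.*-mono-≤ p q))

  G-nonNegative : ∀ n → 0 ℕ.< n → 0ℤ ℤ.≤ G n
  G-nonNegative = prime-power-induction (λ n → 0ℤ ℤ.≤ G n) (subst (0ℤ ℤ.≤_) (sym G1) (ℤ.+≤+ z≤n))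
    λ {q} e m pq q∤m 0<m ih → subst (0ℤ ℤ.≤_) (sym (G-prime-power e m pq q∤m 0<m))
      (nonNegative-* (geometric-nonNegative (χ-value q) e) ih)

  G-square : ∀ k → 0 ℕ.< k → 1ℤ ℤ.≤ G (k ℕ.* k)
  G-square = prime-power-induction (λ k → 1ℤ ℤ.≤ G (k ℕ.* k)) (ℤ.≤-reflexive (sym G1)) step
    where
    step : ∀ {q} e m → Prime q → ¬ q ℕ∣.∣ m → 0 ℕ.< m → 1ℤ ℤ.≤ G (m ℕ.* m) →
      1ℤ ℤ.≤ G ((q ℕ.^ e ℕ.* m) ℕ.* (q ℕ.^ e ℕ.* m))
    step {q} e m pq q∤m 0<m ih = subst (1ℤ ℤ.≤_)
      (sym (trans (cong G (trans (lem (q ℕ.^ e) m) (cong (ℕ._* (m ℕ.* m)) (sym (ℕ.^-distribˡ-+-* q e e)))))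
        (G-prime-power (e ℕ.+ e) (m ℕ.* m) pq q∤m² (ℕ.*-mono-< 0<m 0<m))))
      (positive-* (geometric-even (χ-value q) e) ih)
      where
      lem : ∀ a m → (a ℕ.* m) ℕ.* (a ℕ.* m) ≡ (a ℕ.* a) ℕ.* (m ℕ.* m)
      lem = ℕ-solve-∀
      q∤m² : ¬ q ℕ∣.∣ m ℕ.* m
      q∤m² d with euclidsLemma m m pq d
      ... | inj₁ e = q∤m e
      ... | inj₂ e = q∤m e

  module _ (D : ℤ) (split : ∀ {q} → Prime q → χ q ≡ 1ℤ → ∃[ x ] + q ∣ x * x + D) where

    -- P collects one factor of each prime with odd exponent, and k² the rest. Coprimality to M and
    -- G(n) ≠ 0 force χ(q) = 1 at those primes, so - D is a square modulo each of them and, by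
    -- Chinese remaindering, modulo P.
    SplitPart : ℕ → Set
    SplitPart n = Coprime n M → G n ≢ 0ℤ → ∃[ P ] ∃[ k ] (n ≡ P ℕ.* (k ℕ.* k) × ∃[ x ] + P ∣ x * x + D)

    splitPart : ∀ n → 0 ℕ.< n → SplitPart n
    splitPart = prime-power-induction SplitPart base step
      where
      base : SplitPart 1
      base _ _ = 1 , 1 , refl , 0ℤ , divides (0ℤ * 0ℤ + D) (sym (ℤ.*-identityʳ _))
      square-times : ∀ q k {m} → SplitPart m → Coprime (q ℕ.^ (k ℕ.+ k) ℕ.* m) M → G m ≢ 0ℤ →
        ∃[ P ] ∃[ j ] (q ℕ.^ (k ℕ.+ k) ℕ.* m ≡ P ℕ.* (j ℕ.* j) × ∃[ x ] + P ∣ x * x + D)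
      square-times q k {m} ih c G≢0 with ih (coprime-∣ (ℕ∣.n∣m*n (q ℕ.^ (k ℕ.+ k))) c) G≢0
      ... | P , j , refl , root = P , q ℕ.^ k ℕ.* j ,
        trans (cong (ℕ._* (P ℕ.* (j ℕ.* j))) (ℕ.^-distribˡ-+-* q k k)) (lem (q ℕ.^ k) P j) , root
        where
        lem : ∀ a P j → a ℕ.* a ℕ.* (P ℕ.* (j ℕ.* j)) ≡ P ℕ.* (a ℕ.* j ℕ.* (a ℕ.* j))
        lem = ℕ-solve-∀
      step : ∀ {q} e m → Prime q → ¬ q ℕ∣.∣ m → 0 ℕ.< m → SplitPart m → SplitPart (q ℕ.^ e ℕ.* m)
      step {q} e m pq q∤m 0<m ih c G≢0 with even-or-odd e
      ... | inj₁ (k , refl) = square-times q k ih c Gm≢0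
        where
        Gm≢0 : G m ≢ 0ℤ
        Gm≢0 eq = G≢0 (trans (G-prime-power e m pq q∤m 0<m)
          (trans (cong (geometric (χ q) e *_) eq) (ℤ.*-zeroʳ (geometric (χ q) e))))
      ... | inj₂ (k , refl) = odd-case (χ q) refl
        (χ-coprime (coprime-∣ (ℕ∣.∣-trans (ℕ∣.m∣m*n _) (ℕ∣.m∣m*n {q ℕ.^ e} m)) c))
        where
        Gm≢0 : G m ≢ 0ℤ
        Gm≢0 eq = G≢0 (trans (G-prime-power e m pq q∤m 0<m)
          (trans (cong (geometric (χ q) e *_) eq) (ℤ.*-zeroʳ (geometric (χ q) e))))
        odd-case : ∀ v → χ q ≡ v → IsSign v → ∃[ P ] ∃[ j ]
          (q ℕ.^ e ℕ.* m ≡ P ℕ.* (j ℕ.* j) × ∃[ x ] + P ∣ x * x + D)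
        odd-case _ eq neg = contradiction (trans (G-prime-power e m pq q∤m 0<m)
          (trans (cong (λ v → geometric v e * G m) eq) (cong (_* G m) (proj₂ (geometric-neg k))))) G≢0
        odd-case _ eq pos = extend (ih (coprime-∣ (ℕ∣.n∣m*n (q ℕ.^ e)) c) Gm≢0)
          where
          lem : ∀ q a P j → q ℕ.* (a ℕ.* a) ℕ.* (P ℕ.* (j ℕ.* j)) ≡ q ℕ.* P ℕ.* (a ℕ.* j ℕ.* (a ℕ.* j))
          lem = ℕ-solve-∀
          extend : ∃[ P ] ∃[ j ] (m ≡ P ℕ.* (j ℕ.* j) × ∃[ x ] + P ∣ x * x + D) → ∃[ P ] ∃[ j ]
            (q ℕ.^ e ℕ.* m ≡ P ℕ.* (j ℕ.* j) × ∃[ x ] + P ∣ x * x + D)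
          extend (P , j , m≡ , root) = q ℕ.* P , q ℕ.^ k ℕ.* j ,
            trans (cong₂ (λ s t → q ℕ.* s ℕ.* t) (ℕ.^-distribˡ-+-* q k k) m≡) (lem q (q ℕ.^ k) P j) ,
            root-of-product D (Coprimality.sym
              (prime∤⇒coprime pq λ q∣P → q∤m (subst (q ℕ∣.∣_) (sym m≡) (ℕ∣.∣m⇒∣m*n (j ℕ.* j) q∣P))))
              (split pq eq) root

-- Double Abel summation over the hyperbola

Σ-mono : ∀ n {f g} → (∀ {i} → i ℕ.< n → f i ℤ.≤ g i) → Σ< n f ℤ.≤ Σ< n g
Σ-mono zero    p = ℤ.≤-refl
Σ-mono (suc n) p = ℤ.+-mono-≤ (Σ-mono n (λ i<n → p (ℕ.m≤n⇒m≤1+n i<n))) (p (ℕ.n<1+n n))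

Σ-const : ∀ n c → Σ< n (λ _ → c) ≡ + n * c
Σ-const zero    c = refl
Σ-const (suc n) c = trans (cong (_+ c) (Σ-const n c)) (lem (+ n) c)
  where
  lem : ∀ n c → n * c + c ≡ (1ℤ + n) * c
  lem = solve-∀

Σ-nonNegative : ∀ n {f} → (∀ {i} → i ℕ.< n → 0ℤ ℤ.≤ f i) → 0ℤ ℤ.≤ Σ< n f
Σ-nonNegative n {f} p = subst (ℤ._≤ Σ< n f) (Σ-0 n) (Σ-mono n p)

Σ-abs : ∀ n f → + ℤ.∣ Σ< n f ∣ ℤ.≤ Σ< n (λ i → + ℤ.∣ f i ∣)
Σ-abs zero    f = ℤ.≤-refl
Σ-abs (suc n) f = ℤ.≤-trans (ℤ.+≤+ (ℤ.∣i+j∣≤∣i∣+∣j∣ (Σ< n f) (f n))) (ℤ.+-monoˡ-≤ (+ ℤ.∣ f n ∣) (Σ-abs n f))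

Σ-*ʳ : ∀ n c f → Σ< n (λ i → f i * c) ≡ Σ< n f * c
Σ-*ʳ n c f = trans (Σ-cong n (λ {i} _ → ℤ.*-comm (f i) c)) (trans (Σ-*ˡ n c f) (ℤ.*-comm c _))

Σ-telescope : ∀ n (f : ℕ → ℤ) → Σ< n (λ i → f i - f (suc i)) ≡ f 0 - f n
Σ-telescope zero    f = sym (ℤ.+-inverseʳ (f 0))
Σ-telescope (suc n) f = trans (cong (_+ (f n - f (suc n))) (Σ-telescope n f)) (lem (f 0) (f n) (f (suc n)))
  where
  lem : ∀ a b c → a - b + (b - c) ≡ a - c
  lem = solve-∀

Σ-shift : ∀ n (f : ℕ → ℤ) → f n ≡ f 0 → Σ< n (f ∘ suc) ≡ Σ< n f
Σ-shift n f eq = trans (sym (lem (f 0) _)) (trans (cong (_- f 0) (trans (sym (Σ-head n f))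
  (trans (ℤ.+-comm (Σ< n f) (f n)) (cong (_+ Σ< n f) eq)))) (lem (f 0) _))
  where
  lem : ∀ a b → a + b - a ≡ b
  lem = solve-∀

Σ-prefix : ∀ {m n f} → (∀ i → 0ℤ ℤ.≤ f i) → m ℕ.≤ n → Σ< m f ℤ.≤ Σ< n f
Σ-prefix {m} {n} {f} p m≤n = subst₂ ℤ._≤_ (ℤ.+-identityʳ _)
  (trans (sym (Σ-split m (n ℕ.∸ m) f)) (cong (λ k → Σ< k f) (ℕ.m+[n∸m]≡n m≤n)))
  (ℤ.+-monoʳ-≤ (Σ< m f) (Σ-nonNegative (n ℕ.∸ m) (λ {i} _ → p (m ℕ.+ i))))

Σ-subsequence : ∀ J {s : ℕ → ℕ} {L f} → (∀ i → 0ℤ ℤ.≤ f i) → (∀ {i j} → i ℕ.< j → s i ℕ.< s j) →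
  (∀ {j} → j ℕ.< J → s j ℕ.< L) → Σ< J (f ∘ s) ℤ.≤ Σ< L f
Σ-subsequence zero    {L = L} p mono bound = Σ-nonNegative L (λ {i} _ → p i)
Σ-subsequence (suc J) {s} {L} {f} p mono bound = ℤ.≤-trans
  (ℤ.+-monoˡ-≤ (f (s J)) (Σ-subsequence J {s} {s J} {f} p mono mono))
  (Σ-prefix p (bound (ℕ.n<1+n J)))

abel : ∀ n (f v : ℕ → ℤ) → Σ< n (λ i → f i * v i) ≡ Σ< n (λ i → Σ< (suc i) f * (v i - v (suc i))) + Σ< n f * v n
abel zero    f v = refl
abel (suc n) f v = trans (cong (_+ f n * v n) (abel n f v))
  (lem (Σ< n (λ i → Σ< (suc i) f * (v i - v (suc i)))) (Σ< n f) (f n) (v n) (v (suc n)))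
  where
  lem : ∀ s a b v w → s + a * v + b * v ≡ s + (a + b) * (v - w) + (a + b) * w
  lem = solve-∀

abel-vanishing : ∀ n (f v : ℕ → ℤ) → v n ≡ 0ℤ → Σ< n (λ i → f i * v i) ≡ Σ< n
  (λ i → Σ< (suc i) f * (v i - v (suc i)))
abel-vanishing n f v vn≡0 = trans (abel n f v)
  (trans (cong (λ t → Σ< n (λ i → Σ< (suc i) f * (v i - v (suc i))) + t)
  (trans (cong (Σ< n f *_) vn≡0) (ℤ.*-zeroʳ (Σ< n f)))) (ℤ.+-identityʳ _))

module DoubleAbel (k : ℕ → ℕ → ℤ) (B : ℕ) (k-bound : ∀ a b → ℤ.∣ Σ< a (λ i → Σ< b (k i)) ∣ ℕ.≤ B) where

  -- Summation by parts in j and then in i sets the sums of k over rectangles against the mixed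
  -- second difference of V. The boundary terms vanish because V is zero at index X.
  double-abel : ∀ X (V : ℕ → ℕ → ℤ) → (∀ i → V i X ≡ 0ℤ) → (∀ j → V X j ≡ 0ℤ) →
    + ℤ.∣ Σ< X (λ i → Σ< X (λ j → k i j * V i j)) ∣ ℤ.≤
    + B * Σ< X (λ j → Σ< X (λ i → + ℤ.∣ (V i j - V i (suc j)) - (V (suc i) j - V (suc i) (suc j)) ∣))
  double-abel X V right bottom = begin
    + ℤ.∣ Σ< X (λ i → Σ< X (λ j → k i j * V i j)) ∣
      ≡⟨ cong (λ t → + ℤ.∣ t ∣) (trans (Σ-cong X λ {i} _ → abel-vanishing X (k i) (V i) (right i)) (Σ-swap X X _)) ⟩
    + ℤ.∣ Σ< X (λ j → Σ< X (λ i → Σ< (suc j) (k i) * W i j)) ∣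
      ≡⟨ cong (λ t → + ℤ.∣ t ∣) (Σ-cong X λ {j} _ → abel-vanishing X (λ i → Σ< (suc j) (k i)) (λ i → W i j)
           (cong₂ _-_ (bottom j) (bottom (suc j)))) ⟩
    + ℤ.∣ Σ< X (λ j → Σ< X (λ i → C (suc i) (suc j) * (W i j - W (suc i) j))) ∣
      ≤⟨ ℤ.≤-trans (Σ-abs X _) (Σ-mono X λ {j} _ → ℤ.≤-trans (Σ-abs X _) (Σ-mono X λ {i} _ → entry i j)) ⟩
    Σ< X (λ j → Σ< X (λ i → + B * + ℤ.∣ W i j - W (suc i) j ∣))
      ≡⟨ trans (Σ-cong X λ {j} _ → Σ-*ˡ X (+ B) _) (Σ-*ˡ X (+ B) _) ⟩
    + B * Σ< X (λ j → Σ< X (λ i → + ℤ.∣ W i j - W (suc i) j ∣)) ∎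
    where
    open ℤ.≤-Reasoning
    W : ℕ → ℕ → ℤ
    W i j = V i j - V i (suc j)
    C : ℕ → ℕ → ℤ
    C a b = Σ< a (λ i → Σ< b (k i))
    entry : ∀ i j → + ℤ.∣ C (suc i) (suc j) * (W i j - W (suc i) j) ∣ ℤ.≤ + B * + ℤ.∣ W i j - W (suc i) j ∣
    entry i j = subst₂ ℤ._≤_ (cong (λ t → + t) (sym (ℤ.abs-* (C (suc i) (suc j)) (W i j - W (suc i) j))))
      (ℤ.pos-* B ℤ.∣ W i j - W (suc i) j ∣)
      (ℤ.+≤+ (ℕ.*-monoˡ-≤ ℤ.∣ W i j - W (suc i) j ∣ (k-bound (suc i) (suc j))))

-- The harmonic sum in dyadic blocks: the P terms with indices from P to 2P - 1 are at most X / P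
-- each and so contribute at most X.
Σ-dyadic : ∀ l X (c : ℕ → ℤ) → (∀ i → 0ℤ ℤ.≤ c i) → (∀ i → + suc i * c i ℤ.≤ + X) → Σ< (2 ℕ.^ l) c ℤ.≤ + X * + suc l
Σ-dyadic zero    X c c≥0 c≤ = subst₂ ℤ._≤_ (trans (ℤ.*-identityˡ (c 0)) (sym (ℤ.+-identityˡ (c 0))))
  (sym (ℤ.*-identityʳ (+ X))) (c≤ 0)
Σ-dyadic (suc l) X c c≥0 c≤ = begin
  Σ< (2 ℕ.* P) c                           ≡⟨ cong (λ t → Σ< t c) (cong (P ℕ.+_) (ℕ.+-identityʳ P)) ⟩
  Σ< (P ℕ.+ P) c                           ≡⟨ Σ-split P P c ⟩
  Σ< P c + Σ< P (λ i → c (P ℕ.+ i))        ≤⟨ ℤ.+-mono-≤ (Σ-dyadic l X c c≥0 c≤) block ⟩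
  + X * + suc l + + X                      ≡⟨ lem (+ X) (+ suc l) ⟩
  + X * + suc (suc l)                      ∎
  where
  open ℤ.≤-Reasoning
  P : ℕ
  P = 2 ℕ.^ l
  lem : ∀ x l → x * l + x ≡ x * (1ℤ + l)
  lem = solve-∀
  term-bound : ∀ i → + P * c (P ℕ.+ i) ℤ.≤ + X
  term-bound i = ℤ.≤-trans (ℤ.*-monoʳ-≤-nonNeg (c (P ℕ.+ i)) {{ℤ.nonNegative (c≥0 (P ℕ.+ i))}}
    (ℤ.+≤+ (ℕ.m≤n⇒m≤1+n (ℕ.m≤m+n P i)))) (c≤ (P ℕ.+ i))
  block : Σ< P (λ i → c (P ℕ.+ i)) ℤ.≤ + X
  block = ℤ.*-cancelˡ-≤-pos _ _ (+ P) {{ℤ.positive (ℤ.+<+ (ℕ.m^n>0 2 l))}} (begin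
    + P * Σ< P (λ i → c (P ℕ.+ i))         ≡⟨ Σ-*ˡ P (+ P) _ ⟨
    Σ< P (λ i → + P * c (P ℕ.+ i))         ≤⟨ Σ-mono P (λ {i} _ → term-bound i) ⟩
    Σ< P (λ _ → + X)                       ≡⟨ Σ-const P (+ X) ⟩
    + P * + X                              ∎)

-- The weight n ↦ (X - n)⁺ on products n = (i+1)(j+1); step is its first difference in j.
module HyperbolaWeight (X : ℕ) where

  V : ℕ → ℕ → ℤ
  V i j = + (X ℕ.∸ suc j ℕ.* suc i)

  V-right : ∀ i → V i X ≡ 0ℤ
  V-right i = cong (λ t → + t) (ℕ.m≤n⇒m∸n≡0 (ℕ.≤-trans (ℕ.n≤1+n X) (ℕ.m≤m*n (suc X) (suc i))))

  V-bottom : ∀ j → V X j ≡ 0ℤ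
  V-bottom j = cong (λ t → + t) (ℕ.m≤n⇒m∸n≡0 (ℕ.≤-trans (ℕ.n≤1+n X) (ℕ.m≤n*m (suc X) (suc j))))

  step : ℕ → ℕ → ℕ
  step i j = suc i ℕ.⊓ (X ℕ.∸ suc j ℕ.* suc i)

  V-step : ∀ i j → V i j - V i (suc j) ≡ + step i j
  V-step i j = begin
    + z - + (X ℕ.∸ suc (suc j) ℕ.* suc i)          ≡⟨ cong (λ t → + z - + t)
      (trans (cong (X ℕ.∸_) (ℕ.+-comm (suc i) (suc j ℕ.* suc i))) (sym (ℕ.∸-+-assoc X (suc j ℕ.* suc i) (suc i)))) ⟩
    + z - + (z ℕ.∸ suc i)                          ≡⟨ cong (λ t → + t - + (z ℕ.∸ suc i))
      (sym (ℕ.m⊓n+n∸m≡n (suc i) z)) ⟩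
    + (step i j ℕ.+ (z ℕ.∸ suc i)) - + (z ℕ.∸ suc i)  ≡⟨ lem (+ step i j) (+ (z ℕ.∸ suc i)) ⟩
    + step i j                                     ∎
    where
    open ≡-Reasoning
    z : ℕ
    z = X ℕ.∸ suc j ℕ.* suc i
    lem : ∀ a b → a + b - b ≡ a
    lem = solve-∀

  under : ℕ → ℕ → ℤ
  under i j = guard (suc j ℕ.* suc i ℕ.<? X) 1ℤ

  under≥0 : ∀ i j → 0ℤ ℤ.≤ under i j
  under≥0 i j with suc j ℕ.* suc i ℕ.<? X
  ... | yes _ = ℤ.+≤+ z≤n
  ... | no  _ = ℤ.+≤+ z≤n

  step-suc : ∀ i j → step (suc i) j ℕ.≤ suc (step i j)
  step-suc i j = ℕ.≤-trans
    (ℕ.⊓-monoʳ-≤ (suc (suc i)) (ℕ.≤-trans (ℕ.∸-monoʳ-≤ X (ℕ.*-monoʳ-≤ (suc j) (ℕ.n≤1+n (suc i)))) (ℕ.n≤1+n _)))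
    (ℕ.≤-reflexive refl)

  -- The first differences decrease in i, except by one unit below the hyperbola.
  second-difference : ∀ i j → + ℤ.∣ + step i j - + step (suc i) j ∣ ℤ.≤ (+ step i j - + step (suc i) j)
    + (under (suc i) j + under (suc i) j)
  second-difference i j with step (suc i) j ℕ.≤? step i j
  ... | yes le = subst (ℤ._≤ d + (under (suc i) j + under (suc i) j))
    (trans (ℤ.+-identityʳ d) (sym (ℤ.0≤i⇒+∣i∣≡i (ℤ.i≤j⇒0≤j-i (ℤ.+≤+ le)))))
        (ℤ.+-monoʳ-≤ d (ℤ.+-mono-≤ (under≥0 (suc i) j) (under≥0 (suc i) j)))
    where
    d : ℤ
    d = + step i j - + step (suc i) j
  ... | no ¬le with ℕ.≤-antisym (step-suc i j) (ℕ.≰⇒> ¬le)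
  ... | eq = ℤ.≤-reflexive (begin
      + ℤ.∣ + step i j - + step (suc i) j ∣     ≡⟨ cong (λ t → + ℤ.∣ t ∣) d≡ ⟩
      -1ℤ + (1ℤ + 1ℤ)                           ≡⟨ cong₂ (λ s t → s + (t + t)) d≡
        (guard-yes (suc j ℕ.* suc (suc i) ℕ.<? X) below) ⟨
      (+ step i j - + step (suc i) j) + (under (suc i) j + under (suc i) j) ∎)
    where
    open ≡-Reasoning
    lem : ∀ a → a - (1ℤ + a) ≡ -1ℤ
    lem = solve-∀
    d≡ : + step i j - + step (suc i) j ≡ -1ℤ
    d≡ = trans (cong (λ t → + step i j - + t) eq) (lem (+ step i j))
    below : suc j ℕ.* suc (suc i) ℕ.< X
    below = ℕ.m∸n≢0⇒n<m λ z → ℕ.1+n≢0 (trans (sym eq) (trans (cong (suc (suc i) ℕ.⊓_) z) (ℕ.⊓-zeroʳ (suc (suc i)))))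

  column : ℕ → ℕ → ℤ
  column n i = Σ< n (under i)

  column≤ : ∀ n i → column n i ℤ.≤ + n
  column≤ n i = subst (column n i ℤ.≤_) (trans (Σ-const n 1ℤ) (ℤ.*-identityʳ (+ n))) (Σ-mono n λ {j} _ → bound j)
    where
    bound : ∀ j → under i j ℤ.≤ 1ℤ
    bound j with suc j ℕ.* suc i ℕ.<? X
    ... | yes _ = ℤ.≤-refl
    ... | no  _ = ℤ.+≤+ z≤n

  -- Whenever the index n itself is counted, at most n + 1 indices have been counted and (n + 1)(i +
  -- 1) < X.
  column-bound : ∀ n i → + suc i * column n i ℤ.≤ + X
  column-bound zero    i = subst (ℤ._≤ + X) (sym (ℤ.*-zeroʳ (+ suc i))) (ℤ.+≤+ z≤n)
  column-bound (suc n) i with suc n ℕ.* suc i ℕ.<? X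
  ... | no  _ = subst (λ t → + suc i * t ℤ.≤ + X) (sym (ℤ.+-identityʳ (column n i))) (column-bound n i)
  ... | yes lt = ℤ.≤-trans (ℤ.*-monoˡ-≤-nonNeg (+ suc i) (ℤ.+-monoˡ-≤ 1ℤ (column≤ n i)))
        (subst (ℤ._≤ + X) (trans (ℤ.pos-* (suc n) (suc i))
          (trans (ℤ.*-comm (+ suc n) (+ suc i)) (cong (λ t → + suc i * + t) (ℕ.+-comm 1 n)))) (ℤ.+≤+ (ℕ.<⇒≤ lt)))

  -- Telescoping in i leaves `step 0 j` ≤ 1 for each j, hence at most X. The corrections count
  -- points under the hyperbola twice, at most X (l + 1) each time, which gives X (3 + 2l).
  total-variation : ∀ l → X ≡ 2 ℕ.^ l →
    Σ< X (λ j → Σ< X (λ i → + ℤ.∣ (V i j - V i (suc j)) - (V (suc i) j - V (suc i) (suc j)) ∣)) ℤ.≤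
    + X * (+ 3 + + 2 * + l)
  total-variation l X≡ = begin
    Σ< X (λ j → Σ< X (λ i → + ℤ.∣ (V i j - V i (suc j)) - (V (suc i) j - V (suc i) (suc j)) ∣))
      ≤⟨ Σ-mono X (λ {j} _ → Σ-mono X
        (λ {i} _ → subst (ℤ._≤ (+ step i j - + step (suc i) j) + (under (suc i) j + under (suc i) j))
           (cong₂ (λ s t → + ℤ.∣ s - t ∣) (sym (V-step i j)) (sym (V-step (suc i) j))) (second-difference i j))) ⟩
    Σ< X (λ j → Σ< X (λ i → (+ step i j - + step (suc i) j) + (under (suc i) j + under (suc i) j)))
      ≡⟨ trans (Σ-cong X λ _ → Σ-+ X _ _) (Σ-+ X _ _) ⟩
    Σ< X (λ j → Σ< X (λ i → + step i j - + step (suc i) j)) + Σ< X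
      (λ j → Σ< X (λ i → under (suc i) j + under (suc i) j))
      ≤⟨ ℤ.+-mono-≤ telescoped (ℤ.≤-reflexive (trans (Σ-cong X λ _ → Σ-+ X _ _) (Σ-+ X _ _))) ⟩
    + X + (Σ< X (λ j → Σ< X (λ i → under (suc i) j)) + Σ< X (λ j → Σ< X (λ i → under (suc i) j)))
      ≤⟨ ℤ.+-monoʳ-≤ (+ X) (ℤ.+-mono-≤ counted counted) ⟩
    + X + (+ X * + suc l + + X * + suc l)
      ≡⟨ lem (+ X) (+ l) ⟩
    + X * (+ 3 + + 2 * + l) ∎
    where
    open ℤ.≤-Reasoning
    lem : ∀ x l → x + (x * (1ℤ + l) + x * (1ℤ + l)) ≡ x * (+ 3 + + 2 * l)
    lem = solve-∀
    last-step : ∀ j → step X j ≡ 0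
    last-step j = trans (cong (suc X ℕ.⊓_) (ℤ.+-injective (V-bottom j))) (ℕ.⊓-zeroʳ (suc X))
    telescoped : Σ< X (λ j → Σ< X (λ i → + step i j - + step (suc i) j)) ℤ.≤ + X
    telescoped = subst (Σ< X (λ j → Σ< X (λ i → + step i j - + step (suc i) j)) ℤ.≤_)
      (trans (Σ-const X 1ℤ) (ℤ.*-identityʳ (+ X)))
      (Σ-mono X λ {j} _ → ℤ.≤-trans (ℤ.≤-reflexive (trans (Σ-telescope X (λ i → + step i j))
        (trans (cong (λ t → + step 0 j - + t) (last-step j)) (ℤ.+-identityʳ (+ step 0 j))))) (ℤ.+≤+ (ℕ.m⊓n≤m 1 _)))
    counted : Σ< X (λ j → Σ< X (λ i → under (suc i) j)) ℤ.≤ + X * + suc l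
    counted = subst (ℤ._≤ + X * + suc l)
      (trans (cong (λ t → Σ< t (λ i → column X (suc i))) (sym X≡)) (Σ-swap X X _))
      (Σ-dyadic l X (λ i → column X (suc i)) (λ i → Σ-nonNegative X (λ {j} _ → under≥0 (suc i) j))
        λ i → ℤ.≤-trans (ℤ.*-monoʳ-≤-nonNeg (column X (suc i))
          {{ℤ.nonNegative (Σ-nonNegative X (λ {j} _ → under≥0 (suc i) j))}}
          (ℤ.+≤+ (ℕ.n≤1+n (suc i)))) (column-bound X (suc i)))

periodic-prefix : ∀ M .{{_ : ℕ.NonZero M}} (f : ℕ → ℤ) → (∀ i → f (i ℕ.+ M) ≡ f i) → Σ< M f ≡ 0ℤ → ∀ n → Σ< n f
  ≡ Σ< (n % M) f
periodic-prefix M f periodic zero-sum n = trans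
  (cong (λ t → Σ< t f) (trans (m≡m%n+[m/n]*n n M) (ℕ.+-comm (n % M) _))) (go (n ℕ./ M))
  where
  shift : ∀ q i → f (q ℕ.* M ℕ.+ i) ≡ f i
  shift zero    i = refl
  shift (suc q) i = trans (cong f (trans (ℕ.+-assoc M (q ℕ.* M) i) (ℕ.+-comm M (q ℕ.* M ℕ.+ i))))
    (trans (periodic (q ℕ.* M ℕ.+ i)) (shift q i))
  multiples : ∀ q → Σ< (q ℕ.* M) f ≡ 0ℤ
  multiples zero    = refl
  multiples (suc q) = trans (cong (λ t → Σ< t f) (ℕ.+-comm M (q ℕ.* M))) (trans (Σ-split (q ℕ.* M) M f)
    (cong₂ _+_ (multiples q) (trans (Σ-cong M (λ {i} _ → shift q i)) zero-sum)))
  go : ∀ q → Σ< (q ℕ.* M ℕ.+ n % M) f ≡ Σ< (n % M) f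
  go q = trans (Σ-split (q ℕ.* M) (n % M) f)
    (trans (cong₂ _+_ (multiples q) (Σ-cong (n % M) (λ {i} _ → shift q i))) (ℤ.+-identityˡ _))

-- Whole periods cancel in both directions, which leaves a rectangle with sides below M and entries
-- at most 1 in absolute value.
periodic-bound : ∀ M .{{_ : ℕ.NonZero M}} (k : ℕ → ℕ → ℤ) →
  (∀ i j → k i (j ℕ.+ M) ≡ k i j) → (∀ i j → k (i ℕ.+ M) j ≡ k i j) →
  (∀ i → Σ< M (k i) ≡ 0ℤ) → (∀ j → Σ< M (λ i → k i j) ≡ 0ℤ) → (∀ i j → ℤ.∣ k i j ∣ ℕ.≤ 1) →
  ∀ a b → ℤ.∣ Σ< a (λ i → Σ< b (k i)) ∣ ℕ.≤ M ℕ.* M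
periodic-bound M k perʳ perˡ rows columns k≤1 a b = ℤ.drop‿+≤+ (begin
  + ℤ.∣ Σ< a (λ i → Σ< b (k i)) ∣
    ≡⟨ cong (λ t → + ℤ.∣ t ∣)
      (trans (Σ-cong a λ {i} _ → periodic-prefix M (k i) (perʳ i) (rows i) b) (Σ-swap a (b % M) k)) ⟩
  + ℤ.∣ Σ< (b % M) (λ j → Σ< a (λ i → k i j)) ∣
    ≡⟨ cong (λ t → + ℤ.∣ t ∣)
      (Σ-cong (b % M) λ {j} _ → periodic-prefix M (λ i → k i j) (λ i → perˡ i j) (columns j) a) ⟩
  + ℤ.∣ Σ< (b % M) (λ j → Σ< (a % M) (λ i → k i j)) ∣
    ≤⟨ ℤ.≤-trans (Σ-abs (b % M) _)
      (Σ-mono (b % M) λ {j} _ → ℤ.≤-trans (Σ-abs (a % M) _) (Σ-mono (a % M) λ {i} _ → ℤ.+≤+ (k≤1 i j))) ⟩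
  Σ< (b % M) (λ _ → Σ< (a % M) (λ _ → 1ℤ))
    ≡⟨ trans (Σ-cong (b % M) λ _ → trans (Σ-const (a % M) 1ℤ) (ℤ.*-identityʳ _)) (Σ-const (b % M) (+ (a % M))) ⟩
  + (b % M) * + (a % M)
    ≡⟨ ℤ.pos-* (b % M) (a % M) ⟨
  + (b % M ℕ.* (a % M))
    ≤⟨ ℤ.+≤+ (ℕ.*-mono-≤ (ℕ.<⇒≤ (m%n<n b M)) (ℕ.<⇒≤ (m%n<n a M))) ⟩
  + (M ℕ.* M) ∎)
  where open ℤ.≤-Reasoning

m<2^m : ∀ m → m ℕ.< 2 ℕ.^ m
m<2^m zero    = s≤s z≤n
m<2^m (suc m) = ℕ.≤-trans (s≤s (m<2^m m)) (ℕ.≤-trans (ℕ.+-monoˡ-≤ (2 ℕ.^ m) (ℕ.m^n>0 2 m))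
  (ℕ.≤-reflexive (cong (2 ℕ.^ m ℕ.+_) (sym (ℕ.+-identityʳ (2 ℕ.^ m))))))

linear<2^ : ∀ a b → ∃[ k ] a ℕ.* k ℕ.+ b ℕ.< 2 ℕ.^ k
-- With t = 2a + b, the square (t + 1)² = t² + 2t + 1 already exceeds 2a t + b, and t + 1 ≤ 2^t.
linear<2^ a b = t ℕ.+ t , (begin-strict
  a ℕ.* (t ℕ.+ t) ℕ.+ b             <⟨ ℕ.m<m+n _ {suc (b ℕ.* t ℕ.+ (t ℕ.+ a ℕ.+ a))} (s≤s z≤n) ⟩
  a ℕ.* (t ℕ.+ t) ℕ.+ b ℕ.+ suc (b ℕ.* t ℕ.+ (t ℕ.+ a ℕ.+ a)) ≡⟨ lem a b ⟩
  suc t ℕ.* suc t                   ≤⟨ ℕ.*-mono-≤ (m<2^m t) (m<2^m t) ⟩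
  2 ℕ.^ t ℕ.* 2 ℕ.^ t               ≡⟨ ℕ.^-distribˡ-+-* 2 t t ⟨
  2 ℕ.^ (t ℕ.+ t)                   ∎)
  where
  open ℕ.≤-Reasoning
  t : ℕ
  t = a ℕ.+ a ℕ.+ b
  lem : ∀ a b → a ℕ.* ((a ℕ.+ a ℕ.+ b) ℕ.+ (a ℕ.+ a ℕ.+ b)) ℕ.+ b ℕ.+ suc
    (b ℕ.* (a ℕ.+ a ℕ.+ b) ℕ.+ ((a ℕ.+ a ℕ.+ b) ℕ.+ a ℕ.+ a))
    ≡ suc (a ℕ.+ a ℕ.+ b) ℕ.* suc (a ℕ.+ a ℕ.+ b)
  lem = ℕ-solve-∀

%⇒mod : ∀ {a b} m .{{_ : ℕ.NonZero m}} → a % m ≡ b % m → + a ≡ + b [mod + m ]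
%⇒mod {a} {b} m eq = mod-trans (%-mod a m) (mod-trans (mod-reflexive (cong (λ t → + t) eq)) (mod-sym (%-mod b m)))

-- Comparison of the residue classes of ρ and 1

module Progression {M} .{{_ : ℕ.NonZero M}} (character : Character M) (ρ : ℕ)
  (ρ-coprime : Coprime ρ M) (χρ≡1 : Character.χ character ρ ≡ 1ℤ) where
  open Character character
  open DivisorSum character

  hits : ℕ → ℕ → ℤ
  hits r y = guard (y ℕ.≟ r % M) 1ℤ

  test : ℕ → ℕ → ℤ
  test r x = hits r (x % M)

  test-resp : ∀ r {x y} → + x ≡ + y [mod + M ] → test r x ≡ test r y
  test-resp r p = cong (hits r) (mod⇒% M p)

  twist : ℕ → ℕ → ℕ → ℤ
  twist r d e = χ d * test r (e ℕ.* d)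

  -- With d = i + 1 and e = j + 1, summing this kernel against a weight in d e gives the difference
  -- between the weighted sums of G over n ≡ ρ and over n ≡ 1.
  k : ℕ → ℕ → ℤ
  k i j = twist ρ (suc i) (suc j) - twist 1 (suc i) (suc j)

  value-inverse : ∀ {x y} → Value x → Value y → x * y ≡ 1ℤ → x ≡ y
  value-inverse (sign pos) (sign pos) _ = refl
  value-inverse (sign neg) (sign neg) _ = refl

  -- If d e ≡ r, then χ(d) χ(e) = χ(r) = 1, so the two signs agree. This carries the vanishing of
  -- the row sums of `k` over to its column sums.
  twist-symmetric : ∀ r → χ r ≡ 1ℤ → ∀ d e → twist r d e ≡ twist r e d
  twist-symmetric r χr≡1 d e = trans by-cases (cong (λ t → χ e * test r t) (ℕ.*-comm e d))
    where
    by-cases : χ d * test r (e ℕ.* d) ≡ χ e * test r (e ℕ.* d)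
    by-cases with (e ℕ.* d) % M ℕ.≟ r % M
    ... | no  _  = trans (ℤ.*-zeroʳ (χ d)) (sym (ℤ.*-zeroʳ (χ e)))
    ... | yes eq = cong (_* 1ℤ) (sym (value-inverse (χ-value e) (χ-value d)
      (trans (sym (χ-* e d)) (trans (χ-resp (%⇒mod M eq)) χr≡1))))

  k-symmetric : ∀ i j → k i j ≡ k j i
  k-symmetric i j = cong₂ _-_ (twist-symmetric ρ χρ≡1 (suc i) (suc j)) (twist-symmetric 1 χ1 (suc i) (suc j))

  Σ-residues : ∀ {a} → Coprime a M → (f : ℕ → ℤ) → Σ< M (λ i → f ((i ℕ.* a) % M)) ≡ Σ< M f
  Σ-residues {a} c f = Σ-permute M f (λ i → (i ℕ.* a) % M) (λ {i} _ → m%n<n (i ℕ.* a) M) λ {i} {j} i<M j<M eq →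
    mod-small (mod-cancelˡ (+ i) (+ j) c
      (mod-trans (mod-reflexive (swap i)) (mod-trans (%⇒mod M eq) (mod-reflexive (sym (swap j)))))) i<M j<M
    where
    swap : ∀ i → + a * + i ≡ + (i ℕ.* a)
    swap i = trans (ℤ.*-comm (+ a) (+ i)) (sym (ℤ.pos-* i a))

  -- Multiplication by ρ permutes the residues and carries the class of 1 to that of ρ.
  hits-total : Σ< M (hits ρ) ≡ Σ< M (hits 1)
  hits-total = trans (sym (Σ-residues ρ-coprime (hits ρ))) (Σ-cong M λ {i} i<M →
    guard-cong ((i ℕ.* ρ) % M ℕ.≟ ρ % M) (i ℕ.≟ 1 % M)
      (λ eq → trans (sym (m<n⇒m%n≡m i<M)) (mod⇒% M (mod-cancelˡ {ρ} (+ i) (+ 1) ρ-coprime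
        (mod-trans (mod-reflexive (trans (ℤ.*-comm (+ ρ) (+ i)) (sym (ℤ.pos-* i ρ))))
          (mod-trans (%⇒mod M eq) (mod-reflexive (sym (ℤ.*-identityʳ (+ ρ)))))))))
      (λ { refl → mod⇒% M (mod-trans (mod-reflexive (ℤ.pos-* (1 % M) ρ))
        (mod-trans (mod-* (mod-sym (%-mod 1 M)) (mod-reflexive {a = + ρ} refl))
          (mod-reflexive (ℤ.*-identityˡ (+ ρ))))) })
      (λ _ → refl))

  twist-row : ∀ r d → Coprime d M → Σ< M (λ j → twist r d (suc j)) ≡ χ d * Σ< M (hits r)
  twist-row r d c = trans (Σ-*ˡ M (χ d) _) (cong (χ d *_) (trans
    (Σ-shift M (λ j → test r (j ℕ.* d))
      (cong (hits r) (mod⇒% M (congruent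
      (divides (+ d) (trans (ℤ.+-identityʳ _) (trans (cong (λ t → + t) (ℕ.*-comm M d)) (ℤ.pos-* d M))))))))
      (Σ-residues c (hits r))))

  -- If d is prime to M, then d e meets the classes of ρ and of 1 equally often as e runs over a
  -- period; otherwise χ(d) = 0.
  k-row : ∀ i → Σ< M (k i) ≡ 0ℤ
  k-row i with coprime? (suc i) M
  ... | no ¬c = Σ-vanish M λ {j} _ → cong₂ (λ a b → a * test ρ (suc j ℕ.* suc i) - b * test 1 (suc j ℕ.* suc i))
    (χ-noncoprime ¬c) (χ-noncoprime ¬c)
  ... | yes c = begin
    Σ< M (k i)                                                            ≡⟨ Σ-+ M _ _ ⟩
    Σ< M (λ j → twist ρ d (suc j)) + Σ< M (λ j → - twist 1 d (suc j))             ≡⟨ cong₂ _+_ (twist-row ρ d c)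
      negated ⟩
    χ d * Σ< M (hits ρ) + -1ℤ * (χ d * Σ< M (hits 1))                     ≡⟨ cong
      (λ t → χ d * t + -1ℤ * (χ d * Σ< M (hits 1))) hits-total ⟩
    χ d * Σ< M (hits 1) + -1ℤ * (χ d * Σ< M (hits 1))                     ≡⟨ lem (χ d * Σ< M (hits 1)) ⟩
    0ℤ                                                                    ∎
    where
    open ≡-Reasoning
    d : ℕ
    d = suc i
    lem : ∀ x → x + -1ℤ * x ≡ 0ℤ
    lem = solve-∀
    negated : Σ< M (λ j → - twist 1 d (suc j)) ≡ -1ℤ * (χ d * Σ< M (hits 1))
    negated = trans (Σ-cong M λ {j} _ → sym (ℤ.-1*i≡-i (twist 1 d (suc j))))
      (trans (Σ-*ˡ M -1ℤ _) (cong (-1ℤ *_) (twist-row 1 d c)))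

  k-periodic : ∀ i j → k i (j ℕ.+ M) ≡ k i j
  k-periodic i j = cong₂ (λ a b → χ (suc i) * a - χ (suc i) * b) (test-resp ρ shifted) (test-resp 1 shifted)
    where
    lem : ∀ j m d → (1ℤ + (j + m)) * d - (1ℤ + j) * d ≡ d * m
    lem = solve-∀
    shifted : + (suc (j ℕ.+ M) ℕ.* suc i) ≡ + (suc j ℕ.* suc i) [mod + M ]
    shifted = congruent (divides (+ suc i)
      (trans (cong₂ _-_ (ℤ.pos-* (suc (j ℕ.+ M)) (suc i)) (ℤ.pos-* (suc j) (suc i))) (lem (+ j) (+ M) (+ suc i))))

  k-small : ∀ i j → ℤ.∣ k i j ∣ ℕ.≤ 1
  k-small i j with χ (suc i) | χ-value (suc i) | (suc j ℕ.* suc i) % M ℕ.≟ ρ % M | (suc j ℕ.* suc i) % M ℕ.≟ 1 % M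
  ... | _ | sign pos | yes _ | yes _ = z≤n
  ... | _ | sign pos | yes _ | no  _ = s≤s z≤n
  ... | _ | sign pos | no  _ | yes _ = s≤s z≤n
  ... | _ | sign pos | no  _ | no  _ = z≤n
  ... | _ | sign neg | yes _ | yes _ = z≤n
  ... | _ | sign neg | yes _ | no  _ = s≤s z≤n
  ... | _ | sign neg | no  _ | yes _ = s≤s z≤n
  ... | _ | sign neg | no  _ | no  _ = z≤n
  ... | _ | null     | yes _ | yes _ = z≤n
  ... | _ | null     | yes _ | no  _ = z≤n
  ... | _ | null     | no  _ | yes _ = z≤n
  ... | _ | null     | no  _ | no  _ = z≤n

  k-bound : ∀ a b → ℤ.∣ Σ< a (λ i → Σ< b (k i)) ∣ ℕ.≤ M ℕ.* M
  k-bound = periodic-bound M k k-periodic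
    (λ i j → trans (k-symmetric (i ℕ.+ M) j) (trans (k-periodic j i) (k-symmetric j i)))
    k-row (λ j → trans (Σ-cong M λ {i} _ → k-symmetric i j) (k-row j)) k-small

  module _ (X : ℕ) where
    open HyperbolaWeight X using (V)

    F : ℕ → ℕ → ℤ
    F r n = test r n * + (X ℕ.∸ n)

    A : ℕ → ℤ
    A r = Σ< X (λ m → G (suc m) * F r (suc m))

    -- The pairs (d, e) are sorted by n = d e. For fixed d, the numbers e d run over the multiples
    -- of d, and those beyond X have weight 0.
    regroup : ∀ r → Σ< X (λ i → Σ< X (λ j → twist r (suc i) (suc j) * V i j)) ≡ A r
    regroup r = begin
      Σ< X (λ i → Σ< X (λ j → twist r (suc i) (suc j) * V i j))
        ≡⟨ Σ-cong X (λ {i} _ → inner i) ⟩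
      Σ< X (λ i → Σ< X (λ m → term (suc m) i * F r (suc m)))
        ≡⟨ Σ-swap X X _ ⟩
      Σ< X (λ m → Σ< X (λ i → term (suc m) i * F r (suc m)))
        ≡⟨ Σ-cong X (λ {m} m<X → trans (Σ-*ʳ X (F r (suc m)) (term (suc m)))
          (cong (_* F r (suc m)) (G-range (s≤s z≤n) m<X))) ⟩
      A r ∎
      where
      open ≡-Reasoning
      beyond : ∀ {m} d → X ℕ.≤ m → guard (d ℕ∣.∣? suc m) (F r (suc m)) ≡ 0ℤ
      beyond {m} d X≤m with d ℕ∣.∣? suc m
      ... | no  _ = refl
      ... | yes _ = trans (cong (λ t → test r (suc m) * + t) (ℕ.m≤n⇒m∸n≡0 (ℕ.m≤n⇒m≤1+n X≤m)))
        (ℤ.*-zeroʳ (test r (suc m)))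
      pull : ∀ m i → χ (suc i) * guard (suc i ℕ∣.∣? suc m) (F r (suc m)) ≡ term (suc m) i * F r (suc m)
      pull m i with suc i ℕ∣.∣? suc m
      ... | yes _ = refl
      ... | no  _ = ℤ.*-zeroʳ (χ (suc i))
      inner : ∀ i → Σ< X (λ j → twist r (suc i) (suc j) * V i j) ≡ Σ< X (λ m → term (suc m) i * F r (suc m))
      inner i = begin
        Σ< X (λ j → twist r (suc i) (suc j) * V i j)
          ≡⟨ trans (Σ-cong X λ {j} _ → ℤ.*-assoc (χ (suc i)) (test r (suc j ℕ.* suc i)) (V i j))
            (Σ-*ˡ X (χ (suc i)) _) ⟩
        χ (suc i) * Σ< X (λ j → F r (suc j ℕ.* suc i))
          ≡⟨ cong (χ (suc i) *_) (sym (Σ-multiples i X (F r))) ⟩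
        χ (suc i) * Σ< (X ℕ.* suc i) (λ m → guard (suc i ℕ∣.∣? suc m) (F r (suc m)))
          ≡⟨ cong (χ (suc i) *_) (Σ-extend _ (ℕ.m≤m*n X (suc i)) (beyond (suc i))) ⟩
        χ (suc i) * Σ< X (λ m → guard (suc i ℕ∣.∣? suc m) (F r (suc m)))
          ≡⟨ trans (sym (Σ-*ˡ X (χ (suc i)) _)) (Σ-cong X λ {m} _ → pull m i) ⟩
        Σ< X (λ m → term (suc m) i * F r (suc m)) ∎

    discrepancy : ∀ l → X ≡ 2 ℕ.^ l → + ℤ.∣ A ρ - A 1 ∣ ℤ.≤ + (M ℕ.* M) * (+ X * (+ 3 + + 2 * + l))
    discrepancy l X≡ = begin
      + ℤ.∣ A ρ - A 1 ∣                                        ≡⟨ cong (λ t → + ℤ.∣ t ∣) difference ⟨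
      + ℤ.∣ Σ< X (λ i → Σ< X (λ j → k i j * V i j)) ∣          ≤⟨ DoubleAbel.double-abel k (M ℕ.* M) k-bound X V
        V-right V-bottom ⟩
      + (M ℕ.* M) * _                                          ≤⟨ ℤ.*-monoˡ-≤-nonNeg (+ (M ℕ.* M))
        (total-variation l X≡) ⟩
      + (M ℕ.* M) * (+ X * (+ 3 + + 2 * + l))                  ∎
      where
      open HyperbolaWeight X using (V-right; V-bottom; total-variation)
      open ℤ.≤-Reasoning
      distribute : ∀ a b v → (a - b) * v ≡ a * v + -1ℤ * (b * v)
      distribute = solve-∀
      difference : Σ< X (λ i → Σ< X (λ j → k i j * V i j)) ≡ A ρ - A 1
      difference = trans (Σ-cong X λ {i} _ → trans
        (Σ-cong X λ {j} _ → distribute (twist ρ (suc i) (suc j)) (twist 1 (suc i) (suc j)) (V i j))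
          (trans (Σ-+ X _ _) (cong (λ t → Σ< X (λ j → twist ρ (suc i) (suc j) * V i j) + t) (Σ-*ˡ X -1ℤ _))))
        (trans (Σ-+ X _ _) (cong₂ _+_ (regroup ρ)
          (trans (Σ-*ˡ X -1ℤ _) (trans (cong (-1ℤ *_) (regroup 1)) (ℤ.-1*i≡-i (A 1))))))

    -- The squares (1 + M j)² with j < J are 1 modulo M and at most Y = X / 2. Each has G at least 1
    -- and weight at least Y, and all other terms are nonnegative.
    squares-contribute : ∀ J Y → X ≡ 2 ℕ.* Y → (M ℕ.* J) ℕ.* (M ℕ.* J) ℕ.≤ Y → 0 ℕ.< Y → + (J ℕ.* Y) ℤ.≤ A 1
    squares-contribute J Y refl small 0<Y = begin
      + (J ℕ.* Y)          ≡⟨ ℤ.pos-* J Y ⟩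
      + J * + Y            ≡⟨ Σ-const J (+ Y) ⟨
      Σ< J (λ _ → + Y)     ≤⟨ Σ-mono J value ⟩
      Σ< J (a ∘ s)         ≤⟨ Σ-subsequence J a≥0 (λ i<j → mono (ℕ.*-monoʳ-< M i<j))
        (λ j<J → ℕ.≤-trans (s≤Y j<J) (ℕ.m≤m+n Y _)) ⟩
      A 1                  ∎
      where
      open ℤ.≤-Reasoning
      a : ℕ → ℤ
      a m = G (suc m) * F 1 (suc m)
      s : ℕ → ℕ
      -- The index of (1 + M j)²: `suc (s j)` is this square by definition of multiplication.
      s j = M ℕ.* j ℕ.+ M ℕ.* j ℕ.* suc (M ℕ.* j)
      mono : ∀ {x y} → x ℕ.< y → x ℕ.+ x ℕ.* suc x ℕ.< y ℕ.+ y ℕ.* suc y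
      mono x<y = ℕ.+-mono-<-≤ x<y (ℕ.*-mono-≤ (ℕ.<⇒≤ x<y) (s≤s (ℕ.<⇒≤ x<y)))
      F≥0 : ∀ n → 0ℤ ℤ.≤ F 1 n
      F≥0 n with n % M ℕ.≟ 1 % M
      ... | yes _ = subst (0ℤ ℤ.≤_) (sym (ℤ.*-identityˡ (+ (X ℕ.∸ n)))) (ℤ.+≤+ z≤n)
      ... | no  _ = ℤ.≤-refl
      a≥0 : ∀ m → 0ℤ ℤ.≤ a m
      a≥0 m = nonNegative-* (G-nonNegative (suc m) (s≤s z≤n)) (F≥0 (suc m))
      s≤Y : ∀ {j} → j ℕ.< J → suc (s j) ℕ.≤ Y
      s≤Y {j} j<J = ℕ.≤-trans (ℕ.*-mono-≤ side side) small
        where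
        side : suc (M ℕ.* j) ℕ.≤ M ℕ.* J
        side = ℕ.≤-trans (ℕ.+-monoˡ-≤ (M ℕ.* j) (ℕ.>-nonZero⁻¹ M))
          (ℕ.≤-trans (ℕ.≤-reflexive (sym (ℕ.*-suc M j))) (ℕ.*-monoʳ-≤ M j<J))
      square≡1 : ∀ x m → (1ℤ + m * x) * (1ℤ + m * x) - 1ℤ ≡ (x * (+ 2 + m * x)) * m
      square≡1 = solve-∀
      test≡1 : ∀ j → test 1 (suc (s j)) ≡ 1ℤ
      test≡1 j = guard-yes (suc (s j) % M ℕ.≟ 1 % M) (mod⇒% M (congruent (divides (+ j * (+ 2 + + M * + j))
        (trans (cong (_- 1ℤ) (trans (ℤ.pos-* (suc (M ℕ.* j)) (suc (M ℕ.* j)))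
          (cong (λ t → (1ℤ + t) * (1ℤ + t)) (ℤ.pos-* M j)))) (square≡1 (+ j) (+ M))))))
      value : ∀ {j} → j ℕ.< J → + Y ℤ.≤ a (s j)
      value {j} j<J = begin
        + Y                                             ≤⟨ ℤ.+≤+
          (ℕ.m+n≤o⇒m≤o∸n Y (ℕ.+-monoʳ-≤ Y (ℕ.≤-trans (s≤Y j<J) (ℕ.m≤m+n Y 0)))) ⟩
        + (X ℕ.∸ suc (s j))                             ≡⟨ trans (cong (_* + (X ℕ.∸ suc (s j))) (test≡1 j))
          (ℤ.*-identityˡ _) ⟨
        F 1 (suc (s j))                                 ≡⟨ ℤ.*-identityˡ _ ⟨
        1ℤ * F 1 (suc (s j))                            ≤⟨ ℤ.*-monoʳ-≤-nonNeg (F 1 (suc (s j)))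
          {{ℤ.nonNegative (F≥0 (suc (s j)))}}
                                                            (G-square (suc (M ℕ.* j)) (s≤s z≤n)) ⟩
        a (s j)                                         ∎

  -- Were G zero on the class of ρ up to X, then A(ρ) = 0 and the two bounds would give W Y ≤ M² X
  -- (3 + 2l). Here X = 2Y, and Y = 4^(M + κ) has room for W = 2^κ squares because M W ≤ 2^(M + κ).
  -- With l = 1 + 2 (M + κ) the right side is (8M² κ + M² (10 + 8M)) Y, and κ is chosen so that W
  -- exceeds the factor of Y.
  progression : ∃[ n ] (0 ℕ.< n × + n ≡ + ρ [mod + M ] × G n ≢ 0ℤ)
  progression with linear<2^ (M ℕ.* M ℕ.* 8) (M ℕ.* M ℕ.* (10 ℕ.+ 8 ℕ.* M))
  ... | κ , large = search (ℕ.anyUpTo? (λ m → (suc m % M ℕ.≟ ρ % M) ×-dec ¬? (G (suc m) ℤ.≟ 0ℤ)) X)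
    where
    l′ l Y X W : ℕ
    l′ = (M ℕ.+ κ) ℕ.+ (M ℕ.+ κ)
    l = suc l′
    Y = 2 ℕ.^ l′
    X = 2 ℕ.^ l
    W = 2 ℕ.^ κ
    small : (M ℕ.* W) ℕ.* (M ℕ.* W) ℕ.≤ Y
    small = ℕ.≤-trans (ℕ.*-mono-≤ side side) (ℕ.≤-reflexive (sym (ℕ.^-distribˡ-+-* 2 (M ℕ.+ κ) (M ℕ.+ κ))))
      where
      side : M ℕ.* W ℕ.≤ 2 ℕ.^ (M ℕ.+ κ)
      side = ℕ.≤-trans (ℕ.*-monoˡ-≤ W (ℕ.<⇒≤ (m<2^m M))) (ℕ.≤-reflexive (sym (ℕ.^-distribˡ-+-* 2 M κ)))
    arith : ∀ B Y M κ → B ℕ.* ((2 ℕ.* Y) ℕ.* (3 ℕ.+ 2 ℕ.* suc ((M ℕ.+ κ) ℕ.+ (M ℕ.+ κ)))) ≡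
      (B ℕ.* 8 ℕ.* κ ℕ.+ B ℕ.* (10 ℕ.+ 8 ℕ.* M)) ℕ.* Y
    arith = ℕ-solve-∀
    search : Dec _ → _
    search (yes (m , _ , eq , G≢0)) = suc m , s≤s z≤n , %⇒mod M eq , G≢0
    search (no ∄) = contradiction (ℤ.drop‿+≤+ (begin
      + (W ℕ.* Y)                                     ≤⟨ squares-contribute X W Y refl small (ℕ.m^n>0 2 l′) ⟩
      A X 1                                           ≤⟨ i≤∣i∣ (A X 1) ⟩
      + ℤ.∣ A X 1 ∣                                   ≡⟨ cong (λ t → + t)
        (trans (sym (ℤ.∣-i∣≡∣i∣ (A X 1)))
        (cong ℤ.∣_∣ (sym (trans (cong (_- A X 1) Aρ≡0) (ℤ.+-identityˡ (- A X 1)))))) ⟩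
      + ℤ.∣ A X ρ - A X 1 ∣                           ≤⟨ discrepancy X l refl ⟩
      + (M ℕ.* M) * (+ X * (+ 3 + + 2 * + l))         ≡⟨ cong (λ t → + (M ℕ.* M) * (+ X * (+ 3 + t)))
        (ℤ.pos-* 2 l) ⟨
      + (M ℕ.* M) * (+ X * + (3 ℕ.+ 2 ℕ.* l))         ≡⟨ trans
        (cong (+ (M ℕ.* M) *_) (sym (ℤ.pos-* X (3 ℕ.+ 2 ℕ.* l)))) (sym (ℤ.pos-* (M ℕ.* M) _)) ⟩
      + (M ℕ.* M ℕ.* (X ℕ.* (3 ℕ.+ 2 ℕ.* l)))         ≡⟨ cong (λ t → + t) (arith (M ℕ.* M) Y M κ) ⟩
      + ((M ℕ.* M ℕ.* 8 ℕ.* κ ℕ.+ M ℕ.* M ℕ.* (10 ℕ.+ 8 ℕ.* M)) ℕ.* Y) ∎))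
      (ℕ.<⇒≱ (ℕ.*-monoˡ-< Y {{ℕ.m^n≢0 2 l′}} large))
      where
      open ℤ.≤-Reasoning
      i≤∣i∣ : ∀ i → i ℤ.≤ + ℤ.∣ i ∣
      i≤∣i∣ (+ n)        = ℤ.≤-refl
      i≤∣i∣ (ℤ.-[1+ n ]) = ℤ.-≤+
      Aρ≡0 : A X ρ ≡ 0ℤ
      Aρ≡0 = Σ-vanish X vanish
        where
        vanish : ∀ {m} → m ℕ.< X → G (suc m) * F X ρ (suc m) ≡ 0ℤ
        vanish {m} m<X with suc m % M ℕ.≟ ρ % M | G (suc m) ℤ.≟ 0ℤ
        ... | no  _  | _       = ℤ.*-zeroʳ (G (suc m))
        ... | yes eq | yes G≡0 = trans (cong (_* (1ℤ * + (X ℕ.∸ suc m))) G≡0) (ℤ.*-zeroˡ (1ℤ * + (X ℕ.∸ suc m)))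
        ... | yes eq | no G≢0  = contradiction (m , m<X , eq , G≢0) ∄

-- Selling reduction of ternary lattices

-- Over an arbitrary signature, so that the same expressions serve as integers and as solver polynomials.
module TreeSum {A : Set} (_⊕_ _⊗_ : A → A → A) where
  trees : (a b c d e f : A) → A
  trees a b c d e f =
    ((((((a ⊗ b) ⊗ (c ⊕ (e ⊕ f))) ⊕ ((a ⊗ c) ⊗ (d ⊕ f))) ⊕ ((a ⊗ d) ⊗ (e ⊕ f))) ⊕ ((a ⊗ e) ⊗ f)) ⊕
    ((((b ⊗ c) ⊗ (d ⊕ e)) ⊕ ((b ⊗ d) ⊗ (e ⊕ f))) ⊕ (((b ⊗ e) ⊗ f) ⊕ ((c ⊗ d) ⊗ (e ⊕ f))))) ⊕ ((c ⊗ e) ⊗ f)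

module SellingForm {A : Set} (_⊕_ _⊗_ _⊖_ : A → A → A) where
  edge : A → A → A → A
  edge q x y = q ⊗ ((x ⊖ y) ⊗ (x ⊖ y))
  selling : (a b c d e f x₀ x₁ x₂ x₃ : A) → A
  selling a b c d e f x₀ x₁ x₂ x₃ =
    (edge a x₀ x₁ ⊕ edge b x₀ x₂) ⊕ ((edge c x₀ x₃ ⊕ edge d x₁ x₂) ⊕ (edge e x₁ x₃ ⊕ edge f x₂ x₃))

-- The form Σ q_ij (x_i - x_j)² in the Selling parameters a, b, c, d, e, f = q₀₁, q₀₂, q₀₃, q₁₂, q₁₃, q₂₃;
-- the determinant of its Gram matrix is the sum over the sixteen spanning trees of K₄.
open SellingForm _+_ _*_ _-_ using (selling)
open TreeSum _+_ _*_ using (trees)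

private
  module ℤP where
    open ℤSolver.+-*-Solver public
    module _ {n : ℕ} where
      open SellingForm {Polynomial n} _:+_ _:*_ _:-_ public
      open TreeSum {Polynomial n} _:+_ _:*_ public
  module ℕP where
    open ℕSolver.+-*-Solver public
    module _ {n : ℕ} where
      open TreeSum {Polynomial n} _:+_ _:*_ public

Even : ℤ → Set
Even x = ∃[ k ] x ≡ k + k

even-resp : ∀ {x y} → x ≡ y → Even x → Even y
even-resp refl p = p

-- Vectors v₀ + v₁ + v₂ + v₃ = 0 of an even ternary lattice with q_ij = - v_i · v_j, where `selling`
-- is the norm of Σ x_i v_i. The norm of v_i is the sum of the three parameters at i, hence the four
-- parity conditions, and n is half of a norm.
record Superbase (n a b c d e f : ℤ) : Set where
  field
    nonNegative : ∀ x₀ x₁ x₂ x₃ → 0ℤ ℤ.≤ selling a b c d e f x₀ x₁ x₂ x₃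
    determinant : trees a b c d e f ≡ + 6
    even₀       : Even (a + b + c)
    even₁       : Even (a + d + e)
    even₂       : Even (b + d + f)
    even₃       : Even (c + e + f)
    represents  : ∃[ x₀ ] ∃[ x₁ ] ∃[ x₂ ] ∃[ x₃ ] n + n ≡ selling a b c d e f x₀ x₁ x₂ x₃

-- The three adjacent transpositions generate all relabellings of the v_i; they serve to move a
-- negative parameter to the place d = q₁₂.
swap₀₁ : ∀ {n a b c d e f} → Superbase n a b c d e f → Superbase n a d e b c f
swap₀₁ {n} {a} {b} {c} {d} {e} {f} s = record
  { nonNegative = λ x₀ x₁ x₂ x₃ → subst (0ℤ ℤ.≤_) (form a b c d e f x₀ x₁ x₂ x₃) (nonNegative x₁ x₀ x₂ x₃)
  ; determinant = trans (tree a b c d e f) determinant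
  ; even₀ = even₁
  ; even₁ = even₀
  ; even₂ = even-resp (cong (_+ f) (ℤ.+-comm b d)) even₂
  ; even₃ = even-resp (cong (_+ f) (ℤ.+-comm c e)) even₃
  ; represents  = let x₀ , x₁ , x₂ , x₃ , eq = represents in x₁ , x₀ , x₂ , x₃ , trans eq (form a b c d e f x₁ x₀ x₂ x₃)
  }
  where
  open Superbase s
  open ℤP using (solve; _:=_)
  form : ∀ a b c d e f x₀ x₁ x₂ x₃ → selling a b c d e f x₁ x₀ x₂ x₃ ≡ selling a d e b c f x₀ x₁ x₂ x₃
  form = solve 10 (λ a b c d e f x₀ x₁ x₂ x₃ → ℤP.selling a b c d e f x₁ x₀ x₂ x₃ := ℤP.selling a d e b c f x₀
    x₁ x₂ x₃) refl
  tree : ∀ a b c d e f → trees a d e b c f ≡ trees a b c d e f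
  tree = solve 6 (λ a b c d e f → ℤP.trees a d e b c f := ℤP.trees a b c d e f) refl

swap₁₂ : ∀ {n a b c d e f} → Superbase n a b c d e f → Superbase n b a c d f e
swap₁₂ {n} {a} {b} {c} {d} {e} {f} s = record
  { nonNegative = λ x₀ x₁ x₂ x₃ → subst (0ℤ ℤ.≤_) (form a b c d e f x₀ x₁ x₂ x₃) (nonNegative x₀ x₂ x₁ x₃)
  ; determinant = trans (tree a b c d e f) determinant
  ; even₀ = even-resp (cong (_+ c) (ℤ.+-comm a b)) even₀
  ; even₁ = even₂
  ; even₂ = even₁
  ; even₃ = even-resp (trans (ℤ.+-assoc c e f)
      (trans (cong (λ t → c + t) (ℤ.+-comm e f)) (sym (ℤ.+-assoc c f e)))) even₃
  ; represents  = let x₀ , x₁ , x₂ , x₃ , eq = represents in x₀ , x₂ , x₁ , x₃ , trans eq (form a b c d e f x₀ x₂ x₁ x₃)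
  }
  where
  open Superbase s
  open ℤP using (solve; _:=_)
  form : ∀ a b c d e f x₀ x₁ x₂ x₃ → selling a b c d e f x₀ x₂ x₁ x₃ ≡ selling b a c d f e x₀ x₁ x₂ x₃
  form = solve 10 (λ a b c d e f x₀ x₁ x₂ x₃ → ℤP.selling a b c d e f x₀ x₂ x₁ x₃ := ℤP.selling b a c d f e x₀
    x₁ x₂ x₃) refl
  tree : ∀ a b c d e f → trees b a c d f e ≡ trees a b c d e f
  tree = solve 6 (λ a b c d e f → ℤP.trees b a c d f e := ℤP.trees a b c d e f) refl

swap₂₃ : ∀ {n a b c d e f} → Superbase n a b c d e f → Superbase n a c b e d f
swap₂₃ {n} {a} {b} {c} {d} {e} {f} s = record
  { nonNegative = λ x₀ x₁ x₂ x₃ → subst (0ℤ ℤ.≤_) (form a b c d e f x₀ x₁ x₂ x₃) (nonNegative x₀ x₁ x₃ x₂)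
  ; determinant = trans (tree a b c d e f) determinant
  ; even₀ = even-resp (trans (ℤ.+-assoc a b c)
      (trans (cong (λ t → a + t) (ℤ.+-comm b c)) (sym (ℤ.+-assoc a c b)))) even₀
  ; even₁ = even-resp (trans (ℤ.+-assoc a d e)
      (trans (cong (λ t → a + t) (ℤ.+-comm d e)) (sym (ℤ.+-assoc a e d)))) even₁
  ; even₂ = even₃
  ; even₃ = even₂
  ; represents  = let x₀ , x₁ , x₂ , x₃ , eq = represents in x₀ , x₁ , x₃ , x₂ , trans eq (form a b c d e f x₀ x₁ x₃ x₂)
  }
  where
  open Superbase s
  open ℤP using (solve; _:=_)
  form : ∀ a b c d e f x₀ x₁ x₂ x₃ → selling a b c d e f x₀ x₁ x₃ x₂ ≡ selling a c b e d f x₀ x₁ x₂ x₃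
  form = solve 10 (λ a b c d e f x₀ x₁ x₂ x₃ → ℤP.selling a b c d e f x₀ x₁ x₃ x₂ := ℤP.selling a c b e d f x₀
    x₁ x₂ x₃) refl
  tree : ∀ a b c d e f → trees a c b e d f ≡ trees a b c d e f
  tree = solve 6 (λ a b c d e f → ℤP.trees a c b e d f := ℤP.trees a b c d e f) refl

-- The superbase (v₀, v₁, v₂, v₃) is replaced by (v₀ + v₁, - v₁, v₂, v₃ + v₁).
sell : ∀ {n a b c d e f} → Superbase n a b c d e f → Superbase n (d + e) (b + d) (c - d) (- d) (a + d) (f + d)
sell {n} {a} {b} {c} {d} {e} {f} s = record
  { nonNegative = λ x₀ x₁ x₂ x₃ → subst (0ℤ ℤ.≤_) (form a b c d e f x₀ x₁ x₂ x₃)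
      (nonNegative x₀ (x₃ + x₀ - x₁) x₂ x₃)
  ; determinant = trans (tree a b c d e f) determinant
  ; even₀ = let k , eq = even₀ ; l , eq′ = even₁ in k + l - a , trans (e₀ a b c d e) (trans (cong₂ (λ s t → s + t - (a + a)) eq eq′) (e₀′ k l a))
  ; even₁ = even-resp (e₁ a d e) even₁
  ; even₂ = even-resp (e₂ b d f) even₂
  ; even₃ = let k , eq = even₁ ; l , eq′ = even₃ in k + l - e , trans (e₃ a c d e f) (trans (cong₂ (λ s t → s + t - (e + e)) eq eq′) (e₀′ k l e))
  ; represents  = let x₀ , x₁ , x₂ , x₃ , eq = represents in
      x₀ , x₃ + x₀ - x₁ , x₂ , x₃ , trans eq
        (trans (sym (involution a b c d e f x₀ x₁ x₂ x₃)) (form a b c d e f x₀ (x₃ + x₀ - x₁) x₂ x₃))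
  }
  where
  open Superbase s
  open ℤP using (solve; _:=_; _:+_; _:-_; :-_)
  form : ∀ a b c d e f x₀ x₁ x₂ x₃ →
    selling a b c d e f x₀ (x₃ + x₀ - x₁) x₂ x₃ ≡ selling (d + e) (b + d) (c - d) (- d) (a + d) (f + d) x₀ x₁ x₂ x₃
  form = solve 10 (λ a b c d e f x₀ x₁ x₂ x₃ → ℤP.selling a b c d e f x₀ (x₃ :+ x₀ :- x₁) x₂ x₃ :=
    ℤP.selling (d :+ e) (b :+ d) (c :- d) (:- d) (a :+ d) (f :+ d) x₀ x₁ x₂ x₃) refl
  involution : ∀ a b c d e f x₀ x₁ x₂ x₃ →
    selling a b c d e f x₀ (x₃ + x₀ - (x₃ + x₀ - x₁)) x₂ x₃ ≡ selling a b c d e f x₀ x₁ x₂ x₃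
  involution a b c d e f x₀ x₁ x₂ x₃ = cong (λ x → selling a b c d e f x₀ x x₂ x₃) (back x₀ x₁ x₃)
    where
    back : ∀ x₀ x₁ x₃ → x₃ + x₀ - (x₃ + x₀ - x₁) ≡ x₁
    back = solve-∀
  tree : ∀ a b c d e f → trees (d + e) (b + d) (c - d) (- d) (a + d) (f + d) ≡ trees a b c d e f
  tree = solve 6 (λ a b c d e f → ℤP.trees (d :+ e) (b :+ d) (c :- d) (:- d) (a :+ d) (f :+ d) := ℤP.trees a b c
    d e f) refl
  e₀ : ∀ a b c d e → d + e + (b + d) + (c - d) ≡ (a + b + c) + (a + d + e) - (a + a)
  e₀ = solve-∀
  e₀′ : ∀ k l a → (k + k) + (l + l) - (a + a) ≡ (k + l - a) + (k + l - a)
  e₀′ = solve-∀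
  e₁ : ∀ a d e → a + d + e ≡ d + e + - d + (a + d)
  e₁ = solve-∀
  e₂ : ∀ b d f → b + d + f ≡ b + d + - d + (f + d)
  e₂ = solve-∀
  e₃ : ∀ a c d e f → c - d + (a + d) + (f + d) ≡ (a + d + e) + (c + e + f) - (e + e)
  e₃ = solve-∀

-- Half the sum of the norms of the four vectors, hence nonnegative. Selling's step at d < 0 adds d
-- to it, so it drops by at least 1 and bounds the length of the reduction.
total : (a b c d e f : ℤ) → ℤ
total a b c d e f = (a + b + c) + (d + e + f)

total-nonNegative : ∀ {n a b c d e f} → Superbase n a b c d e f → 0ℤ ℤ.≤ total a b c d e f
total-nonNegative {n} {a} {b} {c} {d} {e} {f} s = halve (total a b c d e f) (subst (0ℤ ℤ.≤_) (lem a b c d e f)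
  (ℤ.+-mono-≤ (ℤ.+-mono-≤ (nonNegative 1ℤ 0ℤ 0ℤ 0ℤ) (nonNegative 0ℤ 1ℤ 0ℤ 0ℤ))
    (ℤ.+-mono-≤ (nonNegative 0ℤ 0ℤ 1ℤ 0ℤ) (nonNegative 0ℤ 0ℤ 0ℤ 1ℤ))))
  where
  open Superbase s
  open ℤP using (solve; _:=_; _:+_; con)
  halve : ∀ x → 0ℤ ℤ.≤ x + x → 0ℤ ℤ.≤ x
  halve (+ n)      _ = ℤ.+≤+ z≤n
  halve ℤ.-[1+ n ] ()
  lem : ∀ a b c d e f → (selling a b c d e f 1ℤ 0ℤ 0ℤ 0ℤ + selling a b c d e f 0ℤ 1ℤ 0ℤ 0ℤ) +
    (selling a b c d e f 0ℤ 0ℤ 1ℤ 0ℤ + selling a b c d e f 0ℤ 0ℤ 0ℤ 1ℤ) ≡ total a b c d e f + total a b c d e f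
  lem = solve 6 (λ a b c d e f → let z = con 0ℤ ; o = con 1ℤ ; t = (a :+ b :+ c) :+ (d :+ e :+ f) in
    (ℤP.selling a b c d e f o z z z :+ ℤP.selling a b c d e f z o z z) :+
    (ℤP.selling a b c d e f z z o z :+ ℤP.selling a b c d e f z z z o) := t :+ t) refl

Reduced : ℤ → Set
Reduced n = ∃[ a ] ∃[ b ] ∃[ c ] ∃[ d ] ∃[ e ] ∃[ f ] Superbase n (+ a) (+ b) (+ c) (+ d) (+ e) (+ f)

reduce : ∀ m {n a b c d e f} → Superbase n a b c d e f → total a b c d e f ℤ.≤ + m → Reduced n

descend : ∀ m {n a b c d e f} → Superbase n a b c d e f → d ℤ.< 0ℤ → total a b c d e f ℤ.≤ + m → Reduced n
descend m {n} {a} {b} {c} {d} {e} {f} s d<0 t≤m = continue m t≤m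
  where
  lem : ∀ a b c d e f → (d + e + (b + d) + (c - d)) + (- d + (a + d) + (f + d)) ≡ (a + b + c) + (d + e + f) + d
  lem = solve-∀
  smaller : ∀ m → total a b c d e f ℤ.≤ + m → total (d + e) (b + d) (c - d) (- d) (a + d) (f + d) ℤ.≤ + m - 1ℤ
  smaller m t≤m = subst (ℤ._≤ + m - 1ℤ) (sym (lem a b c d e f)) (ℤ.+-mono-≤ t≤m (ℤ.i<j⇒i≤pred[j] d<0))
  continue : ∀ m → total a b c d e f ℤ.≤ + m → Reduced n
  continue zero    t≤m = contradiction (ℤ.≤-trans (total-nonNegative (sell s)) (smaller 0 t≤m)) λ ()
  continue (suc m) t≤m = reduce m (sell s) (smaller (suc m) t≤m)
reduce m {n} {ℤ.-[1+ a ]} {b} {c} {d} {e} {f} s t≤m = descend m (swap₀₁ (swap₁₂ s)) ℤ.-<+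
  (subst (ℤ._≤ + m) (permute ℤ.-[1+ a ] b c d e f) t≤m)
  where
  permute : ∀ a b c d e f → (a + b + c) + (d + e + f) ≡ (b + d + f) + (a + c + e)
  permute = solve-∀
reduce m {n} {+ a} {ℤ.-[1+ b ]} {c} {d} {e} {f} s t≤m = descend m (swap₀₁ s) ℤ.-<+
  (subst (ℤ._≤ + m) (permute (+ a) ℤ.-[1+ b ] c d e f) t≤m)
  where
  permute : ∀ a b c d e f → (a + b + c) + (d + e + f) ≡ (a + d + e) + (b + c + f)
  permute = solve-∀
reduce m {n} {+ a} {+ b} {ℤ.-[1+ c ]} {d} {e} {f} s t≤m = descend m (swap₀₁ (swap₂₃ s)) ℤ.-<+
  (subst (ℤ._≤ + m) (permute (+ a) (+ b) ℤ.-[1+ c ] d e f) t≤m)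
  where
  permute : ∀ a b c d e f → (a + b + c) + (d + e + f) ≡ (a + e + d) + (c + b + f)
  permute = solve-∀
reduce m {n} {+ a} {+ b} {+ c} {ℤ.-[1+ d ]} {e} {f} s t≤m = descend m s ℤ.-<+ t≤m
reduce m {n} {+ a} {+ b} {+ c} {+ d} {ℤ.-[1+ e ]} {f} s t≤m = descend m (swap₂₃ s) ℤ.-<+
  (subst (ℤ._≤ + m) (permute (+ a) (+ b) (+ c) (+ d) ℤ.-[1+ e ] f) t≤m)
  where
  permute : ∀ a b c d e f → (a + b + c) + (d + e + f) ≡ (a + c + b) + (e + d + f)
  permute = solve-∀
reduce m {n} {+ a} {+ b} {+ c} {+ d} {+ e} {ℤ.-[1+ f ]} s t≤m = descend m (swap₂₃ (swap₁₂ s)) ℤ.-<+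
  (subst (ℤ._≤ + m) (permute (+ a) (+ b) (+ c) (+ d) (+ e) ℤ.-[1+ f ]) t≤m)
  where
  permute : ∀ a b c d e f → (a + b + c) + (d + e + f) ≡ (b + c + a) + (f + d + e)
  permute = solve-∀
reduce m {n} {+ a} {+ b} {+ c} {+ d} {+ e} {+ f} s t≤m = a , b , c , d , e , f , s

open TreeSum ℕ._+_ ℕ._*_ using () renaming (trees to ℕtrees)

pos-trees : ∀ a b c d e f → trees (+ a) (+ b) (+ c) (+ d) (+ e) (+ f) ≡ + ℕtrees a b c d e f
pos-trees a b c d e f = cong₂ _+_
  (cong₂ _+_
    (cong₂ _+_ (cong₂ _+_ (cong₂ _+_ (mono a b (c ℕ.+ (e ℕ.+ f))) (mono a c (d ℕ.+ f))) (mono a d (e ℕ.+ f)))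
      (mono a e f))
    (cong₂ _+_ (cong₂ _+_ (mono b c (d ℕ.+ e)) (mono b d (e ℕ.+ f))) (cong₂ _+_ (mono b e f) (mono c d (e ℕ.+ f)))))
  (mono c e f)
  where
  mono : ∀ x y z → + x * + y * + z ≡ + (x ℕ.* y ℕ.* z)
  mono x y z = trans (cong (_* + z) (sym (ℤ.pos-* x y))) (sym (ℤ.pos-* (x ℕ.* y) z))

-- Deletion and contraction of the edge d. The trees that avoid d are grouped so that each group has
-- a factor that is part of the coefficient of d; if this coefficient is zero, so is everything.
edge-split : ∀ a b c d e f → ℕtrees a b c d e f ≡
  d ℕ.* ((a ℕ.* e ℕ.+ a ℕ.* f ℕ.+ a ℕ.* c ℕ.+ c ℕ.* e) ℕ.+ (c ℕ.* f ℕ.+ b ℕ.* e ℕ.+ b ℕ.* f ℕ.+ b ℕ.* c)) ℕ.+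
  (b ℕ.* (a ℕ.* e ℕ.+ a ℕ.* f ℕ.+ a ℕ.* c) ℕ.+ f ℕ.* (a ℕ.* e ℕ.+ a ℕ.* c ℕ.+ c ℕ.* e) ℕ.+ e ℕ.*
    (b ℕ.* f ℕ.+ b ℕ.* c))
edge-split = solve 6 (λ a b c d e f → ℕP.trees a b c d e f :=
  d :* ((a :* e :+ a :* f :+ a :* c :+ c :* e) :+ (c :* f :+ b :* e :+ b :* f :+ b :* c)) :+
  (b :* (a :* e :+ a :* f :+ a :* c) :+ f :* (a :* e :+ a :* c :+ c :* e) :+ e :* (b :* f :+ b :* c))) refl
  where open ℕP using (solve; _:=_; _:+_; _:*_)

-- An edge of a connected weighted graph lies on a spanning tree.
edge-bound : ∀ a b c d e f → ℕtrees a b c d e f ≡ 6 → d ℕ.≤ 6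
edge-bound a b c d e f eq with (a ℕ.* e ℕ.+ a ℕ.* f ℕ.+ a ℕ.* c ℕ.+ c ℕ.* e) ℕ.+
  (c ℕ.* f ℕ.+ b ℕ.* e ℕ.+ b ℕ.* f ℕ.+ b ℕ.* c) in τ≡
... | suc τ = ℕ.≤-trans (ℕ.m≤m*n d (suc τ))
  (ℕ.≤-trans (ℕ.m≤m+n _ _) (ℕ.≤-reflexive
  (trans (cong (λ t → d ℕ.* t ℕ.+ rest) (sym τ≡)) (trans (sym (edge-split a b c d e f)) eq))))
  where
  rest : ℕ
  rest = b ℕ.* (a ℕ.* e ℕ.+ a ℕ.* f ℕ.+ a ℕ.* c) ℕ.+ f ℕ.* (a ℕ.* e ℕ.+ a ℕ.* c ℕ.+ c ℕ.* e) ℕ.+ e ℕ.*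
    (b ℕ.* f ℕ.+ b ℕ.* c)
... | zero = contradiction (trans (sym eq) disconnected) λ ()
  where
  open ℕP using (solve; _:=_; _:+_; _:*_)
  ae+af ce ac ae be+bf bc : ℕ
  ae+af = a ℕ.* e ℕ.+ a ℕ.* f
  ce = c ℕ.* e
  ac = a ℕ.* c
  ae = a ℕ.* e
  be+bf = c ℕ.* f ℕ.+ b ℕ.* e ℕ.+ b ℕ.* f
  bc = b ℕ.* c
  left : a ℕ.* e ℕ.+ a ℕ.* f ℕ.+ a ℕ.* c ℕ.+ c ℕ.* e ≡ 0
  left = ℕ.m+n≡0⇒m≡0 (ae+af ℕ.+ ac ℕ.+ ce) τ≡
  ae+af+ac : a ℕ.* e ℕ.+ a ℕ.* f ℕ.+ a ℕ.* c ≡ 0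
  ae+af+ac = ℕ.m+n≡0⇒m≡0 (ae+af ℕ.+ ac) left
  right : be+bf ℕ.+ bc ≡ 0
  right = ℕ.m+n≡0⇒n≡0 (ae+af ℕ.+ ac ℕ.+ ce) τ≡
  sum-zero : ∀ {x y z} → x ≡ 0 → y ≡ 0 → z ≡ 0 → x ℕ.+ y ℕ.+ z ≡ 0
  sum-zero refl refl refl = refl
  ae+ac+ce : ae ℕ.+ ac ℕ.+ ce ≡ 0
  ae+ac+ce = sum-zero (ℕ.m+n≡0⇒m≡0 ae (ℕ.m+n≡0⇒m≡0 ae+af ae+af+ac)) (ℕ.m+n≡0⇒n≡0 ae+af ae+af+ac)
    (ℕ.m+n≡0⇒n≡0 (ae+af ℕ.+ ac) left)
  bf+bc : b ℕ.* f ℕ.+ bc ≡ 0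
  bf+bc = trans (cong (ℕ._+ bc) (ℕ.m+n≡0⇒n≡0 (c ℕ.* f ℕ.+ b ℕ.* e) (ℕ.m+n≡0⇒m≡0 be+bf right)))
    (ℕ.m+n≡0⇒n≡0 be+bf right)
  disconnected : ℕtrees a b c d e f ≡ 0
  disconnected = trans (edge-split a b c d e f) (trans (cong₂ ℕ._+_ (trans (cong (d ℕ.*_) τ≡) (ℕ.*-zeroʳ d))
    (sum-zero (trans (cong (b ℕ.*_) ae+af+ac) (ℕ.*-zeroʳ b)) (trans (cong (f ℕ.*_) ae+ac+ce) (ℕ.*-zeroʳ f))
      (trans (cong (e ℕ.*_) bf+bc) (ℕ.*-zeroʳ e)))) refl)

weights-bounded : ∀ a b c d e f → ℕtrees a b c d e f ≡ 6 →
  (a ℕ.≤ 6 × b ℕ.≤ 6 × c ℕ.≤ 6) × (d ℕ.≤ 6 × e ℕ.≤ 6 × f ℕ.≤ 6)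
weights-bounded a b c d e f eq =
  (edge-bound b d f a c e (trans (relabel-a a b c d e f) eq) ,
   edge-bound a d e b c f (trans (relabel-b a b c d e f) eq) ,
   edge-bound a e d c b f (trans (relabel-c a b c d e f) eq)) ,
  (edge-bound a b c d e f eq ,
   edge-bound a c b e d f (trans (relabel-e a b c d e f) eq) ,
   edge-bound b c a f d e (trans (relabel-f a b c d e f) eq))
  where
  open ℕP using (solve; _:=_)
  relabel-a : ∀ a b c d e f → ℕtrees b d f a c e ≡ ℕtrees a b c d e f
  relabel-a = solve 6 (λ a b c d e f → ℕP.trees b d f a c e := ℕP.trees a b c d e f) refl
  relabel-b : ∀ a b c d e f → ℕtrees a d e b c f ≡ ℕtrees a b c d e f
  relabel-b = solve 6 (λ a b c d e f → ℕP.trees a d e b c f := ℕP.trees a b c d e f) refl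
  relabel-c : ∀ a b c d e f → ℕtrees a e d c b f ≡ ℕtrees a b c d e f
  relabel-c = solve 6 (λ a b c d e f → ℕP.trees a e d c b f := ℕP.trees a b c d e f) refl
  relabel-e : ∀ a b c d e f → ℕtrees a c b e d f ≡ ℕtrees a b c d e f
  relabel-e = solve 6 (λ a b c d e f → ℕP.trees a c b e d f := ℕP.trees a b c d e f) refl
  relabel-f : ∀ a b c d e f → ℕtrees b c a f d e ≡ ℕtrees a b c d e f
  relabel-f = solve 6 (λ a b c d e f → ℕP.trees b c a f d e := ℕP.trees a b c d e f) refl

Weights : Set
Weights = ℕ × ℕ × ℕ × ℕ × ℕ × ℕ

-- The Selling parameters of x² + u² + uv + v²: a triangle of weights 1 with a pendant edge of weight 2.
pendantTriangles : List Weights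
pendantTriangles =
  (1 , 1 , 2 , 1 , 0 , 0) ∷
  (1 , 1 , 0 , 1 , 2 , 0) ∷
  (1 , 1 , 0 , 1 , 0 , 2) ∷
  (1 , 2 , 1 , 0 , 1 , 0) ∷
  (1 , 0 , 1 , 2 , 1 , 0) ∷
  (1 , 0 , 1 , 0 , 1 , 2) ∷
  (2 , 1 , 1 , 0 , 0 , 1) ∷
  (0 , 1 , 1 , 2 , 0 , 1) ∷
  (0 , 1 , 1 , 0 , 2 , 1) ∷
  (2 , 0 , 0 , 1 , 1 , 1) ∷
  (0 , 2 , 0 , 1 , 1 , 1) ∷
  (0 , 0 , 2 , 1 , 1 , 1) ∷
  []

_≟ʷ_ : DecidableEquality Weights
_≟ʷ_ = Product.≡-dec ℕ._≟_
  (Product.≡-dec ℕ._≟_ (Product.≡-dec ℕ._≟_ (Product.≡-dec ℕ._≟_ (Product.≡-dec ℕ._≟_ ℕ._≟_))))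

open DecMembership _≟ʷ_ using (_∈?_)

allBelow : ℕ → (ℕ → Bool) → Bool
allBelow zero    p = true
allBelow (suc n) p = p n ∧ allBelow n p

allBelow-sound : ∀ n p → T (allBelow n p) → ∀ {i} → i ℕ.< n → T (p i)
allBelow-sound (suc n) p t i<1+n with p n in eq | ℕ.m<1+n⇒m<n∨m≡n i<1+n
... | true | inj₁ i<n  = allBelow-sound n p t i<n
... | true | inj₂ refl = subst T (sym eq) _

infixr 4 _⇒ᵇ_
_⇒ᵇ_ : Bool → Bool → Bool
x ⇒ᵇ y = if x then y else true

mp : ∀ x y → T (x ⇒ᵇ y) → T x → T y
mp true y t _ = t

evenᵇ : ℕ → Bool
evenᵇ n = n % 2 ℕ.≡ᵇ 0

isPendantTriangle : (a b c d e f : ℕ) → Bool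
isPendantTriangle a b c d e f = ⌊ (a , b , c , d , e , f) ∈? pendantTriangles ⌋

-- The weights are enumerated in an order that lets the parity conditions prune the search early.
fits₆ : (a d e b f c : ℕ) → Bool
fits₆ a d e b f c = evenᵇ (c ℕ.+ e ℕ.+ f) ⇒ᵇ (ℕtrees a b c d e f ℕ.≡ᵇ 6) ⇒ᵇ isPendantTriangle a b c d e f

fits₅ : (a d e b f : ℕ) → Bool
fits₅ a d e b f = evenᵇ (b ℕ.+ d ℕ.+ f) ⇒ᵇ allBelow 7 (fits₆ a d e b f)

fits₄ : (a d e b : ℕ) → Bool
fits₄ a d e b = allBelow 7 (fits₅ a d e b)

fits₃ : (a d e : ℕ) → Bool
fits₃ a d e = evenᵇ (a ℕ.+ d ℕ.+ e) ⇒ᵇ allBelow 7 (fits₄ a d e)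

fits₂ : (a d : ℕ) → Bool
fits₂ a d = allBelow 7 (fits₃ a d)

fits₁ : ℕ → Bool
fits₁ a = allBelow 7 (fits₂ a)

-- Settled by evaluation; the range 0, ..., 6 of each weight comes from `weights-bounded`.
all-fit : T (allBelow 7 fits₁)
all-fit = _

classified : ∀ a b c d e f → ℕtrees a b c d e f ≡ 6 →
  T (evenᵇ (a ℕ.+ d ℕ.+ e)) → T (evenᵇ (b ℕ.+ d ℕ.+ f)) → T (evenᵇ (c ℕ.+ e ℕ.+ f)) → T
    (isPendantTriangle a b c d e f)
classified a b c d e f eq p q r =
  let (a≤6 , b≤6 , c≤6) , (d≤6 , e≤6 , f≤6) = weights-bounded a b c d e f eq
      at-a = allBelow-sound 7 fits₁ all-fit (s≤s a≤6)
      at-d = allBelow-sound 7 (fits₂ a) at-a (s≤s d≤6)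
      at-e = allBelow-sound 7 (fits₃ a d) at-d (s≤s e≤6)
      at-b = allBelow-sound 7 (fits₄ a d e) (mp (evenᵇ (a ℕ.+ d ℕ.+ e)) (allBelow 7 (fits₄ a d e)) at-e p) (s≤s b≤6)
      at-f = allBelow-sound 7 (fits₅ a d e b) at-b (s≤s f≤6)
      at-c = allBelow-sound 7 (fits₆ a d e b f)
        (mp (evenᵇ (b ℕ.+ d ℕ.+ f)) (allBelow 7 (fits₆ a d e b f)) at-f q) (s≤s c≤6)
  in mp (ℕtrees a b c d e f ℕ.≡ᵇ 6) (isPendantTriangle a b c d e f)
       (mp (evenᵇ (c ℕ.+ e ℕ.+ f)) ((ℕtrees a b c d e f ℕ.≡ᵇ 6) ⇒ᵇ isPendantTriangle a b c d e f) at-c r)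
       (ℕ.≡⇒≡ᵇ (ℕtrees a b c d e f) 6 eq)

even⇒T : ∀ n → Even (+ n) → T (evenᵇ n)
even⇒T n (k , eq) = ℕ.≡⇒≡ᵇ _ 0 (ℕ∣.n∣m⇒m%n≡0 n 2 (∣⇒∣ᵤ (divides k (trans eq (lem k)))))
  where
  lem : ∀ k → k + k ≡ k * + 2
  lem = solve-∀

Represented : ℤ → Set
Represented n = ∃[ x ] ∃[ u ] ∃[ v ] n ≡ x * x + (u * u + u * v + v * v)

-- In each of the twelve cases x is the difference along the pendant edge and u, v are the
-- differences along two sides of the triangle. The third side is u + v, and u² + v² + (u + v)² = 2
-- (u² + u v + v²).
reduced⇒represented : ∀ {n} → Reduced n → Represented n
reduced⇒represented {n} (a , b , c , d , e , f , s) = by-weights represents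
  (toWitness (classified a b c d e f (ℤ.+-injective (trans (sym (pos-trees a b c d e f)) determinant))
    (even⇒T _ even₁) (even⇒T _ even₂) (even⇒T _ even₃)))
  where
  open Superbase s
  open ℤP using (solve; _:=_; _:+_; _:*_; _:-_; con)
  halve : ∀ m x u v → m ≡ (x * x + (u * u + u * v + v * v)) + (x * x + (u * u + u * v + v * v)) → n + n ≡ m →
    Represented n
  halve m x u v eq eq′ = x , u , v , ℤ.*-cancelˡ-≡ (+ 2) _ _
    (trans (twice n) (trans eq′ (trans eq (sym (twice _)))))
    where
    twice : ∀ z → + 2 * z ≡ z + z
    twice = solve-∀
  by-weights : (∃[ x₀ ] ∃[ x₁ ] ∃[ x₂ ] ∃[ x₃ ] n + n ≡ selling (+ a) (+ b) (+ c) (+ d) (+ e) (+ f) x₀ x₁ x₂ x₃) →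
    (a , b , c , d , e , f) ∈ pendantTriangles → Represented n
  by-weights (x₀ , x₁ , x₂ , x₃ , eq) (here refl) = halve _ (x₃ - x₀) (x₀ - x₁) (x₁ - x₂) (solve 4 (λ x₀ x₁ x₂ x₃ →
    let x = x₃ :- x₀ ; u = x₀ :- x₁ ; v = x₁ :- x₂ ; r = x :* x :+ (u :* u :+ u :* v :+ v :* v) in
    ℤP.selling (con (+ 1)) (con (+ 1)) (con (+ 2)) (con (+ 1)) (con (+ 0)) (con (+ 0)) x₀ x₁ x₂ x₃ := r :+ r)
      refl x₀ x₁ x₂ x₃) eq
  by-weights (x₀ , x₁ , x₂ , x₃ , eq) (there (here refl)) = halve _ (x₃ - x₁) (x₁ - x₀) (x₀ - x₂)
    (solve 4 (λ x₀ x₁ x₂ x₃ →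
    let x = x₃ :- x₁ ; u = x₁ :- x₀ ; v = x₀ :- x₂ ; r = x :* x :+ (u :* u :+ u :* v :+ v :* v) in
    ℤP.selling (con (+ 1)) (con (+ 1)) (con (+ 0)) (con (+ 1)) (con (+ 2)) (con (+ 0)) x₀ x₁ x₂ x₃ := r :+ r)
      refl x₀ x₁ x₂ x₃) eq
  by-weights (x₀ , x₁ , x₂ , x₃ , eq) (there (there (here refl))) = halve _ (x₃ - x₂) (x₂ - x₀) (x₀ - x₁)
    (solve 4 (λ x₀ x₁ x₂ x₃ →
    let x = x₃ :- x₂ ; u = x₂ :- x₀ ; v = x₀ :- x₁ ; r = x :* x :+ (u :* u :+ u :* v :+ v :* v) in
    ℤP.selling (con (+ 1)) (con (+ 1)) (con (+ 0)) (con (+ 1)) (con (+ 0)) (con (+ 2)) x₀ x₁ x₂ x₃ := r :+ r)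
      refl x₀ x₁ x₂ x₃) eq
  by-weights (x₀ , x₁ , x₂ , x₃ , eq) (there (there (there (here refl)))) = halve _ (x₂ - x₀) (x₀ - x₁)
    (x₁ - x₃) (solve 4 (λ x₀ x₁ x₂ x₃ →
    let x = x₂ :- x₀ ; u = x₀ :- x₁ ; v = x₁ :- x₃ ; r = x :* x :+ (u :* u :+ u :* v :+ v :* v) in
    ℤP.selling (con (+ 1)) (con (+ 2)) (con (+ 1)) (con (+ 0)) (con (+ 1)) (con (+ 0)) x₀ x₁ x₂ x₃ := r :+ r)
      refl x₀ x₁ x₂ x₃) eq
  by-weights (x₀ , x₁ , x₂ , x₃ , eq) (there (there (there (there (here refl))))) = halve _ (x₂ - x₁) (x₁ - x₀)
    (x₀ - x₃) (solve 4 (λ x₀ x₁ x₂ x₃ →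
    let x = x₂ :- x₁ ; u = x₁ :- x₀ ; v = x₀ :- x₃ ; r = x :* x :+ (u :* u :+ u :* v :+ v :* v) in
    ℤP.selling (con (+ 1)) (con (+ 0)) (con (+ 1)) (con (+ 2)) (con (+ 1)) (con (+ 0)) x₀ x₁ x₂ x₃ := r :+ r)
      refl x₀ x₁ x₂ x₃) eq
  by-weights (x₀ , x₁ , x₂ , x₃ , eq) (there (there (there (there (there (here refl)))))) = halve _ (x₂ - x₃)
    (x₃ - x₀) (x₀ - x₁) (solve 4 (λ x₀ x₁ x₂ x₃ →
    let x = x₂ :- x₃ ; u = x₃ :- x₀ ; v = x₀ :- x₁ ; r = x :* x :+ (u :* u :+ u :* v :+ v :* v) in
    ℤP.selling (con (+ 1)) (con (+ 0)) (con (+ 1)) (con (+ 0)) (con (+ 1)) (con (+ 2)) x₀ x₁ x₂ x₃ := r :+ r)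
      refl x₀ x₁ x₂ x₃) eq
  by-weights (x₀ , x₁ , x₂ , x₃ , eq) (there (there (there (there (there (there (here refl))))))) = halve _
    (x₁ - x₀) (x₀ - x₂) (x₂ - x₃) (solve 4 (λ x₀ x₁ x₂ x₃ →
    let x = x₁ :- x₀ ; u = x₀ :- x₂ ; v = x₂ :- x₃ ; r = x :* x :+ (u :* u :+ u :* v :+ v :* v) in
    ℤP.selling (con (+ 2)) (con (+ 1)) (con (+ 1)) (con (+ 0)) (con (+ 0)) (con (+ 1)) x₀ x₁ x₂ x₃ := r :+ r)
      refl x₀ x₁ x₂ x₃) eq
  by-weights (x₀ , x₁ , x₂ , x₃ , eq) (there (there (there (there (there (there (there (here refl)))))))) =
    halve _ (x₁ - x₂) (x₂ - x₀) (x₀ - x₃) (solve 4 (λ x₀ x₁ x₂ x₃ →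
    let x = x₁ :- x₂ ; u = x₂ :- x₀ ; v = x₀ :- x₃ ; r = x :* x :+ (u :* u :+ u :* v :+ v :* v) in
    ℤP.selling (con (+ 0)) (con (+ 1)) (con (+ 1)) (con (+ 2)) (con (+ 0)) (con (+ 1)) x₀ x₁ x₂ x₃ := r :+ r)
      refl x₀ x₁ x₂ x₃) eq
  by-weights (x₀ , x₁ , x₂ , x₃ , eq)
    (there (there (there (there (there (there (there (there (here refl))))))))) = halve _ (x₁ - x₃) (x₃ - x₀)
    (x₀ - x₂) (solve 4 (λ x₀ x₁ x₂ x₃ →
    let x = x₁ :- x₃ ; u = x₃ :- x₀ ; v = x₀ :- x₂ ; r = x :* x :+ (u :* u :+ u :* v :+ v :* v) in
    ℤP.selling (con (+ 0)) (con (+ 1)) (con (+ 1)) (con (+ 0)) (con (+ 2)) (con (+ 1)) x₀ x₁ x₂ x₃ := r :+ r)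
      refl x₀ x₁ x₂ x₃) eq
  by-weights (x₀ , x₁ , x₂ , x₃ , eq)
    (there (there (there (there (there (there (there (there (there (here refl)))))))))) = halve _ (x₀ - x₁)
    (x₁ - x₂) (x₂ - x₃) (solve 4 (λ x₀ x₁ x₂ x₃ →
    let x = x₀ :- x₁ ; u = x₁ :- x₂ ; v = x₂ :- x₃ ; r = x :* x :+ (u :* u :+ u :* v :+ v :* v) in
    ℤP.selling (con (+ 2)) (con (+ 0)) (con (+ 0)) (con (+ 1)) (con (+ 1)) (con (+ 1)) x₀ x₁ x₂ x₃ := r :+ r)
      refl x₀ x₁ x₂ x₃) eq
  by-weights (x₀ , x₁ , x₂ , x₃ , eq)
    (there (there (there (there (there (there (there (there (there (there (here refl))))))))))) = halve _
    (x₀ - x₂) (x₂ - x₁) (x₁ - x₃) (solve 4 (λ x₀ x₁ x₂ x₃ →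
    let x = x₀ :- x₂ ; u = x₂ :- x₁ ; v = x₁ :- x₃ ; r = x :* x :+ (u :* u :+ u :* v :+ v :* v) in
    ℤP.selling (con (+ 0)) (con (+ 2)) (con (+ 0)) (con (+ 1)) (con (+ 1)) (con (+ 1)) x₀ x₁ x₂ x₃ := r :+ r)
      refl x₀ x₁ x₂ x₃) eq
  by-weights (x₀ , x₁ , x₂ , x₃ , eq)
    (there (there (there (there (there (there (there (there (there (there (there (here refl)))))))))))) = halve
    _ (x₀ - x₃) (x₃ - x₁) (x₁ - x₂) (solve 4 (λ x₀ x₁ x₂ x₃ →
    let x = x₀ :- x₃ ; u = x₃ :- x₁ ; v = x₁ :- x₂ ; r = x :* x :+ (u :* u :+ u :* v :+ v :* v) in
    ℤP.selling (con (+ 0)) (con (+ 0)) (con (+ 2)) (con (+ 1)) (con (+ 1)) (con (+ 1)) x₀ x₁ x₂ x₃ := r :+ r)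
      refl x₀ x₁ x₂ x₃) eq

-- Lattices that represent N

square-nonNegative : ∀ x → 0ℤ ℤ.≤ x * x
square-nonNegative (+ n)        = subst (0ℤ ℤ.≤_) (ℤ.pos-* n n) (ℤ.+≤+ z≤n)
square-nonNegative (ℤ.-[1+ n ]) = ℤ.+≤+ z≤n

-- The form A X² + B XY + C Y² + r XZ + s YZ + N Z² represents N; completing squares in
-- 4N P f = P (2N Z + r X + s Y)² + (P X + H Y)² + 12 N Y² shows that it is positive.
module Lattice (N₀ P₀ : ℕ) .{{_ : ℕ.NonZero N₀}} .{{_ : ℕ.NonZero P₀}} (A B C r s H R : ℤ)
  (eqA : + 4 * + N₀ * A ≡ + P₀ + r * r) (eqB : + 2 * + N₀ * B ≡ H + r * s) (eqC : + 4 * + N₀ * C ≡ R + s * s)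
  (eqR : + P₀ * R ≡ H * H + + 12 * + N₀) where

  N P : ℤ
  N = + N₀
  P = + P₀

  value : (X Y Z : ℤ) → ℤ
  value X Y Z = A * (X * X) + B * (X * Y) + C * (Y * Y) + r * (X * Z) + s * (Y * Z) + N * (Z * Z)

  completed : ∀ X Y Z → + 4 * N * P * value X Y Z ≡
    P * ((+ 2 * N * Z + r * X + s * Y) * (+ 2 * N * Z + r * X + s * Y))
      + ((P * X + H * Y) * (P * X + H * Y) + + 12 * N * (Y * Y))
  completed X Y Z = begin
    + 4 * N * P * value X Y Z
      ≡⟨ regroup A B C r s N P X Y Z ⟩
    P * ((+ 4 * N * A) * (X * X) + + 2 * (+ 2 * N * B) * (X * Y) + (+ 4 * N * C) * (Y * Y) + + 4 * N *
      (r * (X * Z) + s * (Y * Z) + N * (Z * Z)))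
      ≡⟨ cong₃ (λ a b c → P * (a * (X * X) + + 2 * b * (X * Y) + c * (Y * Y) + + 4 * N *
        (r * (X * Z) + s * (Y * Z) + N * (Z * Z)))) eqA eqB eqC ⟩
    P * ((P + r * r) * (X * X) + + 2 * (H + r * s) * (X * Y) + (R + s * s) * (Y * Y) + + 4 * N *
      (r * (X * Z) + s * (Y * Z) + N * (Z * Z)))
      ≡⟨ complete r s H R N P X Y Z ⟩
    P * ((+ 2 * N * Z + r * X + s * Y) * (+ 2 * N * Z + r * X + s * Y))
      + ((P * X) * (P * X) + + 2 * (P * X) * (H * Y) + P * R * (Y * Y))
      ≡⟨ cong (λ t → P * ((+ 2 * N * Z + r * X + s * Y) * (+ 2 * N * Z + r * X + s * Y))
        + ((P * X) * (P * X) + + 2 * (P * X) * (H * Y) + t * (Y * Y))) eqR ⟩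
    P * ((+ 2 * N * Z + r * X + s * Y) * (+ 2 * N * Z + r * X + s * Y))
      + ((P * X) * (P * X) + + 2 * (P * X) * (H * Y) + (H * H + + 12 * N) * (Y * Y))
      ≡⟨ cong (λ t → P * ((+ 2 * N * Z + r * X + s * Y) * (+ 2 * N * Z + r * X + s * Y)) + t)
        (square (P * X) H N Y) ⟩
    P * ((+ 2 * N * Z + r * X + s * Y) * (+ 2 * N * Z + r * X + s * Y))
      + ((P * X + H * Y) * (P * X + H * Y) + + 12 * N * (Y * Y)) ∎
    where
    open ≡-Reasoning
    cong₃ : ∀ (f : ℤ → ℤ → ℤ → ℤ) {a a′ b b′ c c′} → a ≡ a′ → b ≡ b′ → c ≡ c′ → f a b c ≡ f a′ b′ c′
    cong₃ f refl refl refl = refl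
    regroup : ∀ A B C r s N P X Y Z →
      + 4 * N * P * (A * (X * X) + B * (X * Y) + C * (Y * Y) + r * (X * Z) + s * (Y * Z) + N * (Z * Z)) ≡
      P * ((+ 4 * N * A) * (X * X) + + 2 * (+ 2 * N * B) * (X * Y) + (+ 4 * N * C) * (Y * Y) + + 4 * N *
        (r * (X * Z) + s * (Y * Z) + N * (Z * Z)))
    regroup = solve-∀
    complete : ∀ r s H R N P X Y Z →
      P * ((P + r * r) * (X * X) + + 2 * (H + r * s) * (X * Y) + (R + s * s) * (Y * Y) + + 4 * N *
        (r * (X * Z) + s * (Y * Z) + N * (Z * Z))) ≡
      P * ((+ 2 * N * Z + r * X + s * Y) * (+ 2 * N * Z + r * X + s * Y))
        + ((P * X) * (P * X) + + 2 * (P * X) * (H * Y) + P * R * (Y * Y))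
    complete = solve-∀
    square : ∀ z H N Y → z * z + + 2 * z * (H * Y) + (H * H + + 12 * N) * (Y * Y) ≡ (z + H * Y) * (z + H * Y)
      + + 12 * N * (Y * Y)
    square = solve-∀

  4NP-positive : ℤ.Positive (+ 4 * N * P)
  4NP-positive = ℤ.positive (subst (0ℤ ℤ.<_) (trans (ℤ.pos-* (4 ℕ.* N₀) P₀) (cong (_* P) (ℤ.pos-* 4 N₀)))
    (ℤ.+<+ (ℕ.>-nonZero⁻¹ (4 ℕ.* N₀ ℕ.* P₀) {{ℕ.m*n≢0 (4 ℕ.* N₀) P₀ {{ℕ.m*n≢0 4 N₀}}}})))

  value-nonNegative : ∀ X Y Z → 0ℤ ℤ.≤ value X Y Z
  value-nonNegative X Y Z = ℤ.*-cancelˡ-≤-pos 0ℤ (value X Y Z) (+ 4 * N * P) {{4NP-positive}}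
    (subst₂ ℤ._≤_ (sym (ℤ.*-zeroʳ (+ 4 * N * P))) (sym (completed X Y Z))
      (ℤ.+-mono-≤ (scale P₀ (square-nonNegative (+ 2 * N * Z + r * X + s * Y)))
        (ℤ.+-mono-≤ (square-nonNegative (P * X + H * Y))
          (subst (λ t → 0ℤ ℤ.≤ t * (Y * Y)) (ℤ.pos-* 12 N₀) (scale (12 ℕ.* N₀) (square-nonNegative Y))))))
    where
    scale : ∀ n {x} → 0ℤ ℤ.≤ x → 0ℤ ℤ.≤ + n * x
    scale n {x} 0≤x = subst (ℤ._≤ + n * x) (ℤ.*-zeroʳ (+ n)) (ℤ.*-monoˡ-≤-nonNeg (+ n) 0≤x)

  -- Multiplied by 4N, the left side is P R - H², the determinant of the binary form left after the
  -- square in Z is split off; by `eqR` it equals 12N.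
  half-determinant : + 4 * A * C * N + B * r * s - A * (s * s) - C * (r * r) - N * (B * B) ≡ + 3
  half-determinant = ℤ.*-cancelˡ-≡ (+ 4 * N) _ _ {{subst (λ t → ℤ.NonZero t) (ℤ.pos-* 4 N₀) (ℕ.m*n≢0 4 N₀)}} (begin
    + 4 * N * (+ 4 * A * C * N + B * r * s - A * (s * s) - C * (r * r) - N * (B * B))
      ≡⟨ expand A B C r s N ⟩
    (+ 4 * N * A - r * r) * (+ 4 * N * C - s * s) - (+ 2 * N * B - r * s) * (+ 2 * N * B - r * s)
      ≡⟨ cong₂ _-_ (cong₂ (λ x y → (x - r * r) * (y - s * s)) eqA eqC)
        (cong (λ x → (x - r * s) * (x - r * s)) eqB) ⟩
    (P + r * r - r * r) * (R + s * s - s * s) - (H + r * s - r * s) * (H + r * s - r * s)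
      ≡⟨ cancel P R H (r * r) (s * s) (r * s) ⟩
    P * R - H * H
      ≡⟨ cong (_- H * H) eqR ⟩
    H * H + + 12 * N - H * H
      ≡⟨ collect H N ⟩
    + 4 * N * + 3 ∎)
    where
    open ≡-Reasoning
    expand : ∀ A B C r s N → + 4 * N * (+ 4 * A * C * N + B * r * s - A * (s * s) - C * (r * r) - N * (B * B)) ≡
      (+ 4 * N * A - r * r) * (+ 4 * N * C - s * s) - (+ 2 * N * B - r * s) * (+ 2 * N * B - r * s)
    expand = solve-∀
    cancel : ∀ P R H x y z → (P + x - x) * (R + y - y) - (H + z - z) * (H + z - z) ≡ P * R - H * H
    cancel = solve-∀
    collect : ∀ H N → H * H + + 12 * N - H * H ≡ + 4 * N * + 3
    collect = solve-∀

  -- The basis vectors of X, Y, Z are v₁, v₂, v₃, and v₀ is minus their sum. Norms are twice the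
  -- values of the form, so v₃ has norm 2N and represents N.
  superbase : Superbase N (+ 2 * A + B + r) (+ 2 * C + B + s) (+ 2 * N + r + s) (- B) (- r) (- s)
  superbase = record
    { nonNegative = λ x₀ x₁ x₂ x₃ → subst (0ℤ ℤ.≤_) (sym (form A B C r s N x₀ x₁ x₂ x₃))
        (ℤ.+-mono-≤ (value-nonNegative (x₁ - x₀) (x₂ - x₀) (x₃ - x₀))
          (value-nonNegative (x₁ - x₀) (x₂ - x₀) (x₃ - x₀)))
    ; determinant = trans (tree A B C r s N) (cong (λ t → t + t) half-determinant)
    ; even₀       = A + B + C + N + r + s , e₀ A B C N r s
    ; even₁       = A , e₁ A B r
    ; even₂       = C , e₁ C B s
    ; even₃       = N , e₃ N r s
    ; represents  = 0ℤ , 0ℤ , 0ℤ , 1ℤ , rep A B C r s N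
    }
    where
    open ℤP using (solve; _:=_; _:+_; _:*_; _:-_; :-_; con)
    form : ∀ A B C r s N x₀ x₁ x₂ x₃ → selling (+ 2 * A + B + r) (+ 2 * C + B + s) (+ 2 * N + r + s) (- B) (- r)
      (- s) x₀ x₁ x₂ x₃ ≡
      (A * ((x₁ - x₀) * (x₁ - x₀)) + B * ((x₁ - x₀) * (x₂ - x₀)) + C * ((x₂ - x₀) * (x₂ - x₀)) + r *
        ((x₁ - x₀) * (x₃ - x₀)) + s * ((x₂ - x₀) * (x₃ - x₀)) + N * ((x₃ - x₀) * (x₃ - x₀))) +
      (A * ((x₁ - x₀) * (x₁ - x₀)) + B * ((x₁ - x₀) * (x₂ - x₀)) + C * ((x₂ - x₀) * (x₂ - x₀)) + r *
        ((x₁ - x₀) * (x₃ - x₀)) + s * ((x₂ - x₀) * (x₃ - x₀)) + N * ((x₃ - x₀) * (x₃ - x₀)))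
    form = solve 10 (λ A B C r s N x₀ x₁ x₂ x₃ →
      let X = x₁ :- x₀ ; Y = x₂ :- x₀ ; Z = x₃ :- x₀
          v = A :* (X :* X) :+ B :* (X :* Y) :+ C :* (Y :* Y) :+ r :* (X :* Z) :+ s :* (Y :* Z) :+ N :* (Z :* Z) in
      ℤP.selling (con (+ 2) :* A :+ B :+ r) (con (+ 2) :* C :+ B :+ s) (con (+ 2) :* N :+ r :+ s) (:- B) (:- r)
        (:- s) x₀ x₁ x₂ x₃ := v :+ v) refl
    tree : ∀ A B C r s N → trees (+ 2 * A + B + r) (+ 2 * C + B + s) (+ 2 * N + r + s) (- B) (- r) (- s) ≡
      (+ 4 * A * C * N + B * r * s - A * (s * s) - C * (r * r) - N * (B * B))
        + (+ 4 * A * C * N + B * r * s - A * (s * s) - C * (r * r) - N * (B * B))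
    tree = solve 6 (λ A B C r s N →
      let δ = con (+ 4) :* A :* C :* N :+ B :* r :* s :- A :* (s :* s) :- C :* (r :* r) :- N :* (B :* B) in
      ℤP.trees (con (+ 2) :* A :+ B :+ r) (con (+ 2) :* C :+ B :+ s) (con (+ 2) :* N :+ r :+ s) (:- B) (:- r)
        (:- s) := δ :+ δ) refl
    e₀ : ∀ A B C N r s → + 2 * A + B + r + (+ 2 * C + B + s) + (+ 2 * N + r + s) ≡ (A + B + C + N + r + s)
      + (A + B + C + N + r + s)
    e₀ = solve-∀
    e₁ : ∀ A B r → + 2 * A + B + r + - B + - r ≡ A + A
    e₁ = solve-∀
    e₃ : ∀ N r s → + 2 * N + r + s + - r + - s ≡ N + N
    e₃ = solve-∀
    rep : ∀ A B C r s N → N + N ≡ selling (+ 2 * A + B + r) (+ 2 * C + B + s) (+ 2 * N + r + s) (- B) (- r)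
      (- s) 0ℤ 0ℤ 0ℤ 1ℤ
    rep = solve 6 (λ A B C r s N → N :+ N := ℤP.selling (con (+ 2) :* A :+ B :+ r) (con (+ 2) :* C :+ B :+ s)
      (con (+ 2) :* N :+ r :+ s) (:- B) (:- r) (:- s) (con 0ℤ) (con 0ℤ) (con 0ℤ) (con 1ℤ)) refl

superbase⇒represented : ∀ {n a b c d e f} → Superbase n a b c d e f → Represented n
superbase⇒represented {n} {a} {b} {c} {d} {e} {f} s = reduced⇒represented
  (reduce ℤ.∣ total a b c d e f ∣ s (≤-abs (total a b c d e f)))
  where
  ≤-abs : ∀ i → i ℤ.≤ + ℤ.∣ i ∣
  ≤-abs (+ n)        = ℤ.≤-refl
  ≤-abs (ℤ.-[1+ n ]) = ℤ.-≤+

-- The hypothesis says P k² c² ≡ -1 (mod 4N). Hence r = c P k gives P + r² = P (1 + P k² c²), and s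
-- = H k c gives H + r s = H (1 + P k² c²), both multiples of 4N. For R + s² the same follows from P
-- R ≡ H², as P is invertible modulo 4N.
represented-by-residues : ∀ N₀ P₀ .{{_ : ℕ.NonZero N₀}} .{{_ : ℕ.NonZero P₀}} (k c x y w : ℤ) → let N = + N₀ ; P = + P₀ in
  1ℤ + P * (k * k) * (c * c) ≡ + 4 * N * w → x * x + + 3 * N ≡ y * P → Represented N
represented-by-residues N₀ P₀ k c x y w w≡ y≡ = superbase⇒represented (Lattice.superbase N₀ P₀
  -- The last coefficient is (R + s²) / 4N without division: in (R + s²) 4N w = (R + s²) (1 + P k²
  -- c²) replace P R by H² + 12N and P s² by H² (4N w - 1).
  (P * w) (+ 4 * x * w) ((R + s * s) * w - k * k * (c * c) * (H * H * w + + 3)) r s H R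
  (trans (assocA N P w) (trans (cong (P *_) (sym w≡)) (expandA P k c)))
  (trans (assocB N x w) (trans (cong (H *_) (sym w≡)) (expandB x P k c)))
  (trans (assocC N R s w k c H)
    (trans (cong (λ t → (R + s * s) * t - k * k * (c * c) * (H * H * t + + 12 * N)) (sym w≡))
    (trans (expandC R s P k c H N)
      (trans (cong (λ t → (R + s * s) + k * k * (c * c) * (P * R - (H * H + + 12 * N)) + t) (zeroC P k c x))
      (trans (cong (λ t → R + s * s + k * k * (c * c) * (t - (H * H + + 12 * N)) + 0ℤ) eqR)
      (finishC (R + s * s) (k * k * (c * c)) (H * H + + 12 * N)))))))
  eqR)
  where
  N P H R r s : ℤ
  N = + N₀
  P = + P₀
  H = + 2 * x
  R = + 4 * y
  r = c * P * k
  s = + 2 * x * k * c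
  eqR : P * R ≡ H * H + + 12 * N
  eqR = trans (lem P y) (trans (cong (+ 4 *_) (sym y≡)) (lem′ x N))
    where
    lem : ∀ P y → P * (+ 4 * y) ≡ + 4 * (y * P)
    lem = solve-∀
    lem′ : ∀ x N → + 4 * (x * x + + 3 * N) ≡ + 2 * x * (+ 2 * x) + + 12 * N
    lem′ = solve-∀
  assocA : ∀ N P w → + 4 * N * (P * w) ≡ P * (+ 4 * N * w)
  assocA = solve-∀
  expandA : ∀ P k c → P * (1ℤ + P * (k * k) * (c * c)) ≡ P + c * P * k * (c * P * k)
  expandA = solve-∀
  assocB : ∀ N x w → + 2 * N * (+ 4 * x * w) ≡ + 2 * x * (+ 4 * N * w)
  assocB = solve-∀
  expandB : ∀ x P k c → + 2 * x * (1ℤ + P * (k * k) * (c * c)) ≡ + 2 * x + c * P * k * (+ 2 * x * k * c)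
  expandB = solve-∀
  assocC : ∀ N R s w k c H → + 4 * N * ((R + s * s) * w - k * k * (c * c) * (H * H * w + + 3)) ≡
    (R + s * s) * (+ 4 * N * w) - k * k * (c * c) * (H * H * (+ 4 * N * w) + + 12 * N)
  assocC = solve-∀
  expandC : ∀ R s P k c H N → (R + s * s) * (1ℤ + P * (k * k) * (c * c)) - k * k * (c * c) *
    (H * H * (1ℤ + P * (k * k) * (c * c)) + + 12 * N) ≡
    (R + s * s) + k * k * (c * c) * (P * R - (H * H + + 12 * N)) + (s * s - H * H * (k * k) * (c * c)) *
      (P * (k * k) * (c * c))
  expandC = solve-∀
  zeroC : ∀ P k c x → (+ 2 * x * k * c * (+ 2 * x * k * c) - + 2 * x * (+ 2 * x) * (k * k) * (c * c)) *
    (P * (k * k) * (c * c)) ≡ 0ℤ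
  zeroC = solve-∀
  finishC : ∀ a b c → a + b * (c - c) + 0ℤ ≡ a
  finishC = solve-∀

-- Here `c′` is an inverse of c modulo 4N. It turns n ≡ ρ ≡ - c² into n c′² ≡ -1, the form that
-- `represented-by-residues` takes.
represented-by-progression : ∀ N₀ .{{_ : ℕ.NonZero N₀}} {M} .{{_ : ℕ.NonZero M}} (character : Character M) → M ≡
  12 ℕ.* N₀ →
  (∀ {q} → Prime q → Character.χ character q ≡ 1ℤ → ∃[ x ] + q ∣ x * x + + (3 ℕ.* N₀)) →
  ∀ ρ (c c′ z : ℤ) → Coprime ρ M → Character.χ character ρ ≡ 1ℤ → + ρ + c * c ≡ + 4 * + N₀ → c * c′ ≡ 1ℤ + + 4 *
    + N₀ * z →
  Represented (+ N₀)
represented-by-progression N₀ {M} character M≡ split ρ c c′ z ρ-coprime χρ≡1 ρ≡ cc′≡ =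
  let n , 0<n , n≡ρ , G≢0 = Progression.progression character ρ ρ-coprime χρ≡1
      P , k , n≡ , root = DivisorSum.splitPart character (+ (3 ℕ.* N₀)) split n 0<n (coprime-resp n≡ρ ρ-coprime) G≢0
  in conclude n 0<n n≡ρ P k n≡ root
  where
  N : ℤ
  N = + N₀
  expand : ∀ N c c′ t → 1ℤ + (+ 4 * N - c * c + t * (+ 12 * N)) * (c′ * c′) ≡ 1ℤ - (c * c′) * (c * c′) + + 4 * N
    * (c′ * c′ * (1ℤ + + 3 * t))
  expand = solve-∀
  collect : ∀ N z c′ t → 1ℤ - (1ℤ + + 4 * N * z) * (1ℤ + + 4 * N * z) + + 4 * N * (c′ * c′ * (1ℤ + + 3 * t)) ≡
    + 4 * N * (c′ * c′ * (1ℤ + + 3 * t) - + 2 * z - + 4 * N * (z * z))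
  collect = solve-∀
  isolate : ∀ n ρ → n ≡ ρ + (n - ρ)
  isolate = solve-∀
  isolate′ : ∀ ρ d → ρ ≡ ρ + d - d
  isolate′ = solve-∀
  conclude : ∀ n → 0 ℕ.< n → + n ≡ + ρ [mod + M ] → ∀ P k → n ≡ P ℕ.* (k ℕ.* k) → ∃[ x ] + P ∣ x * x
    + + (3 ℕ.* N₀) → Represented N
  conclude n 0<n _ zero k n≡ _ = contradiction n≡ (ℕ.>⇒≢ 0<n)
  conclude n 0<n (congruent (divides t t≡)) (suc P) k n≡ (x , divides y y≡) =
    represented-by-residues N₀ (suc P) (+ k) c′ x y (c′ * c′ * (1ℤ + + 3 * t) - + 2 * z - + 4 * N * (z * z)) (begin
      1ℤ + + suc P * (+ k * + k) * (c′ * c′)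
        ≡⟨ cong (λ u → 1ℤ + u * (c′ * c′))
          (trans (cong (+ suc P *_) (sym (ℤ.pos-* k k)))
          (trans (sym (ℤ.pos-* (suc P) (k ℕ.* k))) (cong (λ u → + u) (sym n≡)))) ⟩
      1ℤ + + n * (c′ * c′)
        ≡⟨ cong (λ u → 1ℤ + u * (c′ * c′)) n-expanded ⟩
      1ℤ + (+ 4 * N - c * c + t * (+ 12 * N)) * (c′ * c′)
        ≡⟨ expand N c c′ t ⟩
      1ℤ - (c * c′) * (c * c′) + + 4 * N * (c′ * c′ * (1ℤ + + 3 * t))
        ≡⟨ cong (λ u → 1ℤ - u * u + + 4 * N * (c′ * c′ * (1ℤ + + 3 * t))) cc′≡ ⟩
      1ℤ - (1ℤ + + 4 * N * z) * (1ℤ + + 4 * N * z) + + 4 * N * (c′ * c′ * (1ℤ + + 3 * t))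
        ≡⟨ collect N z c′ t ⟩
      + 4 * N * (c′ * c′ * (1ℤ + + 3 * t) - + 2 * z - + 4 * N * (z * z)) ∎)
    (trans (cong (λ u → x * x + u) (sym (ℤ.pos-* 3 N₀))) y≡)
    where
    open ≡-Reasoning
    n-expanded : + n ≡ + 4 * N - c * c + t * (+ 12 * N)
    n-expanded = trans (isolate (+ n) (+ ρ)) (cong₂ _+_ (trans (isolate′ (+ ρ) (c * c)) (cong (_- c * c) ρ≡))
      (trans t≡ (cong (t *_) (trans (cong (λ u → + u) M≡) (ℤ.pos-* 12 N₀)))))

represented-by-jacobi : ∀ N₀ .{{_ : ℕ.NonZero N₀}} L l → suc (L ℕ.+ L) ≡ 3 ℕ.* N₀ → L ≡ suc (l ℕ.+ l) →
  ∀ ρ (c c′ z : ℤ) → JacobiCharacter.χ L ρ ≡ 1ℤ → + ρ + c * c ≡ + 4 * + N₀ → c * c′ ≡ 1ℤ + + 4 * + N₀ * z →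
  Represented (+ N₀)
represented-by-jacobi N₀ L l modulus≡ L-odd ρ c c′ z χρ≡1 =
  represented-by-progression N₀ (JacobiCharacter.character L)
    (trans (cong (4 ℕ.*_) modulus≡) (sym (ℕ.*-assoc 4 3 N₀)))
    (λ {q} q-prime χq≡1 → subst (λ t → ∃[ x ] + q ∣ x * x + + t) modulus≡
      (JacobiCharacter.χ-1⇒square L l L-odd q-prime χq≡1))
    ρ c c′ z (JacobiCharacter.χ-1⇒coprime L {ρ} χρ≡1) χρ≡1

-- N is 2 modulo 3, so c = 1 makes ρ = 4N - 1 = 19 + 96s congruent to 1 modulo 3.
represented-5-mod-24 : ∀ s → Represented (+ (5 ℕ.+ 24 ℕ.* s))
represented-5-mod-24 s = represented-by-jacobi N L l (m≡ s) (L≡ s) (suc (k ℕ.+ k)) 1ℤ 1ℤ 0ℤ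
  (JacobiCharacter.χ-special L l (L≡ s) k (4 ℕ.+ 24 ℕ.* s) (k≡ s) 1 (6 ℕ.+ 32 ℕ.* s) (ρ≡ s) (M≡ s)
    (ℕ∣.divides 3 refl))
  (trans (cong (λ t → + t) (ρ+c² s)) (ℤ.pos-* 4 N)) (sym (trans (cong (λ t → 1ℤ + t) (ℤ.*-zeroʳ (+ 4 * + N))) refl))
  where
  N L l k : ℕ
  N = 5 ℕ.+ 24 ℕ.* s
  L = 7 ℕ.+ 36 ℕ.* s
  l = 3 ℕ.+ 18 ℕ.* s
  k = 9 ℕ.+ 48 ℕ.* s
  m≡ : ∀ s → suc ((7 ℕ.+ 36 ℕ.* s) ℕ.+ (7 ℕ.+ 36 ℕ.* s)) ≡ 3 ℕ.* (5 ℕ.+ 24 ℕ.* s)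
  m≡ = ℕ-solve-∀
  L≡ : ∀ s → 7 ℕ.+ 36 ℕ.* s ≡ suc ((3 ℕ.+ 18 ℕ.* s) ℕ.+ (3 ℕ.+ 18 ℕ.* s))
  L≡ = ℕ-solve-∀
  k≡ : ∀ s → 9 ℕ.+ 48 ℕ.* s ≡ suc ((4 ℕ.+ 24 ℕ.* s) ℕ.+ (4 ℕ.+ 24 ℕ.* s))
  k≡ = ℕ-solve-∀
  ρ≡ : ∀ s → suc ((9 ℕ.+ 48 ℕ.* s) ℕ.+ (9 ℕ.+ 48 ℕ.* s)) ≡ 1 ℕ.+ (6 ℕ.+ 32 ℕ.* s) ℕ.* 3
  ρ≡ = ℕ-solve-∀
  M≡ : ∀ s → 4 ℕ.* suc ((7 ℕ.+ 36 ℕ.* s) ℕ.+ (7 ℕ.+ 36 ℕ.* s)) ≡ 3 ℕ.* suc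
    ((9 ℕ.+ 48 ℕ.* s) ℕ.+ (9 ℕ.+ 48 ℕ.* s)) ℕ.+ 3
  M≡ = ℕ-solve-∀
  ρ+c² : ∀ s → suc ((9 ℕ.+ 48 ℕ.* s) ℕ.+ (9 ℕ.+ 48 ℕ.* s)) ℕ.+ 1 ≡ 4 ℕ.* (5 ℕ.+ 24 ℕ.* s)
  ρ+c² = ℕ-solve-∀

-- N is 1 modulo 3 and 4N - 1 is divisible by 3. So c = 3 and ρ = 4N - 9 = 43 + 96s, with (8N + 1) /
-- 3 as the inverse of 3 modulo 4N.
represented-13-mod-24 : ∀ s → Represented (+ (13 ℕ.+ 24 ℕ.* s))
represented-13-mod-24 s = represented-by-jacobi N L l (m≡ s) (L≡ s) (suc (k ℕ.+ k)) (+ 3) (+ (35 ℕ.+ 64 ℕ.* s))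
  (+ 2)
  (JacobiCharacter.χ-special L l (L≡ s) k (10 ℕ.+ 24 ℕ.* s) (k≡ s) 3 (14 ℕ.+ 32 ℕ.* s) (ρ≡ s) (M≡ s)
    (ℕ∣.divides 1 refl))
  (trans (cong (λ t → + t) (ρ+c² s)) (ℤ.pos-* 4 N))
  (trans (sym (ℤ.pos-* 3 (35 ℕ.+ 64 ℕ.* s)))
    (trans (cong (λ t → + t) (inverse s))
    (cong (λ t → 1ℤ + t) (trans (ℤ.pos-* (4 ℕ.* N) 2) (cong (_* + 2) (ℤ.pos-* 4 N))))))
  where
  N L l k : ℕ
  N = 13 ℕ.+ 24 ℕ.* s
  L = 19 ℕ.+ 36 ℕ.* s
  l = 9 ℕ.+ 18 ℕ.* s
  k = 21 ℕ.+ 48 ℕ.* s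
  m≡ : ∀ s → suc ((19 ℕ.+ 36 ℕ.* s) ℕ.+ (19 ℕ.+ 36 ℕ.* s)) ≡ 3 ℕ.* (13 ℕ.+ 24 ℕ.* s)
  m≡ = ℕ-solve-∀
  L≡ : ∀ s → 19 ℕ.+ 36 ℕ.* s ≡ suc ((9 ℕ.+ 18 ℕ.* s) ℕ.+ (9 ℕ.+ 18 ℕ.* s))
  L≡ = ℕ-solve-∀
  k≡ : ∀ s → 21 ℕ.+ 48 ℕ.* s ≡ suc ((10 ℕ.+ 24 ℕ.* s) ℕ.+ (10 ℕ.+ 24 ℕ.* s))
  k≡ = ℕ-solve-∀
  ρ≡ : ∀ s → suc ((21 ℕ.+ 48 ℕ.* s) ℕ.+ (21 ℕ.+ 48 ℕ.* s)) ≡ 1 ℕ.+ (14 ℕ.+ 32 ℕ.* s) ℕ.* 3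
  ρ≡ = ℕ-solve-∀
  M≡ : ∀ s → 4 ℕ.* suc ((19 ℕ.+ 36 ℕ.* s) ℕ.+ (19 ℕ.+ 36 ℕ.* s)) ≡ 3 ℕ.* suc
    ((21 ℕ.+ 48 ℕ.* s) ℕ.+ (21 ℕ.+ 48 ℕ.* s)) ℕ.+ 27
  M≡ = ℕ-solve-∀
  ρ+c² : ∀ s → suc ((21 ℕ.+ 48 ℕ.* s) ℕ.+ (21 ℕ.+ 48 ℕ.* s)) ℕ.+ 9 ≡ 4 ℕ.* (13 ℕ.+ 24 ℕ.* s)
  ρ+c² = ℕ-solve-∀
  inverse : ∀ s → 3 ℕ.* (35 ℕ.+ 64 ℕ.* s) ≡ 1 ℕ.+ 4 ℕ.* (13 ℕ.+ 24 ℕ.* s) ℕ.* 2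
  inverse = ℕ-solve-∀

-- Odd representations by s² + t² + 3z²

mod-+ : ∀ {m a b c d} → a ≡ b [mod m ] → c ≡ d [mod m ] → a + c ≡ b + d [mod m ]
mod-+ {m} {a} {b} {c} {d} (congruent p) (congruent q) = congruent (∣-resp (lem a b c d) (∣m∣n⇒∣m+n p q))
  where
  lem : ∀ a b c d → a - b + (c - d) ≡ a + c - (b + d)
  lem = solve-∀

Odd : ℤ → Set
Odd x = ∃[ k ] x ≡ k + k + 1ℤ

residue-mod : ∀ x m .{{_ : ℕ.NonZero m}} → + (x ℤ.%ℕ m) ≡ x [mod + m ]
residue-mod x m = mod-sym
  (congruent (divides (x ℤ./ℕ m)
  (trans (cong (_- + (x ℤ.%ℕ m)) (ℤ.a≡a%ℕn+[a/ℕn]*n x m)) (lem (+ (x ℤ.%ℕ m)) (x ℤ./ℕ m * + m)))))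
  where
  lem : ∀ r y → r + y - r ≡ y
  lem = solve-∀

even∨odd : ∀ x → Even x ⊎ Odd x
even∨odd x = by-residue (x ℤ.%ℕ 2) (ℤ.n%ℕd<d x 2) (ℤ.a≡a%ℕn+[a/ℕn]*n x 2)
  where
  q : ℤ
  q = x ℤ./ℕ 2
  even : ∀ q → 0ℤ + q * + 2 ≡ q + q
  even = solve-∀
  odd : ∀ q → 1ℤ + q * + 2 ≡ q + q + 1ℤ
  odd = solve-∀
  by-residue : ∀ r → r ℕ.< 2 → x ≡ + r + q * + 2 → Even x ⊎ Odd x
  by-residue 0 _ eq = inj₁ (q , trans eq (even q))
  by-residue 1 _ eq = inj₂ (q , trans eq (odd q))
  by-residue (suc (suc r)) (s≤s (s≤s ())) _

-- Form of all the parity contradictions below: from a = b and an explicit odd multiple of m equal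
-- to a - b. Each case then needs only a polynomial identity that exhibits y.
odd-nonzero : ∀ m .{{_ : ℤ.NonZero m}} y {a b} → a ≡ b → m * (y + y + 1ℤ) ≡ a - b → ⊥
odd-nonzero m y {a} refl eq with ℤ.i*j≡0⇒i≡0∨j≡0 m (trans eq (ℤ.+-inverseʳ a))
odd-nonzero _ {{()}} y refl eq | inj₁ refl
... | inj₂ odd≡0 = ℕ∣.>⇒∤ (s≤s (s≤s z≤n))
  (∣⇒∣ᵤ (divides {+ 2} {1ℤ} (- y)
  (trans (lem y) (trans (cong (λ t → - y * + 2 + t) odd≡0) (ℤ.+-identityʳ (- y * + 2))))))
  where
  lem : ∀ y → 1ℤ ≡ - y * + 2 + (y + y + 1ℤ)
  lem = solve-∀

pronic-even : ∀ k → Even (k * k + k)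
pronic-even k with even∨odd k
... | inj₁ (i , refl) = (i + i) * i + i , lem i
  where
  lem : ∀ i → (i + i) * (i + i) + (i + i) ≡ ((i + i) * i + i) + ((i + i) * i + i)
  lem = solve-∀
... | inj₂ (i , refl) = (i + i + 1ℤ) * (i + 1ℤ) , lem i
  where
  lem : ∀ i → (i + i + 1ℤ) * (i + i + 1ℤ) + (i + i + 1ℤ) ≡ (i + i + 1ℤ) * (i + 1ℤ) + (i + i + 1ℤ) * (i + 1ℤ)
  lem = solve-∀

OddTriple : ℤ → Set
OddTriple n = ∃[ s ] ∃[ t ] ∃[ z ] (Odd s × Odd t × Odd z × n ≡ s * s + t * t + + 3 * (z * z))

odd-square : ∀ {x} → Odd x → ∃[ j ] x * x ≡ + 8 * j + 1ℤ
odd-square (k , refl) with pronic-even k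
... | j , pronic = j , trans (expand k) (trans (cong (λ t → + 4 * t + 1ℤ) pronic) (collect j))
  where
  expand : ∀ k → (k + k + 1ℤ) * (k + k + 1ℤ) ≡ + 4 * (k * k + k) + 1ℤ
  expand = solve-∀
  collect : ∀ j → + 4 * (j + j) + 1ℤ ≡ + 8 * j + 1ℤ
  collect = solve-∀

eisenstein : ℤ → ℤ → ℤ
eisenstein u v = u * u + u * v + v * v

eisenstein-even : ∀ u v m → eisenstein u v ≡ m + m → Even u × Even v
eisenstein-even u v m eq with even∨odd u | even∨odd v
... | inj₁ u-even     | inj₁ v-even     = u-even , v-even
... | inj₁ (a , refl) | inj₂ (b , refl) = ⊥-elim
  (odd-nonzero 1ℤ (+ 2 * (a * a + a * b + b * b + b) + a - m) eq (lem a b m))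
  where
  lem : ∀ a b m → 1ℤ * ((+ 2 * (a * a + a * b + b * b + b) + a - m)
    + (+ 2 * (a * a + a * b + b * b + b) + a - m) + 1ℤ) ≡
    (a + a) * (a + a) + (a + a) * (b + b + 1ℤ) + (b + b + 1ℤ) * (b + b + 1ℤ) - (m + m)
  lem = solve-∀
... | inj₂ (a , refl) | inj₁ (b , refl) = ⊥-elim
  (odd-nonzero 1ℤ (+ 2 * (a * a + a * b + b * b + a) + b - m) eq (lem a b m))
  where
  lem : ∀ a b m → 1ℤ * ((+ 2 * (a * a + a * b + b * b + a) + b - m)
    + (+ 2 * (a * a + a * b + b * b + a) + b - m) + 1ℤ) ≡
    (a + a + 1ℤ) * (a + a + 1ℤ) + (a + a + 1ℤ) * (b + b) + (b + b) * (b + b) - (m + m)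
  lem = solve-∀
... | inj₂ (a , refl) | inj₂ (b , refl) = ⊥-elim
  (odd-nonzero 1ℤ (+ 2 * (a * a + a * b + b * b) + + 3 * (a + b) + 1ℤ - m) eq (lem a b m))
  where
  lem : ∀ a b m → 1ℤ * ((+ 2 * (a * a + a * b + b * b) + + 3 * (a + b) + 1ℤ - m)
    + (+ 2 * (a * a + a * b + b * b) + + 3 * (a + b) + 1ℤ - m) + 1ℤ) ≡
    (a + a + 1ℤ) * (a + a + 1ℤ) + (a + a + 1ℤ) * (b + b + 1ℤ) + (b + b + 1ℤ) * (b + b + 1ℤ) - (m + m)
  lem = solve-∀

OddPair : ℤ → Set
OddPair n = ∃[ t ] ∃[ z ] (Odd t × Odd z × n ≡ t * t + + 3 * (z * z))

-- 4 (a² + a b + b²) = (2a + b)² + 3b², used with b odd, or with a and b interchanged; both cannot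
-- be even, as the form has an odd value.
eisenstein-odd-pair : ∀ a b m → eisenstein a b ≡ m + m + 1ℤ → OddPair (+ 4 * eisenstein a b)
eisenstein-odd-pair a b m eq with even∨odd b | even∨odd a
... | inj₂ (k , refl) | _ = a + a + b , b , (a + k , odd a k) , (k , refl) , lem a b
  where
  odd : ∀ a k → a + a + (k + k + 1ℤ) ≡ a + k + (a + k) + 1ℤ
  odd = solve-∀
  lem : ∀ a b → + 4 * (a * a + a * b + b * b) ≡ (a + a + b) * (a + a + b) + + 3 * (b * b)
  lem = solve-∀
... | inj₁ _ | inj₂ (k , refl) = b + b + a , a , (b + k , odd b k) , (k , refl) , lem a b
  where
  odd : ∀ a k → a + a + (k + k + 1ℤ) ≡ a + k + (a + k) + 1ℤ
  odd = solve-∀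
  lem : ∀ a b → + 4 * (a * a + a * b + b * b) ≡ (b + b + a) * (b + b + a) + + 3 * (a * a)
  lem = solve-∀
... | inj₁ (k , refl) | inj₁ (l , refl) = ⊥-elim
  (odd-nonzero 1ℤ (m - + 2 * (l * l + l * k + k * k)) (sym eq) (lem l k m))
  where
  lem : ∀ l k m → 1ℤ * ((m - + 2 * (l * l + l * k + k * k)) + (m - + 2 * (l * l + l * k + k * k)) + 1ℤ) ≡
    m + m + 1ℤ - ((l + l) * (l + l) + (l + l) * (k + k) + (k + k) * (k + k))
  lem = solve-∀

add-square : ∀ {n m s} → Odd s → n ≡ s * s + m → OddPair m → OddTriple n
add-square {s = s} s-odd eq (t , z , t-odd , z-odd , m≡) =
  s , t , z , s-odd , t-odd , z-odd , trans eq
    (trans (cong (λ u → s * s + u) m≡) (sym (ℤ.+-assoc (s * s) (t * t) (+ 3 * (z * z)))))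

module _ (n : ℤ) where
  private
    N : ℤ
    N = + 8 * n + + 5

  -- N - x² is 4 modulo 8. So u and v are even, and a quarter of their form is odd.
  odd-first : ∀ {x u v} → Odd x → N ≡ x * x + eisenstein u v → OddTriple N
  odd-first {x} {u} {v} x-odd eq =
    let j , x²≡ = odd-square x-odd
        eisenstein≡ = trans (isolate (x * x) (eisenstein u v)) (trans (cong₂ _-_ (sym eq) x²≡) (lem n j))
        (a , u≡) , (b , v≡) = eisenstein-even u v (+ 4 * (n - j) + + 2) eisenstein≡
        quadruple = trans (cong₂ eisenstein u≡ v≡) (scale a b)
        halved = ℤ.*-cancelˡ-≡ (+ 4) (eisenstein a b) _ (trans (sym quadruple) (trans eisenstein≡ (lem′ (n - j))))
    in add-square x-odd (trans eq (cong (λ t → x * x + t) quadruple)) (eisenstein-odd-pair a b (n - j) halved)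
    where
    isolate : ∀ a b → b ≡ a + b - a
    isolate = solve-∀
    lem : ∀ n j → + 8 * n + + 5 - (+ 8 * j + 1ℤ) ≡ (+ 4 * (n - j) + + 2) + (+ 4 * (n - j) + + 2)
    lem = solve-∀
    lem′ : ∀ d → (+ 4 * d + + 2) + (+ 4 * d + + 2) ≡ + 4 * (d + d + 1ℤ)
    lem′ = solve-∀
    scale : ∀ a b → (a + a) * (a + a) + (a + a) * (b + b) + (b + b) * (b + b) ≡ + 4 * (a * a + a * b + b * b)
    scale = solve-∀

  -- Modulo 4, c has to be even, say c = 2i. Then N = y² + 4 (a² + 3i²) with y = b + 2i odd and a² +
  -- 3i² odd. Finally 4 (a² + 3i²) = (a + 3i)² + 3 (a - i)², where both bases have the parity of a²
  -- + 3i².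
  even-first : ∀ a b c → Odd b → N ≡ (a + a) * (a + a) + eisenstein b (c + c) → OddTriple N
  even-first a b c b-odd eq with even∨odd c
  even-first a b c (k , refl) eq | inj₂ (i , refl) = ⊥-elim
    (odd-nonzero (+ 2) (+ 2 * n - 1ℤ - a * a - k * k - + 2 * k - + 2 * (k * i) - + 5 * i - + 4 * (i * i)) eq
    (lem n a k i))
    where
    lem : ∀ n a k i → + 2 * ((+ 2 * n - 1ℤ - a * a - k * k - + 2 * k - + 2 * (k * i) - + 5 * i - + 4 * (i * i))
      + (+ 2 * n - 1ℤ - a * a - k * k - + 2 * k - + 2 * (k * i) - + 5 * i - + 4 * (i * i)) + 1ℤ) ≡
      + 8 * n + + 5 - ((a + a) * (a + a)
        + ((k + k + 1ℤ) * (k + k + 1ℤ) + (k + k + 1ℤ) * (i + i + 1ℤ + (i + i + 1ℤ))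
        + (i + i + 1ℤ + (i + i + 1ℤ)) * (i + i + 1ℤ + (i + i + 1ℤ))))
    lem = solve-∀
  even-first a b c (k , refl) eq | inj₁ (i , refl) =
    let j , y²≡ = odd-square {y} y-odd
        l , pronic-a = pronic-even a
        m , pronic-i = pronic-even i
        quarter = ℤ.*-cancelˡ-≡ (+ 4) (a * a + + 3 * (i * i)) _
          (trans (isolate a i y) (trans (cong₂ _-_ (sym split) y²≡) (lem n j)))
    in add-square {s = y} y-odd split (a + + 3 * i , a - i ,
      (l + + 3 * m - (n - j) - 1ℤ , trans (expand a i)
        (trans (cong₂ (λ u v → u - v) (cong₂ (λ u v → u + + 3 * v) pronic-a pronic-i) quarter) (odd l m (n - j)))) ,
      (l + + 3 * m - (n - j) - 1ℤ - + 2 * i , trans (expand′ a i)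
        (trans (cong₂ (λ u v → u - v - + 4 * i) (cong₂ (λ u v → u + + 3 * v) pronic-a pronic-i) quarter)
        (odd′ l m (n - j) i))) ,
      rotated a i)
    where
    y : ℤ
    y = k + k + 1ℤ + (i + i)
    y-odd : Odd y
    y-odd = k + i , lem₁ k i
      where
      lem₁ : ∀ k i → k + k + 1ℤ + (i + i) ≡ k + i + (k + i) + 1ℤ
      lem₁ = solve-∀
    split : N ≡ y * y + + 4 * (a * a + + 3 * (i * i))
    split = trans eq (lem₂ a k i)
      where
      lem₂ : ∀ a k i → (a + a) * (a + a)
        + ((k + k + 1ℤ) * (k + k + 1ℤ) + (k + k + 1ℤ) * (i + i + (i + i)) + (i + i + (i + i)) * (i + i + (i + i))) ≡
        (k + k + 1ℤ + (i + i)) * (k + k + 1ℤ + (i + i)) + + 4 * (a * a + + 3 * (i * i))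
      lem₂ = solve-∀
    isolate : ∀ a i y → + 4 * (a * a + + 3 * (i * i)) ≡ y * y + + 4 * (a * a + + 3 * (i * i)) - y * y
    isolate = solve-∀
    lem : ∀ n j → + 8 * n + + 5 - (+ 8 * j + 1ℤ) ≡ + 4 * ((n - j) + (n - j) + 1ℤ)
    lem = solve-∀
    expand : ∀ a i → a + + 3 * i ≡ (a * a + a) + + 3 * (i * i + i) - (a * a + + 3 * (i * i))
    expand = solve-∀
    expand′ : ∀ a i → a - i ≡ (a * a + a) + + 3 * (i * i + i) - (a * a + + 3 * (i * i)) - + 4 * i
    expand′ = solve-∀
    odd : ∀ l m d → (l + l) + + 3 * (m + m) - (d + d + 1ℤ) ≡ (l + + 3 * m - d - 1ℤ) + (l + + 3 * m - d - 1ℤ) + 1ℤ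
    odd = solve-∀
    odd′ : ∀ l m d i → (l + l) + + 3 * (m + m) - (d + d + 1ℤ) - + 4 * i ≡ (l + + 3 * m - d - 1ℤ - + 2 * i)
      + (l + + 3 * m - d - 1ℤ - + 2 * i) + 1ℤ
    odd′ = solve-∀
    rotated : ∀ a i → + 4 * (a * a + + 3 * (i * i)) ≡ (a + + 3 * i) * (a + + 3 * i) + + 3 * ((a - i) * (a - i))
    rotated = solve-∀

  odd-triple : Represented N → OddTriple N
  odd-triple (x , u , v , eq) with even∨odd x
  ... | inj₂ x-odd = odd-first {x} {u} {v} x-odd eq
  ... | inj₁ (a , refl) with even∨odd u | even∨odd v
  ... | inj₂ u-odd | inj₁ (c , refl) = even-first a u c u-odd eq
  ... | inj₁ (c , refl) | inj₂ v-odd = even-first a v c v-odd (trans eq (lem a v c))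
    where
    lem : ∀ a v c → (a + a) * (a + a) + ((c + c) * (c + c) + (c + c) * v + v * v) ≡ (a + a) * (a + a)
      + (v * v + v * (c + c) + (c + c) * (c + c))
    lem = solve-∀
  -- When u and v are both odd, the automorphism (u, v) ↦ (- v, u + v) of the form makes the second
  -- coordinate even.
  ... | inj₂ (b , refl) | inj₂ (c , refl) = even-first a (- v) (b + c + 1ℤ) (- c - 1ℤ , odd c)
    (trans eq (lem a b c))
    where
    odd : ∀ c → - (c + c + 1ℤ) ≡ - c - 1ℤ + (- c - 1ℤ) + 1ℤ
    odd = solve-∀
    lem : ∀ a b c → (a + a) * (a + a)
      + ((b + b + 1ℤ) * (b + b + 1ℤ) + (b + b + 1ℤ) * (c + c + 1ℤ) + (c + c + 1ℤ) * (c + c + 1ℤ)) ≡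
      (a + a) * (a + a) + (- (c + c + 1ℤ) * - (c + c + 1ℤ) + - (c + c + 1ℤ) * (b + c + 1ℤ + (b + c + 1ℤ))
        + (b + c + 1ℤ + (b + c + 1ℤ)) * (b + c + 1ℤ + (b + c + 1ℤ)))
    lem = solve-∀
  ... | inj₁ (b , refl) | inj₁ (c , refl) = ⊥-elim
    (odd-nonzero 1ℤ (+ 4 * n + + 2 - + 2 * (a * a + eisenstein b c)) eq (lem n a b c))
    where
    lem : ∀ n a b c → 1ℤ * ((+ 4 * n + + 2 - + 2 * (a * a + (b * b + b * c + c * c)))
      + (+ 4 * n + + 2 - + 2 * (a * a + (b * b + b * c + c * c))) + 1ℤ) ≡
      + 8 * n + + 5 - ((a + a) * (a + a) + ((b + b) * (b + b) + (b + b) * (c + c) + (c + c) * (c + c)))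
    lem = solve-∀

-- Congruences for the odd unknowns

mod-∣ : ∀ {m d a b} → d ℕ∣.∣ m → a ≡ b [mod + m ] → a ≡ b [mod + d ]
mod-∣ d∣m (congruent p) = congruent (∣-trans (∣ᵤ⇒∣ d∣m) p)

∣⇒mod-0 : ∀ {m x} → m ∣ x → x ≡ 0ℤ [mod m ]
∣⇒mod-0 {m} {x} d = congruent (∣-resp (sym (ℤ.+-identityʳ x)) d)

mod-0⇒∣ : ∀ {m x} → x ≡ 0ℤ [mod m ] → m ∣ x
mod-0⇒∣ {m} {x} (congruent d) = ∣-resp (ℤ.+-identityʳ x) d

mod-square : ∀ {m r x} → + r ≡ x [mod m ] → + (r ℕ.* r) ≡ x * x [mod m ]
mod-square {m} {r} p = mod-trans (mod-reflexive (ℤ.pos-* r r)) (mod-* p p)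

odd-mod-2 : ∀ {x} → Odd x → x ≡ 1ℤ [mod + 2 ]
odd-mod-2 (k , refl) = congruent (divides k (lem k))
  where
  lem : ∀ k → k + k + 1ℤ - 1ℤ ≡ k * + 2
  lem = solve-∀

decompose : ∀ x m .{{_ : ℕ.NonZero m}} {r} → x ℤ.%ℕ m ≡ r → ∃[ q ] x ≡ + r + q * + m
decompose x m refl = x ℤ./ℕ m , ℤ.a≡a%ℕn+[a/ℕn]*n x m

-- Removes the floor from the definition of p: x (x - 1) is the pronic number of x - 1, hence even.
twice-p : ∀ m x → + 2 * p m x ≡ (+ m - + 2) * (x * x - x) + + 2 * x
twice-p m x = begin
  + 2 * ((+ m - + 2) * (y ℤ./ + 2) + x)                   ≡⟨ distribute (+ m - + 2) (y ℤ./ + 2) x ⟩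
  (+ m - + 2) * (0ℤ + (y ℤ./ + 2) * + 2) + + 2 * x        ≡⟨ cong
    (λ t → (+ m - + 2) * (+ t + (y ℤ./ + 2) * + 2) + + 2 * x) remainder ⟨
  (+ m - + 2) * (+ (y ℤ.% + 2) + (y ℤ./ + 2) * + 2) + + 2 * x  ≡⟨ cong (λ t → (+ m - + 2) * t + + 2 * x)
    (ℤ.a≡a%n+[a/n]*n y (+ 2)) ⟨
  (+ m - + 2) * y + + 2 * x                               ≡⟨ cong (λ t → (+ m - + 2) * t + + 2 * x) (expand x) ⟩
  (+ m - + 2) * (x * x - x) + + 2 * x                     ∎
  where
  open ≡-Reasoning
  y : ℤ
  y = x * (x - 1ℤ)
  distribute : ∀ c q x → + 2 * (c * q + x) ≡ c * (0ℤ + q * + 2) + + 2 * x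
  distribute = solve-∀
  expand : ∀ x → x * (x - 1ℤ) ≡ x * x - x
  expand = solve-∀
  y-even : + 2 ∣ y
  y-even with pronic-even (x - 1ℤ)
  ... | k , eq = divides k (trans (lem x) (trans eq (lem′ k)))
    where
    lem : ∀ x → x * (x - 1ℤ) ≡ (x - 1ℤ) * (x - 1ℤ) + (x - 1ℤ)
    lem = solve-∀
    lem′ : ∀ k → k + k ≡ k * + 2
    lem′ = solve-∀
  remainder : y ℤ.% + 2 ≡ 0
  remainder = mod-small (mod-trans (residue-mod y 2) (∣⇒mod-0 y-even)) (ℤ.n%d<d y (+ 2)) (s≤s z≤n)

residue-sum : ∀ m .{{_ : ℕ.NonZero m}} x y → + (x ℤ.%ℕ m ℕ.* (x ℤ.%ℕ m) ℕ.+ y ℤ.%ℕ m ℕ.* (y ℤ.%ℕ m)) ≡ x * x + y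
  * y [mod + m ]
residue-sum m x y = mod-+ (mod-square (residue-mod x m)) (mod-square (residue-mod y m))

3∣one-of-two : ∀ x y → x * x + y * y ≡ 1ℤ [mod + 3 ] → + 3 ∣ x ⊎ + 3 ∣ y
3∣one-of-two x y p = conclude (from-yes (ℕ.allUpTo? (λ i → ℕ.allUpTo? (λ j →
    ((i ℕ.* i ℕ.+ j ℕ.* j) % 3 ℕ.≟ 1) →-dec ((i ℕ.≟ 0) ⊎-dec (j ℕ.≟ 0))) 3) 3)
  (ℤ.n%ℕd<d x 3) (ℤ.n%ℕd<d y 3) (mod⇒% 3 (mod-trans (residue-sum 3 x y) p)))
  where
  to-∣ : ∀ x → x ℤ.%ℕ 3 ≡ 0 → + 3 ∣ x
  to-∣ x eq = mod-0⇒∣ (mod-trans (mod-sym (residue-mod x 3)) (mod-reflexive (cong (λ t → + t) eq)))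
  conclude : x ℤ.%ℕ 3 ≡ 0 ⊎ y ℤ.%ℕ 3 ≡ 0 → + 3 ∣ x ⊎ + 3 ∣ y
  conclude (inj₁ eq) = inj₁ (to-∣ x eq)
  conclude (inj₂ eq) = inj₂ (to-∣ y eq)

odd-multiple : ∀ {x} m → Odd (m * x) → Odd x
odd-multiple {x} m (k , eq) with even∨odd x
... | inj₂ odd = odd
... | inj₁ (i , refl) = ⊥-elim (odd-nonzero 1ℤ (k - m * i) (sym eq) (lem k m i))
  where
  lem : ∀ k m i → 1ℤ * ((k - m * i) + (k - m * i) + 1ℤ) ≡ (k + k + 1ℤ) - m * (i + i)
  lem = solve-∀

odd-third : ∀ {x} → Odd x → + 3 ∣ x → ∃[ k ] x ≡ + 3 * (+ 2 * k + 1ℤ)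
odd-third {x} odd (divides q eq) with odd-multiple {q} (+ 3) (subst Odd (trans eq (ℤ.*-comm q (+ 3))) odd)
... | k , refl = k , trans eq (lem k)
  where
  lem : ∀ k → (k + k + 1ℤ) * + 3 ≡ + 3 * (+ 2 * k + 1ℤ)
  lem = solve-∀

-- Only x² matters, so x or - x may be used, and the two residues r and m - r lead to the same form
-- m y - r of the base.
square-of-residue : ∀ m r r′ .{{_ : ℕ.NonZero m}} → r ℕ.+ r′ ≡ m → ∀ x → x ℤ.%ℕ m ≡ r ⊎ x ℤ.%ℕ m ≡ r′ →
  ∃[ y ] x * x ≡ (+ m * y - + r) * (+ m * y - + r)
square-of-residue m r r′ sum x (inj₁ eq) = let q , x≡ = decompose x m eq in - q , trans (cong (λ t → t * t) x≡) (lem (+ m) (+ r) q)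
  where
  lem : ∀ m r q → (r + q * m) * (r + q * m) ≡ (m * - q - r) * (m * - q - r)
  lem = solve-∀
square-of-residue m r r′ sum x (inj₂ eq) = let q , x≡ = decompose x m eq in
  q + 1ℤ , trans (cong (λ t → t * t) x≡)
    (trans (cong (λ t → (+ r′ + q * t) * (+ r′ + q * t)) (cong (λ t → + t) (sym sum)))
    (trans (lem (+ r) (+ r′) q) (cong (λ t → (+ t * (q + 1ℤ) - + r) * (+ t * (q + 1ℤ) - + r)) sum)))
  where
  lem : ∀ r r′ q → (r′ + q * (r + r′)) * (r′ + q * (r + r′)) ≡ ((r + r′) * (q + 1ℤ) - r) * ((r + r′) * (q + 1ℤ) - r)
  lem = solve-∀

unit-mod-6 : ∀ {x} → Odd x → x * x ≡ 1ℤ [mod + 3 ] → ∃[ y ] x * x ≡ (+ 6 * y - 1ℤ) * (+ 6 * y - 1ℤ)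
unit-mod-6 {x} odd sq = square-of-residue 6 1 5 refl x
  (from-yes (ℕ.allUpTo? (λ i → (i % 2 ℕ.≟ 1) →-dec ((i ℕ.* i) % 3 ℕ.≟ 1) →-dec ((i ℕ.≟ 1) ⊎-dec (i ℕ.≟ 5))) 6)
    (ℤ.n%ℕd<d x 6) (mod⇒% 2 (mod-trans (mod-∣ (ℕ∣.divides 3 refl) (residue-mod x 6)) (odd-mod-2 odd)))
    (mod⇒% 3 (mod-trans (mod-square (mod-∣ (ℕ∣.divides 2 refl) (residue-mod x 6))) sq)))

unit-mod-18 : ∀ {x} → Odd x → x * x ≡ + 4 [mod + 9 ] → ∃[ y ] x * x ≡ (+ 18 * y - + 7) * (+ 18 * y - + 7)
unit-mod-18 {x} odd sq = square-of-residue 18 7 11 refl x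
  (from-yes (ℕ.allUpTo? (λ i → (i % 2 ℕ.≟ 1) →-dec ((i ℕ.* i) % 9 ℕ.≟ 4) →-dec ((i ℕ.≟ 7) ⊎-dec (i ℕ.≟ 11))) 18)
    (ℤ.n%ℕd<d x 18) (mod⇒% 2 (mod-trans (mod-∣ (ℕ∣.divides 9 refl) (residue-mod x 18)) (odd-mod-2 odd)))
    (mod⇒% 9 (mod-trans (mod-square (mod-∣ (ℕ∣.divides 2 refl) (residue-mod x 18))) sq)))

unit-mod-10 : ∀ {x} → Odd x → x * x ≡ + 4 [mod + 5 ] → ∃[ y ] x * x ≡ (+ 10 * y - + 3) * (+ 10 * y - + 3)
unit-mod-10 {x} odd sq = square-of-residue 10 3 7 refl x
  (from-yes (ℕ.allUpTo? (λ i → (i % 2 ℕ.≟ 1) →-dec ((i ℕ.* i) % 5 ℕ.≟ 4) →-dec ((i ℕ.≟ 3) ⊎-dec (i ℕ.≟ 7))) 10)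
    (ℤ.n%ℕd<d x 10) (mod⇒% 2 (mod-trans (mod-∣ (ℕ∣.divides 5 refl) (residue-mod x 10)) (odd-mod-2 odd)))
    (mod⇒% 5 (mod-trans (mod-square (mod-∣ (ℕ∣.divides 2 refl) (residue-mod x 10))) sq)))

-- Multiplication of t + z√-3 by a primitive sixth root of unity or its inverse, whichever keeps both coordinates odd.
rotate : ∀ {t z} → Odd t → Odd z →
  ∃[ t′ ] ∃[ z′ ] (Odd t′ × Odd z′ × t * t + + 3 * (z * z) ≡ t′ * t′ + + 3 * (z′ * z′) ×
    (+ 2 * z′ ≡ t - z ⊎ + 2 * z′ ≡ t + z))
rotate (b , refl) (c , refl) with even∨odd (b - c)
... | inj₂ (k , eq) = b + + 3 * c + + 2 , b - c ,
  (k + + 2 * c + 1ℤ , trans (split b c) (trans (cong (_+ (+ 4 * c + + 2)) eq) (odd k c))) , (k , eq) ,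
      norm b c , inj₁ (half b c)
  where
  split : ∀ b c → b + + 3 * c + + 2 ≡ (b - c) + (+ 4 * c + + 2)
  split = solve-∀
  odd : ∀ k c → k + k + 1ℤ + (+ 4 * c + + 2) ≡ (k + + 2 * c + 1ℤ) + (k + + 2 * c + 1ℤ) + 1ℤ
  odd = solve-∀
  norm : ∀ b c → (b + b + 1ℤ) * (b + b + 1ℤ) + + 3 * ((c + c + 1ℤ) * (c + c + 1ℤ)) ≡ (b + + 3 * c + + 2) *
    (b + + 3 * c + + 2) + + 3 * ((b - c) * (b - c))
  norm = solve-∀
  half : ∀ b c → + 2 * (b - c) ≡ b + b + 1ℤ - (c + c + 1ℤ)
  half = solve-∀
... | inj₁ (k , eq) = b - + 3 * c - 1ℤ , b + c + 1ℤ ,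
  (k - c - 1ℤ , trans (split b c) (trans (cong (_- (+ 2 * c + 1ℤ)) eq) (odd k c))) ,
      (k + c , trans (split′ b c) (trans (cong (_+ (+ 2 * c + 1ℤ)) eq) (odd′ k c))) , norm b c , inj₂ (half b c)
  where
  split : ∀ b c → b - + 3 * c - 1ℤ ≡ (b - c) - (+ 2 * c + 1ℤ)
  split = solve-∀
  odd : ∀ k c → k + k - (+ 2 * c + 1ℤ) ≡ (k - c - 1ℤ) + (k - c - 1ℤ) + 1ℤ
  odd = solve-∀
  split′ : ∀ b c → b + c + 1ℤ ≡ (b - c) + (+ 2 * c + 1ℤ)
  split′ = solve-∀
  odd′ : ∀ k c → k + k + (+ 2 * c + 1ℤ) ≡ (k + c) + (k + c) + 1ℤ
  odd′ = solve-∀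
  norm : ∀ b c → (b + b + 1ℤ) * (b + b + 1ℤ) + + 3 * ((c + c + 1ℤ) * (c + c + 1ℤ)) ≡ (b - + 3 * c - 1ℤ) *
    (b - + 3 * c - 1ℤ) + + 3 * ((b + c + 1ℤ) * (b + c + 1ℤ))
  norm = solve-∀
  half : ∀ b c → + 2 * (b + c + 1ℤ) ≡ b + b + 1ℤ + (c + c + 1ℤ)
  half = solve-∀

odd-triple-5 : ∀ s → OddTriple (+ (5 ℕ.+ 24 ℕ.* s))
odd-triple-5 s = subst OddTriple (sym eq) (odd-triple (+ (3 ℕ.* s)) (subst Represented eq (represented-5-mod-24 s)))
  where
  eq : + (5 ℕ.+ 24 ℕ.* s) ≡ + 8 * + (3 ℕ.* s) + + 5
  eq = trans (cong (λ t → + t) (lem s)) (cong (_+ + 5) (ℤ.pos-* 8 (3 ℕ.* s)))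
    where
    lem : ∀ s → 5 ℕ.+ 24 ℕ.* s ≡ 8 ℕ.* (3 ℕ.* s) ℕ.+ 5
    lem = ℕ-solve-∀

odd-triple-13 : ∀ s → OddTriple (+ (13 ℕ.+ 24 ℕ.* s))
odd-triple-13 s = subst OddTriple (sym eq)
  (odd-triple (+ (1 ℕ.+ 3 ℕ.* s)) (subst Represented eq (represented-13-mod-24 s)))
  where
  eq : + (13 ℕ.+ 24 ℕ.* s) ≡ + 8 * + (1 ℕ.+ 3 ℕ.* s) + + 5
  eq = trans (cong (λ t → + t) (lem s)) (cong (_+ + 5) (ℤ.pos-* 8 (1 ℕ.+ 3 ℕ.* s)))
    where
    lem : ∀ s → 13 ℕ.+ 24 ℕ.* s ≡ 8 ℕ.* (1 ℕ.+ 3 ℕ.* s) ℕ.+ 5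
    lem = ℕ-solve-∀

replace-norm : ∀ {n} s t z t′ z′ → t * t + + 3 * (z * z) ≡ t′ * t′ + + 3 * (z′ * z′) →
  n ≡ s * s + t * t + + 3 * (z * z) → n ≡ s * s + t′ * t′ + + 3 * (z′ * z′)
replace-norm s t z t′ z′ norm eq = trans eq
  (trans (ℤ.+-assoc (s * s) (t * t) _) (trans (cong (λ u → s * s + u) norm) (sym (ℤ.+-assoc (s * s) _ _))))

-- Either z² ≡ 4 already, or the pair (t, z) or (s, z) is such that a rotation produces z′² ≡ 4, as
-- `after-rotation` shows.
residues-mod-5 : ∀ {i} → i ℕ.< 5 → ∀ {j} → j ℕ.< 5 → ∀ {k} → k ℕ.< 5 → (i ℕ.* i ℕ.+ j ℕ.* j ℕ.+ 3 ℕ.* (k ℕ.* k))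
  % 5 ≡ 2 →
  (k ℕ.* k) % 5 ≡ 4 ⊎ ((j ℕ.* k) % 5 ≡ 0 × (j ℕ.* j ℕ.+ k ℕ.* k) % 5 ≡ 1) ⊎
    ((i ℕ.* k) % 5 ≡ 0 × (i ℕ.* i ℕ.+ k ℕ.* k) % 5 ≡ 1)
residues-mod-5 = from-yes (ℕ.allUpTo? (λ i → ℕ.allUpTo? (λ j → ℕ.allUpTo? (λ k →
  ((i ℕ.* i ℕ.+ j ℕ.* j ℕ.+ 3 ℕ.* (k ℕ.* k)) % 5 ℕ.≟ 2) →-dec
  (((k ℕ.* k) % 5 ℕ.≟ 4) ⊎-dec
    ((((j ℕ.* k) % 5 ℕ.≟ 0) ×-dec ((j ℕ.* j ℕ.+ k ℕ.* k) % 5 ℕ.≟ 1)) ⊎-dec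
    (((i ℕ.* k) % 5 ℕ.≟ 0) ×-dec ((i ℕ.* i ℕ.+ k ℕ.* k) % 5 ℕ.≟ 1))))) 5) 5) 5)

-- Part (a), from representations of 72n + 61

module PartA (n N : ℤ) (N≡ : N ≡ + 72 * n + + 61) where

  Goal : Set
  Goal = ∃[ x ] ∃[ y ] ∃[ z ] (n ≡ p 3 x + p 5 y + p 11 z)

  -- 72 p₃(x) + 9 = 9 (2x + 1)², 72 p₅(y) + 3 = 3 (6y - 1)² and 72 p₁₁(z) + 49 = (18z - 7)²; the
  -- constants add up to 61.
  conclude : ∀ x y z → N ≡ + 3 * (+ 2 * x + 1ℤ) * (+ 3 * (+ 2 * x + 1ℤ)) + (+ 18 * z - + 7) * (+ 18 * z - + 7)
    + + 3 * ((+ 6 * y - 1ℤ) * (+ 6 * y - 1ℤ)) → Goal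
  conclude x y z eq = x , y , z , ℤ.*-cancelˡ-≡ (+ 72) n (p 3 x + p 5 y + p 11 z) (begin
    + 72 * n                                                       ≡⟨ trans (isolate n) (cong (_- + 61) (sym N≡)) ⟩
    N - + 61                                                       ≡⟨ trans (cong (_- + 61) eq) (expand x y z) ⟩
    + 36 * ((1ℤ * (x * x - x) + + 2 * x) + (+ 3 * (y * y - y) + + 2 * y) + (+ 9 * (z * z - z) + + 2 * z))
      ≡⟨ cong (+ 36 *_) (cong₂ _+_ (cong₂ _+_ (twice-p 3 x) (twice-p 5 y)) (twice-p 11 z)) ⟨
    + 36 * (+ 2 * p 3 x + + 2 * p 5 y + + 2 * p 11 z)              ≡⟨ collect (p 3 x) (p 5 y) (p 11 z) ⟩
    + 72 * (p 3 x + p 5 y + p 11 z)                                ∎)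
    where
    open ≡-Reasoning
    isolate : ∀ n → + 72 * n ≡ + 72 * n + + 61 - + 61
    isolate = solve-∀
    expand : ∀ x y z → + 3 * (+ 2 * x + 1ℤ) * (+ 3 * (+ 2 * x + 1ℤ)) + (+ 18 * z - + 7) * (+ 18 * z - + 7) + + 3
      * ((+ 6 * y - 1ℤ) * (+ 6 * y - 1ℤ)) - + 61 ≡
      + 36 * ((1ℤ * (x * x - x) + + 2 * x) + (+ 3 * (y * y - y) + + 2 * y) + (+ 9 * (z * z - z) + + 2 * z))
    expand = solve-∀
    collect : ∀ a b c → + 36 * (+ 2 * a + + 2 * b + + 2 * c) ≡ + 72 * (a + b + c)
    collect = solve-∀

  nonmultiple-square : ∀ z → ¬ + 3 ∣ z → z * z ≡ 1ℤ [mod + 3 ]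
  nonmultiple-square z 3∤z = by-residue (z ℤ.%ℕ 3) (ℤ.n%ℕd<d z 3) (residue-mod z 3)
    where
    by-residue : ∀ r → r ℕ.< 3 → + r ≡ z [mod + 3 ] → z * z ≡ 1ℤ [mod + 3 ]
    by-residue 0 _ p = contradiction (mod-0⇒∣ (mod-sym p)) 3∤z
    by-residue 1 _ p = mod-sym (mod-* p p)
    by-residue 2 _ p = mod-trans (mod-sym (mod-* p p)) (congruent (divides 1ℤ refl))
    by-residue (suc (suc (suc r))) (s≤s (s≤s (s≤s ()))) _

  sum-mod-3 : ∀ s t z → N ≡ s * s + t * t + + 3 * (z * z) → s * s + t * t ≡ 1ℤ [mod + 3 ]
  sum-mod-3 s t z eq = congruent (divides (+ 24 * n + + 20 - z * z)
    (trans (isolate (s * s + t * t) (z * z))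
      (trans (cong (λ u → u - + 3 * (z * z) - 1ℤ) (trans (sym eq) N≡)) (lem n (z * z)))))
    where
    isolate : ∀ a b → a - 1ℤ ≡ a + + 3 * b - + 3 * b - 1ℤ
    isolate = solve-∀
    lem : ∀ n b → + 72 * n + + 61 - + 3 * b - 1ℤ ≡ (+ 24 * n + + 20 - b) * + 3
    lem = solve-∀

  not-divisible : ∀ s t z → + 3 ∣ s → + 3 ∣ t → N ≡ s * s + t * t + + 3 * (z * z) → ⊥
  not-divisible s t z 3∣s 3∣t eq = ℕ∣.>⇒∤ (s≤s (s≤s z≤n)) (∣⇒∣ᵤ (mod-0⇒∣ (mod-trans (mod-sym (sum-mod-3 s t z eq))
    (∣⇒mod-0 (∣m∣n⇒∣m+n {+ 3} (∣m⇒∣m*n s 3∣s) (∣m⇒∣m*n t 3∣t))))))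

  -- Modulo 9 the square of the multiple of 3 drops out and 3z² ≡ 3, as z is prime to 3; this leaves
  -- t² ≡ 61 - 3 ≡ 4.
  t²-mod-9 : ∀ x y t z → z * z ≡ (+ 6 * y - 1ℤ) * (+ 6 * y - 1ℤ) →
    N ≡ + 3 * (+ 2 * x + 1ℤ) * (+ 3 * (+ 2 * x + 1ℤ)) + t * t + + 3 * (z * z) → t * t ≡ + 4 [mod + 9 ]
  t²-mod-9 x y t z z²≡ eq = congruent
    (divides (+ 8 * n + + 6 - (+ 2 * x + 1ℤ) * (+ 2 * x + 1ℤ) - + 12 * (y * y) + + 4 * y)
    (trans (isolate (+ 3 * (+ 2 * x + 1ℤ)) (t * t) (z * z))
      (trans (cong₂ (λ u v → u - + 3 * (+ 2 * x + 1ℤ) * (+ 3 * (+ 2 * x + 1ℤ)) - + 3 * v - + 4)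
        (trans (sym eq) N≡) z²≡) (lem n x y))))
    where
    isolate : ∀ a b c → b - + 4 ≡ (a * a + b + + 3 * c) - a * a - + 3 * c - + 4
    isolate = solve-∀
    lem : ∀ n x y → + 72 * n + + 61 - + 3 * (+ 2 * x + 1ℤ) * (+ 3 * (+ 2 * x + 1ℤ)) - + 3 *
      ((+ 6 * y - 1ℤ) * (+ 6 * y - 1ℤ)) - + 4 ≡
      (+ 8 * n + + 6 - (+ 2 * x + 1ℤ) * (+ 2 * x + 1ℤ) - + 12 * (y * y) + + 4 * y) * + 9
    lem = solve-∀

  finish : ∀ {s t z} → Odd s → Odd t → Odd z → + 3 ∣ s → ¬ + 3 ∣ z → N ≡ s * s + t * t + + 3 * (z * z) → Goal
  finish {s} {t} {z} s-odd t-odd z-odd 3∣s 3∤z eq =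
    let x , s≡  = odd-third s-odd 3∣s
        y , z²≡ = unit-mod-6 z-odd (nonmultiple-square z 3∤z)
        eq′     = trans eq (cong (λ u → u * u + t * t + + 3 * (z * z)) s≡)
        w , t²≡ = unit-mod-18 {t} t-odd (t²-mod-9 x y t z z²≡ eq′)
    in conclude x y w (trans eq′
      (cong₂ (λ u v → + 3 * (+ 2 * x + 1ℤ) * (+ 3 * (+ 2 * x + 1ℤ)) + u + + 3 * v) t²≡ z²≡))

  -- If 3 divides z, then rotating (t, z) gives 2z′ = t ± z. Were z′ still divisible by 3, so would
  -- be t, but s and t are not both multiples of 3.
  avoid-3 : ∀ {s t z} → Odd s → Odd t → Odd z → + 3 ∣ s → N ≡ s * s + t * t + + 3 * (z * z) → Goal
  avoid-3 {s} {t} {z} s-odd t-odd z-odd 3∣s eq = by-cases (3 ℕ∣.∣? ℤ.∣ z ∣)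
    where
    lem₁ : ∀ t z → t - z + z ≡ t
    lem₁ = solve-∀
    lem₂ : ∀ t z → t + z + - z ≡ t
    lem₂ = solve-∀
    3∣t : ∀ {z′} → + 3 ∣ z → + 2 * z′ ≡ t - z ⊎ + 2 * z′ ≡ t + z → + 3 ∣ z′ → + 3 ∣ t
    3∣t 3∣z (inj₁ e) 3∣z′ = ∣-resp (lem₁ t z) (∣m∣n⇒∣m+n {+ 3} (∣-resp e (∣n⇒∣m*n (+ 2) 3∣z′)) 3∣z)
    3∣t 3∣z (inj₂ e) 3∣z′ = ∣-resp (lem₂ t z) (∣m∣n⇒∣m+n {+ 3} (∣-resp e (∣n⇒∣m*n (+ 2) 3∣z′)) (∣m⇒∣-m 3∣z))
    by-cases : Dec (3 ℕ∣.∣ ℤ.∣ z ∣) → Goal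
    by-cases (no 3∤z)   = finish s-odd t-odd z-odd 3∣s (3∤z ∘ ∣⇒∣ᵤ) eq
    by-cases (yes 3∣ᵤz) =
      let t′ , z′ , t′-odd , z′-odd , norm , half = rotate t-odd z-odd in
      finish s-odd t′-odd z′-odd 3∣s (λ 3∣z′ → not-divisible s t z 3∣s (3∣t (∣ᵤ⇒∣ 3∣ᵤz) half 3∣z′) eq)
        (replace-norm s t z t′ z′ norm eq)

  result : OddTriple N → Goal
  result (s , t , z , s-odd , t-odd , z-odd , eq) = by-cases (3∣one-of-two s t (sum-mod-3 s t z eq))
    where
    by-cases : + 3 ∣ s ⊎ + 3 ∣ t → Goal
    by-cases (inj₁ 3∣s) = avoid-3 s-odd t-odd z-odd 3∣s eq
    by-cases (inj₂ 3∣t) = avoid-3 t-odd s-odd z-odd 3∣t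
      (trans eq (cong (_+ + 3 * (z * z)) (ℤ.+-comm (s * s) (t * t))))

-- Part (b), from representations of 120n + 77

module PartB (n N : ℤ) (N≡ : N ≡ + 120 * n + + 77) where

  Goal : Set
  Goal = ∃[ x ] ∃[ y ] ∃[ z ] (n ≡ + 3 * p 3 x + p 5 y + p 7 z)

  -- 360 p₃(x) + 45 = 5 (3 (2x + 1))², 120 p₅(y) + 5 = 5 (6y - 1)² and 120 p₇(z) + 27 = 3 (10z -
  -- 3)²; the constants add up to 77.
  conclude : ∀ x y z → N ≡ + 5 *
    (+ 3 * (+ 2 * x + 1ℤ) * (+ 3 * (+ 2 * x + 1ℤ)) + (+ 6 * y - 1ℤ) * (+ 6 * y - 1ℤ)) + + 3 *
    ((+ 10 * z - + 3) * (+ 10 * z - + 3)) → Goal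
  conclude x y z eq = x , y , z , ℤ.*-cancelˡ-≡ (+ 120) n (+ 3 * p 3 x + p 5 y + p 7 z) (begin
    + 120 * n                                                      ≡⟨ trans (isolate n) (cong (_- + 77) (sym N≡)) ⟩
    N - + 77                                                       ≡⟨ trans (cong (_- + 77) eq) (expand x y z) ⟩
    + 60 * (+ 3 * (1ℤ * (x * x - x) + + 2 * x) + (+ 3 * (y * y - y) + + 2 * y) + (+ 5 * (z * z - z) + + 2 * z))
      ≡⟨ cong (+ 60 *_) (cong₂ _+_ (cong₂ _+_ (cong (+ 3 *_) (twice-p 3 x)) (twice-p 5 y)) (twice-p 7 z)) ⟨
    + 60 * (+ 3 * (+ 2 * p 3 x) + + 2 * p 5 y + + 2 * p 7 z)       ≡⟨ collect (p 3 x) (p 5 y) (p 7 z) ⟩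
    + 120 * (+ 3 * p 3 x + p 5 y + p 7 z)                          ∎)
    where
    open ≡-Reasoning
    isolate : ∀ n → + 120 * n ≡ + 120 * n + + 77 - + 77
    isolate = solve-∀
    expand : ∀ x y z → + 5 * (+ 3 * (+ 2 * x + 1ℤ) * (+ 3 * (+ 2 * x + 1ℤ)) + (+ 6 * y - 1ℤ) * (+ 6 * y - 1ℤ))
      + + 3 * ((+ 10 * z - + 3) * (+ 10 * z - + 3)) - + 77 ≡
      + 60 * (+ 3 * (1ℤ * (x * x - x) + + 2 * x) + (+ 3 * (y * y - y) + + 2 * y) + (+ 5 * (z * z - z) + + 2 * z))
    expand = solve-∀
    collect : ∀ a b c → + 60 * (+ 3 * (+ 2 * a) + + 2 * b + + 2 * c) ≡ + 120 * (+ 3 * a + b + c)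
    collect = solve-∀

  sum-mod-3 : ∀ A B z → N ≡ + 5 * (A * A + B * B) + + 3 * (z * z) → A * A + B * B ≡ 1ℤ [mod + 3 ]
  sum-mod-3 A B z eq = congruent (divides (+ 2 * (A * A + B * B) + z * z - + 40 * n - + 26)
    (trans (isolate N (A * A + B * B))
      (trans (cong₂ (λ u v → A * A + B * B - 1ℤ + (u - v)) eq N≡) (lem n (A * A + B * B) (z * z)))))
    where
    isolate : ∀ N a → a - 1ℤ ≡ a - 1ℤ + (N - N)
    isolate = solve-∀
    lem : ∀ n a c → a - 1ℤ + (+ 5 * a + + 3 * c - (+ 120 * n + + 77)) ≡ (+ 2 * a + c - + 40 * n - + 26) * + 3
    lem = solve-∀

  B²-mod-3 : ∀ A B z → + 3 ∣ A → N ≡ + 5 * (A * A + B * B) + + 3 * (z * z) → B * B ≡ 1ℤ [mod + 3 ]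
  B²-mod-3 A B z 3∣A eq = mod-trans (mod-reflexive (sym (ℤ.+-identityˡ (B * B))))
    (mod-trans (mod-+ (mod-sym (∣⇒mod-0 (∣m⇒∣m*n A 3∣A))) (mod-reflexive {a = B * B} refl)) (sum-mod-3 A B z eq))

  finish : ∀ {A B z} → Odd A → Odd B → Odd z → z * z ≡ + 4 [mod + 5 ] → + 3 ∣ A → N ≡ + 5 * (A * A + B * B)
    + + 3 * (z * z) → Goal
  finish {A} {B} {z} A-odd B-odd z-odd z²≡4 3∣A eq =
    let x , A≡  = odd-third A-odd 3∣A
        y , B²≡ = unit-mod-6 B-odd (B²-mod-3 A B z 3∣A eq)
        w , z²≡ = unit-mod-10 z-odd z²≡4
        eq′     = trans eq (cong (λ u → + 5 * (u * u + B * B) + + 3 * (z * z)) A≡)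
    in conclude x y w (trans eq′
      (cong₂ (λ u v → + 5 * (+ 3 * (+ 2 * x + 1ℤ) * (+ 3 * (+ 2 * x + 1ℤ)) + u) + + 3 * v) B²≡ z²≡))

  split-3 : ∀ {A B z} → Odd A → Odd B → Odd z → z * z ≡ + 4 [mod + 5 ] → N ≡ + 5 * (A * A + B * B) + + 3 *
    (z * z) → Goal
  split-3 {A} {B} {z} A-odd B-odd z-odd z²≡4 eq = by-cases (3∣one-of-two A B (sum-mod-3 A B z eq))
    where
    by-cases : + 3 ∣ A ⊎ + 3 ∣ B → Goal
    by-cases (inj₁ 3∣A) = finish A-odd B-odd z-odd z²≡4 3∣A eq
    by-cases (inj₂ 3∣B) = finish B-odd A-odd z-odd z²≡4 3∣B
      (trans eq (cong (λ u → + 5 * u + + 3 * (z * z)) (ℤ.+-comm (A * A) (B * B))))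

  -- Division by 2 + i in the Gaussian integers: with s = 5q + 2t the quotient of s + t i is (2q +
  -- t) - q i, whose norm is a fifth of s² + t². Both parts are odd because s and t are.
  from-multiple : ∀ {s t z} → Odd s → Odd t → Odd z → z * z ≡ + 4 [mod + 5 ] → + 5 ∣ s - + 2 * t → N ≡ s * s + t
    * t + + 3 * (z * z) → Goal
  from-multiple {s} {t} {z} (a , s≡) (b , t≡) z-odd z²≡4 (divides q eq′) eq =
    split-3 {+ 2 * q + t} {q} (q + b , trans (cong (λ u → + 2 * q + u) t≡) (odd q b)) q-odd z-odd z²≡4
      (trans eq (trans (cong (λ u → u * u + t * t + + 3 * (z * z)) s-expanded) (norm q t z)))
    where
    odd : ∀ q b → + 2 * q + (b + b + 1ℤ) ≡ (q + b) + (q + b) + 1ℤ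
    odd = solve-∀
    isolate : ∀ s t → s ≡ s - + 2 * t + + 2 * t
    isolate = solve-∀
    s-expanded : s ≡ q * + 5 + + 2 * t
    s-expanded = trans (isolate s t) (cong (_+ + 2 * t) eq′)
    norm : ∀ q t z → (q * + 5 + + 2 * t) * (q * + 5 + + 2 * t) + t * t + + 3 * (z * z) ≡ + 5 *
      ((+ 2 * q + t) * (+ 2 * q + t) + q * q) + + 3 * (z * z)
    norm = solve-∀
    isolate′ : ∀ q t → + 5 * q ≡ q * + 5 + + 2 * t - + 2 * t
    isolate′ = solve-∀
    odd′ : ∀ a t → a + a + 1ℤ - + 2 * t ≡ (a - t) + (a - t) + 1ℤ
    odd′ = solve-∀
    q-odd : Odd q
    q-odd = odd-multiple {q} (+ 5)
      (a - t , trans (isolate′ q t) (trans (cong (_- + 2 * t) (trans (sym s-expanded) s≡)) (odd′ a t)))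

  -- From z² ≡ 4 it follows that s² + t² ≡ 77 - 12 ≡ 0 (mod 5), that is s² ≡ 4t². The sign of t is
  -- free and selects the factor of s² - 4t² that 5 divides.
  split-5 : ∀ {s t z} → Odd s → Odd t → Odd z → z * z ≡ + 4 [mod + 5 ] → N ≡ s * s + t * t + + 3 * (z * z) → Goal
  split-5 {s} {t} {z} s-odd t-odd z-odd z²≡4 eq =
    by-cases (prime-∣-* {5} (from-yes (prime? 5)) (s - + 2 * t) (s + + 2 * t) (factored (divides-difference z²≡4)))
    where
    isolate : ∀ s t z → (s - + 2 * t) * (s + + 2 * t) ≡ (s * s + t * t + + 3 * (z * z)) - + 3 * (z * z - + 4)
      - + 12 - + 5 * (t * t)
    isolate = solve-∀
    lem : ∀ n c d → + 120 * n + + 77 - + 3 * (c * + 5) - + 12 - + 5 * d ≡ (+ 24 * n + + 13 - + 3 * c - d) * + 5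
    lem = solve-∀
    factored : + 5 ∣ z * z - + 4 → + 5 ∣ (s - + 2 * t) * (s + + 2 * t)
    factored (divides c z²-4) = divides (+ 24 * n + + 13 - + 3 * c - t * t)
      (trans (isolate s t z) (trans
        (cong₂ (λ u v → u - + 3 * v - + 12 - + 5 * (t * t)) (trans (sym eq) N≡) z²-4) (lem n c (t * t))))
    odd : ∀ b → - (b + b + 1ℤ) ≡ - b - 1ℤ + (- b - 1ℤ) + 1ℤ
    odd = solve-∀
    flip : ∀ s t → s + + 2 * t ≡ s - + 2 * - t
    flip = solve-∀
    square : ∀ t → t * t ≡ - t * - t
    square = solve-∀
    by-cases : + 5 ∣ s - + 2 * t ⊎ + 5 ∣ s + + 2 * t → Goal
    by-cases (inj₁ d) = from-multiple s-odd t-odd z-odd z²≡4 d eq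
    by-cases (inj₂ d) = from-multiple {s} { - t} s-odd
      (- proj₁ t-odd - 1ℤ , trans (cong -_ (proj₂ t-odd)) (odd (proj₁ t-odd))) z-odd z²≡4
      (∣-resp (flip s t) d) (trans eq (cong (λ u → s * s + u + + 3 * (z * z)) (square t)))

  -- 2z′ = t ± z and t z ≡ 0 give 4 z′² ≡ t² + z² ≡ 1 (mod 5), and 4 is its own inverse.
  after-rotation : ∀ {s t z} → Odd s → Odd t → Odd z → + 5 ∣ t * z → t * t + z * z ≡ 1ℤ [mod + 5 ] → N ≡ s * s
    + t * t + + 3 * (z * z) → Goal
  after-rotation {s} {t} {z} s-odd t-odd z-odd (divides c tz) (congruent (divides d t²+z²)) eq =
    let t′ , z′ , t′-odd , z′-odd , norm , half = rotate t-odd z-odd in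
    split-5 s-odd t′-odd z′-odd (congruent (z′²≡4 z′ half)) (replace-norm s t z t′ z′ norm eq)
    where
    expand : ∀ w → w * w - + 4 ≡ + 5 * (w * w) - (+ 2 * w) * (+ 2 * w) - + 4
    expand = solve-∀
    minus : ∀ w t z → + 5 * (w * w) - (t - z) * (t - z) - + 4 ≡ + 5 * (w * w) - (t * t + z * z - 1ℤ) + + 2 *
      (t * z) - + 5
    minus = solve-∀
    plus : ∀ w t z → + 5 * (w * w) - (t + z) * (t + z) - + 4 ≡ + 5 * (w * w) - (t * t + z * z - 1ℤ) - + 2 *
      (t * z) - + 5
    plus = solve-∀
    minus′ : ∀ w c d → + 5 * (w * w) - d * + 5 + + 2 * (c * + 5) - + 5 ≡ (w * w - d + + 2 * c - 1ℤ) * + 5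
    minus′ = solve-∀
    plus′ : ∀ w c d → + 5 * (w * w) - d * + 5 - + 2 * (c * + 5) - + 5 ≡ (w * w - d - + 2 * c - 1ℤ) * + 5
    plus′ = solve-∀
    z′²≡4 : ∀ z′ → + 2 * z′ ≡ t - z ⊎ + 2 * z′ ≡ t + z → + 5 ∣ z′ * z′ - + 4
    z′²≡4 z′ (inj₁ e) = divides (z′ * z′ - d + + 2 * c - 1ℤ)
      (trans (expand z′) (trans (cong (λ u → + 5 * (z′ * z′) - u * u - + 4) e) (trans (minus z′ t z)
      (trans (cong₂ (λ u v → + 5 * (z′ * z′) - u + + 2 * v - + 5) t²+z² tz) (minus′ z′ c d)))))
    z′²≡4 z′ (inj₂ e) = divides (z′ * z′ - d - + 2 * c - 1ℤ)
      (trans (expand z′) (trans (cong (λ u → + 5 * (z′ * z′) - u * u - + 4) e) (trans (plus z′ t z)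
      (trans (cong₂ (λ u v → + 5 * (z′ * z′) - u - + 2 * v - + 5) t²+z² tz) (plus′ z′ c d)))))

  residues : ∀ s t z → s * s + t * t + + 3 * (z * z) ≡ + 2 [mod + 5 ] →
    z * z ≡ + 4 [mod + 5 ] ⊎ (+ 5 ∣ t * z × t * t + z * z ≡ 1ℤ [mod + 5 ]) ⊎
      (+ 5 ∣ s * z × s * s + z * z ≡ 1ℤ [mod + 5 ])
  residues s t z hyp = lift (residues-mod-5 (ℤ.n%ℕd<d s 5) (ℤ.n%ℕd<d t 5) (ℤ.n%ℕd<d z 5)
    (mod⇒% 5 (mod-trans (mod-+ (residue-sum 5 s t)
      (mod-trans (mod-reflexive (ℤ.pos-* 3 (k ℕ.* k)))
      (mod-* (mod-reflexive {a = + 3} refl) (mod-square (residue-mod z 5))))) hyp)))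
    where
    i j k : ℕ
    i = s ℤ.%ℕ 5
    j = t ℤ.%ℕ 5
    k = z ℤ.%ℕ 5
    from-% : ∀ {a r x} → + a ≡ x [mod + 5 ] → a % 5 ≡ r → x ≡ + r [mod + 5 ]
    from-% {a} p eq = mod-trans (mod-sym p) (mod-trans (%-mod a 5) (mod-reflexive (cong (λ u → + u) eq)))
    product : ∀ x y → + (x ℤ.%ℕ 5 ℕ.* (y ℤ.%ℕ 5)) ≡ x * y [mod + 5 ]
    product x y = mod-trans (mod-reflexive (ℤ.pos-* (x ℤ.%ℕ 5) (y ℤ.%ℕ 5)))
      (mod-* (residue-mod x 5) (residue-mod y 5))
    lift : (k ℕ.* k) % 5 ≡ 4 ⊎ ((j ℕ.* k) % 5 ≡ 0 × (j ℕ.* j ℕ.+ k ℕ.* k) % 5 ≡ 1) ⊎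
      ((i ℕ.* k) % 5 ≡ 0 × (i ℕ.* i ℕ.+ k ℕ.* k) % 5 ≡ 1) →
      z * z ≡ + 4 [mod + 5 ] ⊎ (+ 5 ∣ t * z × t * t + z * z ≡ 1ℤ [mod + 5 ]) ⊎
        (+ 5 ∣ s * z × s * s + z * z ≡ 1ℤ [mod + 5 ])
    lift (inj₁ e)              = inj₁ (from-% (product z z) e)
    lift (inj₂ (inj₁ (e , f))) = inj₂ (inj₁ (mod-0⇒∣ (from-% (product t z) e) , from-% (residue-sum 5 t z) f))
    lift (inj₂ (inj₂ (e , f))) = inj₂ (inj₂ (mod-0⇒∣ (from-% (product s z) e) , from-% (residue-sum 5 s z) f))

  result : OddTriple N → Goal
  result (s , t , z , s-odd , t-odd , z-odd , eq) = by-cases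
    (residues s t z (mod-trans (mod-reflexive (trans (sym eq) N≡)) (congruent (divides (+ 24 * n + + 15) (lem n)))))
    where
    lem : ∀ n → + 120 * n + + 77 - + 2 ≡ (+ 24 * n + + 15) * + 5
    lem = solve-∀
    by-cases : z * z ≡ + 4 [mod + 5 ] ⊎ (+ 5 ∣ t * z × t * t + z * z ≡ 1ℤ [mod + 5 ]) ⊎
      (+ 5 ∣ s * z × s * s + z * z ≡ 1ℤ [mod + 5 ]) → Goal
    by-cases (inj₁ z²≡4)                     = split-5 s-odd t-odd z-odd z²≡4 eq
    by-cases (inj₂ (inj₁ (5∣tz , t²+z²≡1))) = after-rotation s-odd t-odd z-odd 5∣tz t²+z²≡1 eq
    by-cases (inj₂ (inj₂ (5∣sz , s²+z²≡1))) = after-rotation t-odd s-odd z-odd 5∣sz s²+z²≡1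
      (trans eq (cong (_+ + 3 * (z * z)) (ℤ.+-comm (s * s) (t * t))))

theorem1p2 : ((n : ℕ) → ∃[ x ] ∃[ y ] ∃[ z ] (+ n ≡ p 3 x + p 5 y + p 11 z))
    × ((n : ℕ) → ∃[ x ] ∃[ y ] ∃[ z ] (+ n ≡ + 3 * p 3 x + p 5 y + p 7 z))
theorem1p2 =
  (λ n → PartA.result (+ n) _ (trans (cong (λ t → + t) (partA n)) (cong (_+ + 61) (ℤ.pos-* 72 n)))
    (odd-triple-13 (3 ℕ.* n ℕ.+ 2))) ,
  (λ n → PartB.result (+ n) _ (trans (cong (λ t → + t) (partB n)) (cong (_+ + 77) (ℤ.pos-* 120 n)))
    (odd-triple-5 (5 ℕ.* n ℕ.+ 3)))
  where
  partA : ∀ n → 13 ℕ.+ 24 ℕ.* (3 ℕ.* n ℕ.+ 2) ≡ 72 ℕ.* n ℕ.+ 61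
  partA = ℕ-solve-∀
  partB : ∀ n → 5 ℕ.+ 24 ℕ.* (5 ℕ.* n ℕ.+ 3) ≡ 120 ℕ.* n ℕ.+ 77
  partB = ℕ-solve-∀
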